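{- Let $\mathbb{F}$ be a field, $f\in\mathbb{F}[x_1,\ldots,x_n]\setminus\mathbb{F}$, and let $e\ge 2$ be an integer. The reconstruction procedure described in the context, run on input $(f,e)$, has the following property. (1) If there exists $g\in\mathbb{F}[x_1,\ldots,x_n]$ with $f=g^e$, then the procedure outputs a polynomial $\tilde g\in\mathbb{F}[x_1,\ldots,x_n]$ satisfying $\tilde g^e=f$. (2) If no such $g\in\mathbb{F}[x_1,\ldots,x_n]$ exists, then the procedure outputs "not an $e$-th power".
   Context: Notation: $\mathbf{x}^{\mathbf{u}}=x_1^{u_1}\cdots x_n^{u_n}$, $\langle\mathbf{u},\mathbf{k}\rangle=\sum_i u_ik_i$, $\operatorname{supp}(f)\subset\mathbb{N}^n$ is the set of exponent vectors of $f$ with nonzero coefficient, and $d=\operatorname{indeg}(f)$ is the maximum exponent of any single variable in any monomial of $f$. The reconstruction procedure on input $(f,e)$: 1. Choose $\mathbf{k}=(k_1,\ldots,k_n)\in\{1,\ldots,2d+2\}^n$ such that $\langle\mathbf{u},\mathbf{k}\rangle$ has a unique minimizer $\mathbf{a}$ over $\mathbf{u}\in\operatorname{supp}(f)$ (such $\mathbf{k}$ exists), and let $c\,\mathbf{x}^{\mathbf{a}}$ be the corresponding term of $f$. 2. Set $k_f=\langle\mathbf{a},\mathbf{k}\rangle$, $F^\sharp=y^{ -k_f}f(x_1y^{k_1},\ldots,x_ny^{k_n})\in\mathbb{F}[x_1,\ldots,x_n,y]$, and $\alpha=c\,\mathbf{x}^{\mathbf{a}}$ (so $F^\sharp|_{y=0}=\alpha$).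 3. If $c$ has no $e$-th root in $\mathbb{F}$, or some coordinate of $\mathbf{a}$ is not divisible by $e$, return "not an $e$-th power". 4. Choose $\beta\in\mathbb{F}^*$ and $\mathbf{b}\in\mathbb{N}^n$ with $\beta^e=c$, $e\mathbf{b}=\mathbf{a}$, and set $B=\beta\mathbf{x}^{\mathbf{b}}$. 5. Form $H=\alpha^{ -1}F^\sharp(x_1,\ldots,x_n,y\alpha)$, which is a polynomial in $\mathbb{F}[x_1,\ldots,x_n,y]$ with $H|_{y=0}=1$. 6. Let $p=\operatorname{char}(\mathbb{F})$. If $p>0$ and $p\mid e$, write $e=p^rq$ with $p\nmid q$. If for every term $A\,\mathbf{x}^{\mathbf{u}}y^{u_y}$ of $H$ all coordinates of $(\mathbf{u},u_y)$ are divisible by $p^r$ and $A$ has a (necessarily unique) $p^r$-th root $A^{1/p^r}$ in $\mathbb{F}$, replace $H$ by the polynomial obtained by replacing each such term by $A^{1/p^r}\mathbf{x}^{\mathbf{u}/p^r}y^{u_y/p^r}$; otherwise return "not an $e$-th power". If $p=0$ or $p\nmid e$, set $q=e$ and leave $H$ unchanged. 7. Let $N=\lfloor \deg_y(F^\sharp)/q\rfloor$ and let $R_0$ be the representative of $y$-degree at most $N$ of \[\sum_{i=0}^{N}\binom{1/q}{i}(H-1)^i \bmod y^{N+1}.\] Here $\binom{1/q}{i}\in\mathbb{F}$ is the image in $\mathbb{F}$ of the rational number $\frac{(1/q)(1/q-1)\cdots(1/q-i+1)}{i!}\in\mathbb{Z}[1/q]$, which is meaningful since $q$ is invertible in $\mathbb{F}$.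 8. Form the Laurent expression $G^\sharp_{\mathrm{cand}}=B\,R_0(x_1,\ldots,x_n,y/\alpha)$. If it is not in $\mathbb{F}[x_1,\ldots,x_n,y]$, return "not an $e$-th power". 9. Set $g_{\mathrm{cand}}=G^\sharp_{\mathrm{cand}}(x_1,\ldots,x_n,1)$. If $g_{\mathrm{cand}}\in\mathbb{F}[x_1,\ldots,x_n]$ and $g_{\mathrm{cand}}^e=f$ (with the original input $e$), return $g_{\mathrm{cand}}$; otherwise return "not an $e$-th power". -}

module Defs where

open import Algebra.Apartness.Bundles using (HeytingField; HeytingCommutativeRing)
open import Algebra.Bundles using (CommutativeRing; RawRing)
import Algebra.Definitions.RawSemiring as RawSemiringDefinitions
open import Data.Bool.Base using (if_then_else_)
open import Data.Fin.Base using (Fin; zero; suc; toℕ)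
open import Data.Integer.Base as ℤ using (ℤ; -[1+_]) renaming (+_ to pos)
import Data.Integer.Properties as ℤ
open import Data.List.Base as List using (List; []; _∷_; _++_)
open import Data.Nat.Base as ℕ using (ℕ; zero; suc; _≤_; _<_; NonZero; _!)
import Data.Nat.Properties as ℕ
open import Data.Nat.Divisibility using (_∣_; _∤_)
import Data.Nat.Divisibility as ∣
open import Data.Nat.DivMod using (_/_)
open import Data.Product.Base using (Σ; ∃; ∃-syntax; _×_; _,_; proj₁; map₂)
open import Data.Rational.Base as ℚ using (ℚ; 1ℚ)
open import Data.Sum.Base using (_⊎_)
open import Data.Vec.Base as Vec using (Vec; lookup; replicate; zipWith; _[_]≔_)
import Data.Vec.Properties as Vec
import Data.Vec.Functional as Vector
open import Function.Base using (_∘_)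
open import Function.Bundles using (_⇔_)
open import Level using (_⊔_)
open import Relation.Binary.Definitions using (DecidableEquality)
open import Relation.Binary.PropositionalEquality using (_≡_; _≢_; subst; sym)
open import Relation.Nullary using (¬_; does)

-- The procedure below is given by its total-correctness semantics: the
-- type at each step says that the rest of the procedure, started there,
-- ends in an output satisfying a given postcondition, however the choices
-- are made.  A step "choose an object of type A" therefore asks both that
-- there is such an object and that every such object is acceptable.
-- Quantities that are determined uniquely, but only by a property, are
-- introduced in the same way.

choose : ∀ {a s} (A : Set a) (S : A → Set s) → Set (a ⊔ s)
choose A S = A × ((x : A) → S x)

when_do′_otherwise_ : ∀ {q s t} → Set q → Set s → Set t → Set (q ⊔ s ⊔ t)
when Q do′ S otherwise T = (Q → S) × (¬ Q → T)

record Exponents : Set₁ where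
  field
    Exp : Set
    _≟_ : DecidableEquality Exp
    _∙_ : Exp → Exp → Exp
    ε   : Exp

open Exponents using (Exp)

ℕ^ ℤ^ : ℕ → Exponents
ℕ^ n = record
  { Exp = Vec ℕ n ; _≟_ = Vec.≡-dec ℕ._≟_ ; _∙_ = zipWith ℕ._+_ ; ε = replicate n 0 }
ℤ^ n = record
  { Exp = Vec ℤ n ; _≟_ = Vec.≡-dec ℤ._≟_ ; _∙_ = zipWith ℤ._+_ ; ε = replicate n (pos 0) }

⟨_,_⟩ : ∀ {n} → Vec ℕ n → Vec ℕ n → ℕ
⟨ u , k ⟩ = Vec.sum (zipWith ℕ._*_ u k)

fallingFactorial : ℚ → ℕ → ℚ
fallingFactorial x zero    = 1ℚ
fallingFactorial x (suc i) = fallingFactorial x i ℚ.* (x ℚ.- (pos i ℚ./ 1))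

binomial : ℚ → ℕ → ℚ
binomial x i = fallingFactorial x i ℚ.* (ℚ._/_ (pos 1) (i !) {{i ℕ.!≢0}})

-- Classically, a Heyting field is the same thing as a field, with x # y
-- meaning x ≉ y.
module Reconstruction {c ℓ₁ ℓ₂} (F : HeytingField c ℓ₁ ℓ₂) where

  private
    module F where
      open HeytingField F public
      open CommutativeRing (HeytingCommutativeRing.commutativeRing heytingCommutativeRing) public
        using (rawRing)
      open RawSemiringDefinitions (RawRing.rawSemiring rawRing) public
        using (_^_) renaming (_×_ to _·_)

  open F using (Carrier; _≈_; _#_; 0#; 1#)

  fromℤ : ℤ → Carrier
  fromℤ (pos n)  = n F.· 1#
  fromℤ -[1+ n ] = F.- (suc n F.· 1#)

  -- The library inverts x - y for x # y, so this is the inverse of x - 0#.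
  inverse : ∀ {x} → x # 0# → Carrier
  inverse x#0 = proj₁ (F.#⇒invertible x#0)

  Characteristic : ℕ → Set ℓ₁
  Characteristic p = ∀ m → (m F.· 1# ≈ 0#) ⇔ (p ∣ m)

  HasRoot : ℕ → Carrier → Set (c ⊔ ℓ₁)
  HasRoot m x = ∃[ z ] z F.^ m ≈ x

  -- z is the image of r under ℤ[1/q] → F (for q invertible in F).
  IsImage : (q : ℕ) .{{_ : NonZero q}} → ℚ → Carrier → Set ℓ₁
  IsImage q r z = ∃[ m ] ∃[ s ]
    (r ≡ ℚ._/_ m (q ℕ.^ s) {{ℕ.m^n≢0 q s}}) × (z F.* (q F.· 1#) F.^ s ≈ fromℤ m)

  -- Formal sums of terms; an exponent may be repeated and coefficients may
  -- vanish, so equality is equality of all coefficients.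
  record Sum (X : Exponents) : Set c where
    constructor ⟪_⟫
    field
      terms : List (Carrier × Exp X)

  open Sum

  Poly Laurent : ℕ → Set c
  Poly n    = Sum (ℕ^ n)
  Laurent n = Sum (ℤ^ n)

  module _ {X : Exponents} where
    private module X = Exponents X

    coeff : Sum X → Exp X → Carrier
    coeff p u = List.foldr
      (λ (x , v) s → if does (v X.≟ u) then x F.+ s else s) 0# (terms p)

    infix 4 _≈ₚ_ _∈supp_

    _≈ₚ_ : Sum X → Sum X → Set ℓ₁
    p ≈ₚ q = ∀ u → coeff p u ≈ coeff q u

    _∈supp_ : Exp X → Sum X → Set ℓ₂
    u ∈supp p = coeff p u # 0#

    monomial : Carrier → Exp X → Sum X
    monomial x u = ⟪ (x , u) ∷ [] ⟫

    const : Carrier → Sum X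
    const x = monomial x X.ε

    rawRing : RawRing c ℓ₁
    rawRing = record
      { Carrier = Sum X
      ; _≈_     = _≈ₚ_
      ; _+_     = λ p q → ⟪ terms p ++ terms q ⟫
      ; _*_     = λ p q → ⟪ List.cartesianProductWith
                              (λ (x , u) (z , v) → x F.* z , u X.∙ v) (terms p) (terms q) ⟫
      ; -_      = λ p → ⟪ List.map (λ (x , u) → F.- x , u) (terms p) ⟫
      ; 0#      = ⟪ [] ⟫
      ; 1#      = const 1#
      }

    open RawRing rawRing public using (_+_; _*_; -_)
    open RawSemiringDefinitions (RawRing.rawSemiring rawRing) public
      using (_^_; sum; product)

    eval : ∀ {n} → Vector.Vector (Sum X) n → Poly n → Sum X
    eval t p = List.foldr
      (λ (x , u) s → const x * product (λ i → t i ^ lookup u i) + s) ⟪ [] ⟫ (terms p)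

  embed : ∀ {n} → Poly n → Laurent n
  embed p = ⟪ List.map (map₂ (Vec.map pos)) (terms p) ⟫

  var : ∀ {n} → Fin n → Poly n
  var {n} i = monomial 1# (replicate n 0 [ i ]≔ 1)

  IsConstant : ∀ {n} → Poly n → Set (c ⊔ ℓ₁)
  IsConstant f = ∃[ x ] f ≈ₚ const x

  -- F[x₁,…,xₙ,y] is Poly (suc n), with y as the variable of index zero.
  y : ∀ {n} → Poly (suc n)
  y = var zero

  x : ∀ {n} → Fin n → Poly (suc n)
  x i = var (suc i)

  truncate : ∀ {n} → ℕ → Poly (suc n) → Poly (suc n)
  truncate N p = ⟪ List.filter (λ (_ , u) → Vec.head u ℕ.≤? N) (terms p) ⟫

  IsMaximum : ∀ {s} → (ℕ → Set s) → ℕ → Set s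
  IsMaximum S m = S m × (∀ j → S j → j ≤ m)

  IsIndeg : ∀ {n} → Poly n → ℕ → Set ℓ₂
  IsIndeg f = IsMaximum (λ j → ∃[ u ] ∃[ i ] (u ∈supp f) × (lookup u i ≡ j))

  IsYDegree : ∀ {n} → Poly (suc n) → ℕ → Set ℓ₂
  IsYDegree p = IsMaximum (λ j → ∃[ u ] ((j Vec.∷ u) ∈supp p))

  record Weights {n} (f : Poly n) (d : ℕ) : Set ℓ₂ where
    field
      k         : Vec ℕ n
      1≤k≤2d+2  : ∀ i → (1 ≤ lookup k i) × (lookup k i ≤ 2 ℕ.* d ℕ.+ 2)
      a         : Vec ℕ n
      a∈supp    : a ∈supp f
      a-minimal : ∀ u → u ∈supp f → u ≢ a → ⟨ a , k ⟩ < ⟨ u , k ⟩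

  record TermRoot {n} (e : ℕ) (z : Carrier) (a : Vec ℕ n) : Set (c ⊔ ℓ₁ ⊔ ℓ₂) where
    field
      β    : Carrier
      β#0  : β # 0#
      β^e  : β F.^ e ≈ z
      b    : Vec ℕ n
      eb≡a : Vec.map (e ℕ.*_) b ≡ a

  record Split (p e : ℕ) : Set where
    field
      r q   : ℕ
      e≡pʳq : e ≡ p ℕ.^ r ℕ.* q
      p∤q   : p ∤ q

    q≢0 : NonZero q
    q≢0 = ℕ.≢-nonZero (λ q≡0 → p∤q (subst (p ∣_) (sym q≡0) (p ∣.∣0)))

  TermsArePowers : ∀ {n} → ℕ → Poly n → Set (c ⊔ ℓ₁ ⊔ ℓ₂)
  TermsArePowers m H =
    ∀ u → u ∈supp H → (∀ i → m ∣ lookup u i) × HasRoot m (coeff H u)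

  -- The polynomial obtained by replacing each term A·x^u of H by
  -- A^{1/m}·x^{u/m}, described through its coefficients.  It is unique when m
  -- is a power of the characteristic, as m-th roots are then unique, and
  -- H is as in TermsArePowers.
  TermwiseRoot : ∀ {n} → ℕ → Poly n → Set (c ⊔ ℓ₁)
  TermwiseRoot {n} m H =
    Σ (Poly n) λ H′ → ∀ v → coeff H′ v F.^ m ≈ coeff H (Vec.map (m ℕ.*_) v)

  BinomialImages : (q : ℕ) .{{_ : NonZero q}} → Set (c ⊔ ℓ₁)
  BinomialImages q = (i : ℕ) → ∃ (IsImage q (binomial (pos 1 ℚ./ q) i))

  -- Σ_{i=0}^{N} binom(1/q,i) (H-1)^i mod y^{N+1}
  truncatedRoot : ∀ {n} (q : ℕ) .{{_ : NonZero q}} →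
                  BinomialImages q → ℕ → Poly (suc n) → Poly (suc n)
  truncatedRoot q γ N H =
    truncate N (sum {n = suc N} (λ i →
      const (proj₁ (γ (toℕ i))) * (H + - const 1#) ^ toℕ i))

  data Output (n : ℕ) : Set c where
    returns       : Poly n → Output n
    notAnEthPower : Output n

  reconstruct : ∀ {n s} (f : Poly n) (e : ℕ) → 2 ≤ e →
                (Output n → Set s) → Set (c ⊔ ℓ₁ ⊔ ℓ₂ ⊔ s)
  reconstruct {n} {s} f e 2≤e Post =
    choose (∃ (IsIndeg f)) λ (d , _) →
    choose (Weights f d) steps2-9
    where
    steps2-9 : ∀ {d} → Weights f d → Set (c ⊔ ℓ₁ ⊔ ℓ₂ ⊔ s)
    steps2-9 W =
      choose (∃[ F♯ ] embed F♯ ≈ₚ y^-k_f * embed (eval (λ i → x i * y ^ lookup k i) f))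
        λ (F♯ , _) →
      when (¬ HasRoot e a-coeff ⊎ (∃[ i ] e ∤ lookup a i))
        do′ Post notAnEthPower
        otherwise (choose (TermRoot e a-coeff a) (steps5-9 F♯))
      where
      open Weights W

      a-coeff : Carrier
      a-coeff = coeff f a

      y^-k_f : Laurent (suc n)
      y^-k_f = monomial 1# (ℤ.- pos ⟨ a , k ⟩ Vec.∷ replicate n (pos 0))

      α : Poly (suc n)
      α = monomial a-coeff (0 Vec.∷ a)

      α⁻¹ : Laurent (suc n)
      α⁻¹ = monomial (inverse a∈supp) (Vec.map (λ j → ℤ.- pos j) (0 Vec.∷ a))

      steps5-9 : Poly (suc n) → TermRoot e a-coeff a → Set (c ⊔ ℓ₁ ⊔ ℓ₂ ⊔ s)
      steps5-9 F♯ ρ =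
        choose (∃[ H ] embed H ≈ₚ α⁻¹ * embed (eval ((y * α) Vector.∷ x) F♯)) λ (H , _) →
        choose (∃ Characteristic) λ (p , _) →
        when ((0 < p) × (p ∣ e))
          do′ (choose (Split p e) λ S → let open Split S in
               when TermsArePowers (p ℕ.^ r) H
                 do′ (choose (TermwiseRoot (p ℕ.^ r) H) λ (H′ , _) → steps7-9 q {{q≢0}} H′)
                 otherwise Post notAnEthPower)
          otherwise steps7-9 e {{ℕ.>-nonZero (ℕ.<-trans ℕ.z<s 2≤e)}} H
        where
        open TermRoot ρ

        B : Poly (suc n)
        B = monomial β (0 Vec.∷ b)

        steps7-9 : (q : ℕ) .{{_ : NonZero q}} → Poly (suc n) → Set (c ⊔ ℓ₁ ⊔ ℓ₂ ⊔ s)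
        steps7-9 q H =
          choose (∃ (IsYDegree F♯)) λ (D , _) →
          choose (BinomialImages q) λ γ →
          let R₀      = truncatedRoot q γ (D / q) H
              G♯-cand = embed B * eval ((embed y * α⁻¹) Vector.∷ (embed ∘ x)) R₀
              IsPoly  = ∃[ G ] embed G ≈ₚ G♯-cand
          in
          when IsPoly
            do′ (choose IsPoly λ (G , _) →
                 -- G(x₁,…,xₙ,1) is automatically a polynomial, since G is.
                 let g-cand = eval (const 1# Vector.∷ var) G in
                 when (g-cand ^ e ≈ₚ f)
                   do′ Post (returns g-cand)
                   otherwise Post notAnEthPower)
            otherwise Post notAnEthPower

-- Give f weights k with a unique lightest term c x^a.  The step from f to H is an
-- invertible monomial substitution (up to the factor c x^a), and everything in the
-- procedure is followed through such substitutions by evaluating linear functionals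
-- on formal sums.  If f = g^e, comparing extreme terms for monomial orders refining
-- the weight shows that g also has a unique lightest term γ x^b, with γ^e = c and
-- e b = a, and that e times the weight range of g is at most that of f.  The same
-- substitution therefore turns g into a polynomial G with G^e = H, G = 1 modulo y
-- and deg_y G ≤ N.  By the Frobenius identity, step 6 replaces H = (G^q)^{p^r} by
-- G^q.  Since the binomial series of (1 + T)^{1/q} has coefficients in ℤ[1/q] and
-- q-th power 1 + T, step 7 yields a q-th root of G^q modulo y^{N+1} that is 1 modulo
-- y; such a root is unique because q is invertible, so R₀ = G.  Undoing the
-- substitution gives (β/γ) g, whose e-th power is f because β^e = c = γ^e.

module Submission where

open import Defs
open import Algebra.Apartness.Bundles using (HeytingField; HeytingCommutativeRing)
import Algebra.Apartness.Properties.HeytingCommutativeRing as HeytingProperties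
open import Algebra.Bundles using (CommutativeRing)
import Algebra.Properties.CommutativeSemiring.Binomial as BinomialTheorem
import Algebra.Properties.CommutativeSemiring.Exp as ExpProperties
import Algebra.Properties.Ring as RingProperties
import Algebra.Properties.Semiring.Mult as MultProperties
import Algebra.Properties.Semiring.Sum as SumProperties
import Algebra.Solver.Ring.NaturalCoefficients.Default as SemiringSolver
open import Algebra.Structures using (IsCommutativeMonoid)
open import Axiom.ExcludedMiddle using (ExcludedMiddle)
open import Data.Bool.Base using (if_then_else_)
open import Data.Fin.Base as Fin using (Fin; zero; suc; toℕ; fromℕ; inject₁)
import Data.Fin.Properties as Fin
open import Data.Integer.Base as ℤ using (ℤ; -[1+_]) renaming (+_ to pos)
open import Data.Integer.Divisibility.Signed as ℤ∣ using () renaming (_∣_ to _∣ℤ_)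
import Data.Integer.Properties as ℤ
import Data.Integer.Solver as ℤSolver
open import Data.List.Base as List using (List; []; _∷_; _++_)
open import Data.List.Membership.Propositional using () renaming (_∈_ to _∈ₗ_)
import Data.List.Membership.Propositional.Properties as ∈ₗ
import Data.List.Properties as List
open import Data.List.Relation.Unary.Any using (here; there)
open import Data.Nat.Base as ℕ using (ℕ; zero; suc; _≤_; _<_; NonZero; z≤n; s≤s; _!)
open import Data.Nat.Combinatorics using (_C_; nCn≡1; nCk≡nC[n∸k]; nCk≡n!/k![n-k]!; k![n∸k]!∣n!)
import Data.Nat.DivMod as ℕ
open import Data.Nat.Divisibility using (_∣_; _∤_; divides; _∣?_)
import Data.Nat.Divisibility as ∣
import Data.Nat.Properties as ℕ
import Data.Nat.Solver as ℕSolver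
open import Data.Product.Base using (∃; ∃-syntax; _×_; _,_; proj₁; proj₂)
open import Data.Rational.Base as ℚ using (ℚ; 1ℚ)
import Data.Rational.Properties as ℚ
import Data.Rational.Solver as ℚSolver
open import Data.Rational.Unnormalised.Base as ℚᵘ using (mkℚᵘ; *≡*)
import Data.Rational.Unnormalised.Properties as ℚᵘ
open import Data.Sum.Base as ⊎ using (_⊎_; inj₁; inj₂)
open import Data.Vec.Base as Vec using (Vec; []; _∷_; lookup; replicate; zipWith; _[_]≔_)
import Data.Vec.Functional as Vector
import Data.Vec.Properties as Vec
open import Data.Vec.Relation.Binary.Pointwise.Inductive as Pointwise using (Pointwise; []; _∷_)
open import Function.Base using (_∘_)
open import Function.Bundles using (mk⇔; module Equivalence)
open import Level as Level using (_⊔_; Lift; lift; lower)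
open import Relation.Binary.Definitions using (tri<; tri≈; tri>)
open import Relation.Binary.PropositionalEquality as ≡ using (_≡_; _≢_)
import Relation.Binary.Reasoning.Setoid as SetoidReasoning
open import Relation.Nullary using (¬_; Dec; does; yes; no; contradiction)
import Relation.Nullary.Decidable as Dec

-- Power series and roots in filtered rings

-- Soundness costs nothing, since the last step tests the candidate. The work is to show that a root
-- g of f refutes every exit with failure, whatever choices the procedure makes; the root is
-- therefore a hypothesis only inside refutations, and one traversal serves both halves of the
-- theorem. Formal sums may repeat exponents and list cancelling terms, so neither their lists nor
-- their coefficients behave well under substitution. Functionals do: pairing a product or a
-- substituted sum with a functional is pairing the original with a composed one, and each
-- substitution is checked on exponents alone. The q-th power of the binomial series is found from a
-- differential equation. Solving it divides by positive integers, which may vanish in F, so it is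
-- solved over ℚ and the result is carried along the graph of ℤ[1/q] → F. The weights come from
-- geometry: with D = d + 1, an exponent of f farthest from the corner (D, ..., D) is the unique
-- minimizer for the direction from it to that corner, whose coordinates lie between 1 and d + 1.

module Series {c ℓ} (R : CommutativeRing c ℓ) where
  open CommutativeRing R
  open import Algebra.Properties.Semiring.Exp semiring
  open import Algebra.Properties.Semiring.Mult semiring
    using (×-congʳ; ×-assoc-*; ×-homo-+; ×-homo-1) renaming (_×_ to _·_)
  open import Algebra.Solver.Ring.NaturalCoefficients.Default commutativeSemiring
    using (solve; _:+_; _:*_; _:=_; con)
  open import Relation.Binary.Reasoning.Setoid setoid

  Seq : Set c
  Seq = ℕ → Carrier

  infix 4 _≋_
  _≋_ : Seq → Seq → Set ℓ
  s ≋ t = ∀ m → s m ≈ t m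

  one : Seq
  one zero    = 1#
  one (suc _) = 0#

  infixl 7 _⋆_
  -- The Cauchy product, by recursion along the left factor; `⋆-sucʳ` is the matching rule for the
  -- right one.
  _⋆_ : Seq → Seq → Seq
  (s ⋆ t) zero    = s 0 * t 0
  (s ⋆ t) (suc m) = s 0 * t (suc m) + (s ∘ suc ⋆ t) m

  infixr 8 _^⋆_
  _^⋆_ : Seq → ℕ → Seq
  s ^⋆ zero  = one
  s ^⋆ suc n = s ⋆ s ^⋆ n

  ⋆-congˡ : ∀ {s s′} t → s ≋ s′ → s ⋆ t ≋ s′ ⋆ t
  ⋆-congˡ t eq zero    = *-congʳ (eq 0)
  ⋆-congˡ t eq (suc m) = +-cong (*-congʳ (eq 0)) (⋆-congˡ t (eq ∘ suc) m)

  ⋆-congʳ : ∀ s {t t′} → t ≋ t′ → s ⋆ t ≋ s ⋆ t′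
  ⋆-congʳ s eq zero    = *-congˡ (eq 0)
  ⋆-congʳ s eq (suc m) = +-cong (*-congˡ (eq (suc m))) (⋆-congʳ (s ∘ suc) eq m)

  ⋆-distribʳ : ∀ s s′ t → (λ m → s m + s′ m) ⋆ t ≋ (λ m → (s ⋆ t) m + (s′ ⋆ t) m)
  ⋆-distribʳ s s′ t zero    = distribʳ _ _ _
  ⋆-distribʳ s s′ t (suc m) = trans
    (+-cong (distribʳ _ _ _) (⋆-distribʳ (s ∘ suc) (s′ ∘ suc) t m))
    (solve 4 (λ a b d e → (a :+ b) :+ (d :+ e) := (a :+ d) :+ (b :+ e)) refl _ _ _ _)

  ⋆-distribˡ : ∀ s t t′ → s ⋆ (λ m → t m + t′ m) ≋ (λ m → (s ⋆ t) m + (s ⋆ t′) m)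
  ⋆-distribˡ s t t′ zero    = distribˡ _ _ _
  ⋆-distribˡ s t t′ (suc m) = trans
    (+-cong (distribˡ _ _ _) (⋆-distribˡ (s ∘ suc) t t′ m))
    (solve 4 (λ a b d e → (a :+ b) :+ (d :+ e) := (a :+ d) :+ (b :+ e)) refl _ _ _ _)

  ⋆-scaleˡ : ∀ x s t → (λ m → x * s m) ⋆ t ≋ (λ m → x * (s ⋆ t) m)
  ⋆-scaleˡ x s t zero    = *-assoc _ _ _
  ⋆-scaleˡ x s t (suc m) =
    trans (+-cong (*-assoc _ _ _) (⋆-scaleˡ x (s ∘ suc) t m)) (sym (distribˡ _ _ _))

  ⋆-scaleʳ : ∀ x s t → s ⋆ (λ m → x * t m) ≋ (λ m → x * (s ⋆ t) m)
  ⋆-scaleʳ x s t zero    = solve 3 (λ s x t → s :* (x :* t) := x :* (s :* t)) refl _ _ _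
  ⋆-scaleʳ x s t (suc m) = trans (+-congˡ (⋆-scaleʳ x (s ∘ suc) t m))
    (solve 4 (λ s x t r → s :* (x :* t) :+ x :* r := x :* (s :* t :+ r)) refl _ _ _ _)

  ⋆-sucʳ : ∀ s t m → (s ⋆ t) (suc m) ≈ (s ⋆ t ∘ suc) m + s (suc m) * t 0
  ⋆-sucʳ s t zero    = refl
  ⋆-sucʳ s t (suc m) = trans (+-congˡ (⋆-sucʳ (s ∘ suc) t m)) (sym (+-assoc _ _ _))

  -- The operator T d/dT. It is a derivation that leaves every coefficient at its index, so its
  -- product rule `euler-⋆` involves no shift; d/dT is its shift by one.
  euler : Seq → Seq
  euler s m = (m · 1#) * s m

  euler-⋆ : ∀ s t m → euler (s ⋆ t) m ≈ (euler s ⋆ t) m + (s ⋆ euler t) m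
  euler-⋆ s t zero    = solve 2 (λ a b → con 0 :* (a :* b) :=
                          (con 0 :* a) :* b :+ a :* (con 0 :* b)) refl _ _
  euler-⋆ s t (suc m) = begin
    (1# + m · 1#) * (s 0 * t (suc m) + r m)
      ≈⟨ solve 4 (λ n a b r → (con 1 :+ n) :* (a :* b :+ r) :=
           (r :+ n :* r) :+ a :* ((con 1 :+ n) :* b)) refl _ _ _ _ ⟩
    (r m + euler r m) + s 0 * euler t (suc m)
      ≈⟨ +-congʳ (+-congˡ (euler-⋆ (s ∘ suc) t m)) ⟩
    (r m + ((euler (s ∘ suc) ⋆ t) m + (s ∘ suc ⋆ euler t) m)) + s 0 * euler t (suc m)
      ≈⟨ solve 5 (λ r a b s t → (r :+ (a :+ b)) :+ s := (r :+ a) :+ (s :+ b)) refl _ _ _ _ (t 0) ⟩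
    (r m + (euler (s ∘ suc) ⋆ t) m) + (s ⋆ euler t) (suc m)
      ≈⟨ +-congʳ (⋆-distribʳ (s ∘ suc) (euler (s ∘ suc)) t m) ⟨
    ((λ i → s (suc i) + euler (s ∘ suc) i) ⋆ t) m + (s ⋆ euler t) (suc m)
      ≈⟨ +-congʳ (⋆-congˡ t (λ i → trans (+-congʳ (sym (*-identityˡ _))) (sym (distribʳ _ _ _))) m) ⟩
    (euler s ∘ suc ⋆ t) m + (s ⋆ euler t) (suc m)
      ≈⟨ +-congʳ (trans (+-congʳ (trans (*-congʳ (zeroˡ _)) (zeroˡ _))) (+-identityˡ _)) ⟨
    (euler s ⋆ t) (suc m) + (s ⋆ euler t) (suc m) ∎
    where
    r : Seq
    r = s ∘ suc ⋆ t

  -- (1 + T) s′ = x s, the differential equation of (1 + T)^x.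
  IsBinomialSeries : Carrier → Seq → Set ℓ
  IsBinomialSeries x s = ∀ m → euler s (suc m) + euler s m ≈ x * s m

  one-isBinomialSeries : IsBinomialSeries 0# one
  one-isBinomialSeries zero    = trans (+-congʳ (zeroʳ _)) (+-identityˡ _)
  one-isBinomialSeries (suc m) = trans (+-cong (zeroʳ _) (zeroʳ _)) (trans (+-identityˡ _) (sym (zeroʳ _)))

  -- By the product rule the logarithmic derivatives x/(1 + T) and z/(1 + T) add up. This takes the
  -- place of Vandermonde's identity for binomial coefficients.
  ⋆-isBinomialSeries : ∀ {x z s t} → IsBinomialSeries x s → IsBinomialSeries z t →
                       IsBinomialSeries (x + z) (s ⋆ t)
  ⋆-isBinomialSeries {x} {z} {s} {t} bs bt m = begin
    euler (s ⋆ t) (suc m) + euler (s ⋆ t) m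
      ≈⟨ +-cong (euler-⋆ s t (suc m)) (euler-⋆ s t m) ⟩
    ((0# * s 0) * t (suc m) + (euler s ∘ suc ⋆ t) m + (s ⋆ euler t) (suc m)) + (es + et)
      ≈⟨ +-congʳ (+-congˡ (⋆-sucʳ s (euler t) m)) ⟩
    ((0# * s 0) * t (suc m) + ds + (dt + s (suc m) * (0# * t 0))) + (es + et)
      ≈⟨ solve 8 (λ s₀ t′ ds dt s′ t₀ es et →
            ((con 0 :* s₀) :* t′ :+ ds :+ (dt :+ s′ :* (con 0 :* t₀))) :+ (es :+ et) :=
            (ds :+ es) :+ (dt :+ et)) refl (s 0) (t (suc m)) ds dt (s (suc m)) (t 0) es et ⟩
    (ds + es) + (dt + et)
      ≈⟨ +-cong (⋆-distribʳ _ _ t m) (⋆-distribˡ s _ _ m) ⟨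
    ((λ i → euler s (suc i) + euler s i) ⋆ t) m + (s ⋆ (λ i → euler t (suc i) + euler t i)) m
      ≈⟨ +-cong (trans (⋆-congˡ t bs m) (⋆-scaleˡ x s t m))
                (trans (⋆-congʳ s bt m) (⋆-scaleʳ z s t m)) ⟩
    x * (s ⋆ t) m + z * (s ⋆ t) m
      ≈⟨ distribʳ _ _ _ ⟨
    (x + z) * (s ⋆ t) m ∎
    where
    ds dt es et : Carrier
    ds = (euler s ∘ suc ⋆ t) m
    dt = (s ⋆ euler t ∘ suc) m
    es = (euler s ⋆ t) m
    et = (s ⋆ euler t) m

  ^⋆-isBinomialSeries : ∀ {x s} n → IsBinomialSeries x s → IsBinomialSeries (n · x) (s ^⋆ n)
  ^⋆-isBinomialSeries zero    bs = one-isBinomialSeries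
  ^⋆-isBinomialSeries (suc n) bs = ⋆-isBinomialSeries bs (^⋆-isBinomialSeries n bs)

  ^⋆-zero : ∀ {s} n → s 0 ≈ 1# → (s ^⋆ n) 0 ≈ 1#
  ^⋆-zero zero    eq = refl
  ^⋆-zero (suc n) eq = trans (*-cong eq (^⋆-zero n eq)) (*-identityˡ 1#)

  onePlusT : Seq
  onePlusT zero          = 1#
  onePlusT (suc zero)    = 1#
  onePlusT (suc (suc _)) = 0#

module Filtered {c ℓ} (R : CommutativeRing c ℓ) where
  open CommutativeRing R
  open import Algebra.Properties.Semiring.Exp semiring
  open import Algebra.Properties.Semiring.Mult semiring using () renaming (_×_ to _·_)
  open import Algebra.Properties.Ring ring
  open import Algebra.Properties.Semiring.Sum semiring using (sum; sum-cong-≋; *-distribˡ-sum)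
  open import Algebra.Solver.Ring.NaturalCoefficients.Default commutativeSemiring
    using (solve; _:+_; _:*_; _:=_; con)
  open Series R

  -- A decreasing filtration by ideals with `I j` · `I k` inside `I (j + k)`: the part of y-adic
  -- divisibility on which the extraction of roots rests.
  record Filtration i : Set (c ⊔ ℓ ⊔ Level.suc i) where
    field
      I      : ℕ → Carrier → Set i
      I-resp : ∀ {j a b} → a ≈ b → I j a → I j b
      I-all  : ∀ a → I 0 a
      I-suc  : ∀ {j a} → I (suc j) a → I j a
      I-+    : ∀ {j a b} → I j a → I j b → I j (a + b)
      I-neg  : ∀ {j a} → I j a → I j (- a)
      I-*    : ∀ {j k a b} → I j a → I k b → I (j ℕ.+ k) (a * b)
      I-0#   : ∀ {j} → I j 0#

  module Approximation {i} (filtration : Filtration i) where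
    open Filtration filtration

    infix 4 _≡_mod_
    _≡_mod_ : Carrier → Carrier → ℕ → Set i
    a ≡ b mod j = I j (a - b)

    ≈⇒mod : ∀ {a b j} → a ≈ b → a ≡ b mod j
    ≈⇒mod {a} {b} eq = I-resp (sym (trans (+-congʳ eq) (-‿inverseʳ b))) I-0#

    mod-sym : ∀ {a b j} → a ≡ b mod j → b ≡ a mod j
    mod-sym {a} {b} h = I-resp (⁻¹-anti-homo‿- a b) (I-neg h)

    mod-trans : ∀ {a b d j} → a ≡ b mod j → b ≡ d mod j → a ≡ d mod j
    mod-trans {a} {b} {d} h h′ = I-resp
      (trans (+-assoc _ _ _) (+-congˡ (trans (sym (+-assoc _ _ _)) (trans (+-congʳ (-‿inverseˡ b)) (+-identityˡ _)))))
      (I-+ h h′)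

    mod-+ : ∀ {a b a′ b′ j} → a ≡ b mod j → a′ ≡ b′ mod j → a + a′ ≡ b + b′ mod j
    mod-+ {a} {b} {a′} {b′} h h′ = I-resp
      (trans (solve 4 (λ a b a′ b′ → (a :+ b) :+ (a′ :+ b′) := (a :+ a′) :+ (b :+ b′)) refl a (- b) a′ (- b′))
             (+-congˡ (-‿+-comm b b′)))
      (I-+ h h′)

    mod-*ˡ : ∀ {a b j k d} → I k d → a ≡ b mod j → d * a ≡ d * b mod (k ℕ.+ j)
    mod-*ˡ {a} {b} {d = d} hd h = I-resp (x[y-z]≈xy-xz d a b) (I-* hd h)

    mod-* : ∀ {a b a′ b′ j} → a ≡ b mod j → a′ ≡ b′ mod j → a * a′ ≡ b * b′ mod j
    mod-* {a} {b} {a′} {b′} h h′ = mod-trans (mod-*ˡ (I-all a) h′)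
      (mod-trans (≈⇒mod (*-comm a b′)) (mod-trans (mod-*ˡ (I-all b′) h) (≈⇒mod (*-comm b′ b))))

    mod-^ : ∀ {a b j} n → a ≡ b mod j → a ^ n ≡ b ^ n mod j
    mod-^ zero    h = ≈⇒mod refl
    mod-^ (suc n) h = mod-* h (mod-^ n h)

    I-≤ : ∀ {j k a} → j ≤ k → I k a → I j a
    I-≤ j≤k = go (ℕ.≤⇒≤′ j≤k)
      where
      go : ∀ {j k a} → j ℕ.≤′ k → I k a → I j a
      go ℕ.≤′-refl     h = h
      go (ℕ.≤′-step l) h = go l (I-suc h)

    module _ (T : Carrier) (T∈I : I 1 T) where

      -- Horner's scheme. It follows the recursion of `_⋆_`, and the factor `T` in front of the
      -- recursive call raises the precision of an induction hypothesis by one.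
      partialSum : ℕ → Seq → Carrier
      partialSum zero    s = s 0
      partialSum (suc N) s = s 0 + T * partialSum N (s ∘ suc)

      partialSum-cong : ∀ N {s t} → s ≋ t → partialSum N s ≈ partialSum N t
      partialSum-cong zero    eq = eq 0
      partialSum-cong (suc N) eq = +-cong (eq 0) (*-congˡ (partialSum-cong N (eq ∘ suc)))

      sum≈partialSum : ∀ N s → sum {n = suc N} (λ i → s (toℕ i) * T ^ toℕ i) ≈ partialSum N s
      sum≈partialSum zero    s = trans (+-identityʳ _) (*-identityʳ _)
      sum≈partialSum (suc N) s = +-cong (*-identityʳ _) (trans
        (sum-cong-≋ {n = suc N} {λ i → s (suc (toℕ i)) * (T * T ^ toℕ i)} {λ i → T * (s (suc (toℕ i)) * T ^ toℕ i)}
          (λ i → solve 3 (λ s t r → s :* (t :* r) := t :* (s :* r)) refl (s (suc (toℕ i))) T (T ^ toℕ i)))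
        (trans (sym (*-distribˡ-sum {suc N} T (λ i → s (suc (toℕ i)) * T ^ toℕ i))) (*-congˡ (sum≈partialSum N (s ∘ suc)))))

      partialSum-+ : ∀ N s t → partialSum N (λ m → s m + t m) ≈ partialSum N s + partialSum N t
      partialSum-+ zero    s t = refl
      partialSum-+ (suc N) s t = trans (+-congˡ (*-congˡ (partialSum-+ N (s ∘ suc) (t ∘ suc))))
        (solve 5 (λ s₀ t₀ τ a b → (s₀ :+ t₀) :+ τ :* (a :+ b) := (s₀ :+ τ :* a) :+ (t₀ :+ τ :* b))
          refl _ _ T _ _)

      partialSum-* : ∀ N x s → partialSum N (λ m → x * s m) ≈ x * partialSum N s
      partialSum-* zero    x s = refl
      partialSum-* (suc N) x s = trans (+-congˡ (*-congˡ (partialSum-* N x (s ∘ suc))))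
        (solve 4 (λ x s₀ τ a → x :* s₀ :+ τ :* (x :* a) := x :* (s₀ :+ τ :* a)) refl x _ T _)

      partialSum-step : ∀ N s → partialSum N s ≡ partialSum (suc N) s mod suc N
      partialSum-step zero    s = mod-trans (≈⇒mod (sym (+-identityʳ _)))
        (mod-+ (≈⇒mod refl) (mod-sym (I-resp (sym (trans (+-congˡ -0#≈0#) (+-identityʳ _)))
          (I-* T∈I (I-all (s 1))))))
      partialSum-step (suc N) s = mod-+ (≈⇒mod refl) (mod-*ˡ T∈I (partialSum-step N (s ∘ suc)))

      -- Evaluation at `T` is multiplicative except for the products of degree above `N`, and these
      -- lie in `I (suc N)` because `T` lies in `I 1`.
      partialSum-⋆ : ∀ N s t → partialSum N s * partialSum N t ≡ partialSum N (s ⋆ t) mod suc N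
      partialSum-⋆ zero    s t = ≈⇒mod refl
      partialSum-⋆ (suc N) s t = mod-trans
        (≈⇒mod (solve 4 (λ s₀ τ a b → (s₀ :+ τ :* a) :* b := s₀ :* b :+ τ :* (a :* b)) refl
          (s 0) T (partialSum N (s ∘ suc)) (partialSum (suc N) t)))
        (mod-trans
          (mod-+ (≈⇒mod refl) (mod-*ˡ T∈I (mod-trans
            (mod-* (≈⇒mod refl) (mod-sym (partialSum-step N t)))
            (partialSum-⋆ N (s ∘ suc) t))))
          (≈⇒mod (trans
            (solve 5 (λ s₀ t₀ τ a b → s₀ :* (t₀ :+ τ :* a) :+ τ :* b :=
                                      s₀ :* t₀ :+ τ :* (s₀ :* a :+ b)) refl
              (s 0) (t 0) T (partialSum N (t ∘ suc)) (partialSum N (s ∘ suc ⋆ t)))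
            (+-congˡ (*-congˡ (sym (trans (partialSum-+ N _ _) (+-congʳ (partialSum-* N _ _)))))))))

      partialSum-zero : ∀ N → partialSum N (λ _ → 0#) ≈ 0#
      partialSum-zero zero    = refl
      partialSum-zero (suc N) = trans (+-identityˡ _) (trans (*-congˡ (partialSum-zero N)) (zeroʳ T))

      partialSum-one : ∀ N → partialSum N one ≈ 1#
      partialSum-one zero    = refl
      partialSum-one (suc N) = trans (+-congˡ (trans (*-congˡ (partialSum-zero N)) (zeroʳ T))) (+-identityʳ 1#)

      partialSum-^⋆ : ∀ N s n → partialSum N s ^ n ≡ partialSum N (s ^⋆ n) mod suc N
      partialSum-^⋆ N s zero    = ≈⇒mod (sym (partialSum-one N))
      partialSum-^⋆ N s (suc n) = mod-trans (mod-* (≈⇒mod refl) (partialSum-^⋆ N s n))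
                                            (partialSum-⋆ N s (s ^⋆ n))

      partialSum-onePlusT : ∀ N → partialSum N onePlusT ≡ 1# + T mod suc N
      partialSum-onePlusT zero    = mod-trans (≈⇒mod (sym (+-identityʳ 1#))) (mod-+ (≈⇒mod refl)
        (mod-sym (I-resp (sym (trans (+-congˡ -0#≈0#) (+-identityʳ _))) T∈I)))
      partialSum-onePlusT (suc N) = ≈⇒mod (+-congˡ (trans (*-congˡ (trans
        (partialSum-cong N λ { zero → refl ; (suc _) → refl }) (partialSum-one N))) (*-identityʳ T)))

      partialSum-const : ∀ N s → partialSum N s ≡ s 0 mod 1
      partialSum-const zero    s = ≈⇒mod refl
      partialSum-const (suc N) s = mod-trans (mod-+ (≈⇒mod refl)
        (I-resp (sym (trans (+-congˡ -0#≈0#) (+-identityʳ _))) (I-* T∈I (I-all _)))) (≈⇒mod (+-identityʳ _))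

    -- The sum of a^(n-1-i) b^i over i < n, that is, (a^n - b^n)/(a - b).
    quotient : Carrier → Carrier → ℕ → Carrier
    quotient a b zero    = 0#
    quotient a b (suc n) = a ^ n + b * quotient a b n

    ^-difference : ∀ a b n → (a - b) * quotient a b n ≈ a ^ n - b ^ n
    ^-difference a b zero    = trans (zeroʳ _) (sym (-‿inverseʳ 1#))
    ^-difference a b (suc n) = begin
      (a - b) * (a ^ n + b * quotient a b n)
        ≈⟨ solve 4 (λ d α b r → d :* (α :+ b :* r) := d :* α :+ b :* (d :* r)) refl (a - b) (a ^ n) b _ ⟩
      (a - b) * a ^ n + b * ((a - b) * quotient a b n)
        ≈⟨ +-cong ([y-z]x≈yx-zx (a ^ n) a b) (trans (*-congˡ (^-difference a b n)) (x[y-z]≈xy-xz b (a ^ n) (b ^ n))) ⟩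
      (a * a ^ n - b * a ^ n) + (b * a ^ n - b * b ^ n)
        ≈⟨ trans (+-assoc _ _ _) (+-congˡ (trans (sym (+-assoc _ _ _)) (trans (+-congʳ (-‿inverseˡ _)) (+-identityˡ _)))) ⟩
      a * a ^ n - b * b ^ n ∎
      where open import Relation.Binary.Reasoning.Setoid setoid

    1^ : ∀ n → 1# ^ n ≈ 1#
    1^ zero    = refl
    1^ (suc n) = trans (*-identityˡ _) (1^ n)

    quotient-mod : ∀ {a b} n → a ≡ 1# mod 1 → b ≡ 1# mod 1 → quotient a b n ≡ n · 1# mod 1
    quotient-mod zero    ha hb = ≈⇒mod refl
    quotient-mod (suc n) ha hb = mod-+ (mod-trans (mod-^ n ha) (≈⇒mod (1^ n)))
      (mod-trans (mod-* hb (quotient-mod n ha hb)) (≈⇒mod (*-identityˡ _)))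

    -- Hensel's uniqueness argument. The cofactor `quotient a b q` of a - b in a^q - b^q is
    -- congruent to q modulo `I 1`. Hence, once a - b lies in `I j`, the product (a - b) q differs
    -- from a^q - b^q by an element of `I (suc j)`, and dividing by q gains one degree of precision.
    root-unique : ∀ {a b q⁻¹} q M → (q · 1#) * q⁻¹ ≈ 1# → a ≡ 1# mod 1 → b ≡ 1# mod 1 →
                  a ^ q ≡ b ^ q mod M → a ≡ b mod M
    root-unique {a} {b} {q⁻¹} q M inv ha hb h = go M ℕ.≤-refl
      where
      go : ∀ j → j ≤ M → a ≡ b mod j
      go zero    _   = I-all _
      go (suc j) j<M = I-resp (trans (*-assoc _ _ _) (trans (*-congˡ inv) (*-identityʳ _)))
        (≡.subst (λ k → I k (((a - b) * (q · 1#)) * q⁻¹)) (ℕ.+-identityʳ (suc j)) (I-* step (I-all q⁻¹)))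
        where
        step : I (suc j) ((a - b) * (q · 1#))
        step = I-resp
          (trans (sym (distribˡ _ _ _)) (*-congˡ
            (trans (+-comm _ _) (trans (+-assoc _ _ _) (trans (+-congˡ (-‿inverseˡ _)) (+-identityʳ _))))))
          (I-+ (I-resp (sym (^-difference a b q)) (I-≤ j<M h))
               (≡.subst (λ k → I k ((a - b) * ((q · 1#) - quotient a b q))) (ℕ.+-comm j 1)
                 (I-* (go j (ℕ.<⇒≤ j<M)) (mod-sym (quotient-mod q ha hb)))))

    -- The truncated series and `G` are both 1 modulo `I 1`, and their q-th powers both equal `H`
    -- modulo `I (suc N)`, so `root-unique` identifies them; no limit is taken.
    binomialSum-root : ∀ {q⁻¹} q N s {H G} → (q · 1#) * q⁻¹ ≈ 1# → s ^⋆ q ≋ onePlusT → s 0 ≈ 1# →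
      H ≈ G ^ q → G ≡ 1# mod 1 → sum {n = suc N} (λ i → s (toℕ i) * (H - 1#) ^ toℕ i) ≡ G mod suc N
    binomialSum-root q N s {H} {G} inv root s₀≈1 H≈Gᑫ G≡1 =
      mod-trans (≈⇒mod (sum≈partialSum T H≡1 N s)) (root-unique q (suc N) inv
        (mod-trans (partialSum-const T H≡1 N s) (≈⇒mod s₀≈1)) G≡1
        (mod-trans (partialSum-^⋆ T H≡1 N s q) (mod-trans (≈⇒mod (partialSum-cong T H≡1 N root))
          (mod-trans (partialSum-onePlusT T H≡1 N) (≈⇒mod (trans 1+T≈H H≈Gᑫ))))))
      where
      T : Carrier
      T = H - 1#
      H≡1 : H ≡ 1# mod 1
      H≡1 = mod-trans (≈⇒mod H≈Gᑫ) (mod-trans (mod-^ q G≡1) (≈⇒mod (1^ q)))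
      1+T≈H : 1# + T ≈ H
      1+T≈H = trans (+-comm _ _) (trans (+-assoc _ _ _) (trans (+-congˡ (-‿inverseˡ 1#)) (+-identityʳ H)))

-- The binomial coefficients of 1/q

module _ where
  open ≡ using (refl; sym; trans; cong; cong₂; subst)

  module ≃-Reasoning = SetoidReasoning ℚᵘ.≃-setoid

  ι : ℤ → ℚ
  ι m = m ℚ./ 1

  ι-+ : ∀ a b → ι (a ℤ.+ b) ≡ ι a ℚ.+ ι b
  ι-+ a b = ℚ.toℚᵘ-injective (begin
    ℚ.toℚᵘ (ι (a ℤ.+ b))           ≈⟨ ℚ.toℚᵘ-fromℚᵘ (mkℚᵘ (a ℤ.+ b) 0) ⟩
    mkℚᵘ (a ℤ.+ b) 0
      ≈⟨ *≡* (cong (ℤ._* pos 1) (sym (cong₂ ℤ._+_ (ℤ.*-identityʳ a) (ℤ.*-identityʳ b)))) ⟩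
    mkℚᵘ a 0 ℚᵘ.+ mkℚᵘ b 0         ≈⟨ ℚᵘ.+-cong (ℚ.toℚᵘ-fromℚᵘ (mkℚᵘ a 0)) (ℚ.toℚᵘ-fromℚᵘ (mkℚᵘ b 0)) ⟨
    ℚ.toℚᵘ (ι a) ℚᵘ.+ ℚ.toℚᵘ (ι b) ≈⟨ ℚ.toℚᵘ-homo-+ (ι a) (ι b) ⟨
    ℚ.toℚᵘ (ι a ℚ.+ ι b)           ∎)
    where open ≃-Reasoning

  ι-* : ∀ a b → ι (a ℤ.* b) ≡ ι a ℚ.* ι b
  ι-* a b = ℚ.toℚᵘ-injective (begin
    ℚ.toℚᵘ (ι (a ℤ.* b))           ≈⟨ ℚ.toℚᵘ-fromℚᵘ (mkℚᵘ (a ℤ.* b) 0) ⟩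
    mkℚᵘ a 0 ℚᵘ.* mkℚᵘ b 0         ≈⟨ ℚᵘ.*-cong (ℚ.toℚᵘ-fromℚᵘ (mkℚᵘ a 0)) (ℚ.toℚᵘ-fromℚᵘ (mkℚᵘ b 0)) ⟨
    ℚ.toℚᵘ (ι a) ℚᵘ.* ℚ.toℚᵘ (ι b) ≈⟨ ℚ.toℚᵘ-homo-* (ι a) (ι b) ⟨
    ℚ.toℚᵘ (ι a ℚ.* ι b)           ∎)
    where open ≃-Reasoning

  ι-neg : ∀ a → ι (ℤ.- a) ≡ ℚ.- ι a
  ι-neg a = ℚ.toℚᵘ-injective (begin
    ℚ.toℚᵘ (ι (ℤ.- a)) ≈⟨ ℚ.toℚᵘ-fromℚᵘ (mkℚᵘ (ℤ.- a) 0) ⟩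
    ℚᵘ.- mkℚᵘ a 0      ≈⟨ ℚᵘ.-‿cong (ℚ.toℚᵘ-fromℚᵘ (mkℚᵘ a 0)) ⟨
    ℚᵘ.- ℚ.toℚᵘ (ι a)  ≈⟨ ℚ.toℚᵘ-homo‿- (ι a) ⟨
    ℚ.toℚᵘ (ℚ.- ι a)   ∎)
    where open ≃-Reasoning

  ι-injective : ∀ {a b} → ι a ≡ ι b → a ≡ b
  ι-injective {a} {b} eq with ℚ.fromℚᵘ-injective {mkℚᵘ a 0} {mkℚᵘ b 0} eq
  ... | *≡* eq′ = trans (sym (ℤ.*-identityʳ a)) (trans eq′ (ℤ.*-identityʳ b))

  /⇒* : ∀ m d .{{_ : NonZero d}} → (m ℚ./ d) ℚ.* ι (pos d) ≡ ι m
  /⇒* m d@(suc d-1) = ℚ.toℚᵘ-injective (begin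
    ℚ.toℚᵘ ((m ℚ./ d) ℚ.* ι (pos d)) ≈⟨ ℚ.toℚᵘ-homo-* (m ℚ./ d) (ι (pos d)) ⟩
    ℚ.toℚᵘ (m ℚ./ d) ℚᵘ.* ℚ.toℚᵘ (ι (pos d))
      ≈⟨ ℚᵘ.*-cong (ℚ.toℚᵘ-fromℚᵘ (mkℚᵘ m d-1)) (ℚ.toℚᵘ-fromℚᵘ (mkℚᵘ (pos d) 0)) ⟩
    mkℚᵘ m d-1 ℚᵘ.* mkℚᵘ (pos d) 0
      ≈⟨ *≡* (trans (ℤ.*-identityʳ _) (cong (λ k → m ℤ.* pos k) (sym (ℕ.*-identityʳ d)))) ⟩
    mkℚᵘ m 0                         ≈⟨ ℚ.toℚᵘ-fromℚᵘ (mkℚᵘ m 0) ⟨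
    ℚ.toℚᵘ (ι m)                     ∎)
    where open ≃-Reasoning

  ι-cancel : ∀ d .{{_ : NonZero d}} {r s} → r ℚ.* ι (pos d) ≡ s ℚ.* ι (pos d) → r ≡ s
  ι-cancel d {r} {s} eq = trans (sym (undo r)) (trans (cong (ℚ._* (pos 1 ℚ./ d)) eq) (undo s))
    where
    undo : ∀ r → r ℚ.* ι (pos d) ℚ.* (pos 1 ℚ./ d) ≡ r
    undo r = trans (ℚ.*-assoc r _ _)
        (trans (cong (r ℚ.*_) (trans (ℚ.*-comm (ι (pos d)) _) (/⇒* (pos 1) d))) (ℚ.*-identityʳ r))

  *⇒/ : ∀ {r} m d .{{_ : NonZero d}} → r ℚ.* ι (pos d) ≡ ι m → r ≡ m ℚ./ d
  *⇒/ m d eq = ι-cancel d (trans eq (sym (/⇒* m d)))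

  module ℚSeries = Series ℚ.+-*-commutativeRing

  open import Algebra.Properties.Semiring.Mult
    (CommutativeRing.semiring ℚ.+-*-commutativeRing)
    using () renaming (_×_ to _·_)

  ·1≡ι : ∀ n → n · 1ℚ ≡ ι (pos n)
  ·1≡ι zero    = refl
  ·1≡ι (suc n) = trans (cong (1ℚ ℚ.+_) (·1≡ι n)) (sym (ι-+ (pos 1) (pos n)))

  -- Rests on (m + 1) binom(x, m + 1) = (x - m) binom(x, m).
  binomial-isBinomialSeries : ∀ x → ℚSeries.IsBinomialSeries x (binomial x)
  binomial-isBinomialSeries x m = begin
    (suc m · 1ℚ) ℚ.* (ff ℚ.* (x ℚ.- ι (pos m)) ℚ.* 1/[1+m]!) ℚ.+ (m · 1ℚ) ℚ.* (ff ℚ.* 1/m!)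
      ≡⟨ cong₂ (λ a b → a ℚ.* (ff ℚ.* (x ℚ.- ι (pos m)) ℚ.* 1/[1+m]!) ℚ.+ b ℚ.* (ff ℚ.* 1/m!)) (·1≡ι (suc m)) (·1≡ι m) ⟩
    ι (pos (suc m)) ℚ.* (ff ℚ.* (x ℚ.- ι (pos m)) ℚ.* 1/[1+m]!) ℚ.+ ι (pos m) ℚ.* (ff ℚ.* 1/m!)
      ≡⟨ solve 6 (λ n f x i r s → n :* (f :* (x :- i) :* r) :+ i :* (f :* s) :=
                                  f :* (x :- i) :* (r :* n) :+ i :* (f :* s)) refl
           (ι (pos (suc m))) ff x (ι (pos m)) 1/[1+m]! 1/m! ⟩
    ff ℚ.* (x ℚ.- ι (pos m)) ℚ.* (1/[1+m]! ℚ.* ι (pos (suc m))) ℚ.+ ι (pos m) ℚ.* (ff ℚ.* 1/m!)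
      ≡⟨ cong (λ s → ff ℚ.* (x ℚ.- ι (pos m)) ℚ.* s ℚ.+ ι (pos m) ℚ.* (ff ℚ.* 1/m!)) step ⟩
    ff ℚ.* (x ℚ.- ι (pos m)) ℚ.* 1/m! ℚ.+ ι (pos m) ℚ.* (ff ℚ.* 1/m!)
      ≡⟨ solve 4 (λ f x i s → f :* (x :- i) :* s :+ i :* (f :* s) := x :* (f :* s)) refl
           ff x (ι (pos m)) 1/m! ⟩
    x ℚ.* (ff ℚ.* 1/m!) ∎
    where
    open ≡.≡-Reasoning
    open ℚSolver.+-*-Solver
    ff 1/m! 1/[1+m]! : ℚ
    ff = fallingFactorial x m
    1/m! = ℚ._/_ (pos 1) (m !) {{m ℕ.!≢0}}
    1/[1+m]! = ℚ._/_ (pos 1) (suc m !) {{suc m ℕ.!≢0}}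
    step : 1/[1+m]! ℚ.* ι (pos (suc m)) ≡ 1/m!
    step = *⇒/ (pos 1) (m !) {{m ℕ.!≢0}} (begin
      1/[1+m]! ℚ.* ι (pos (suc m)) ℚ.* ι (pos (m !))   ≡⟨ ℚ.*-assoc 1/[1+m]! _ _ ⟩
      1/[1+m]! ℚ.* (ι (pos (suc m)) ℚ.* ι (pos (m !))) ≡⟨ cong (1/[1+m]! ℚ.*_) (ι-* (pos (suc m)) (pos (m !))) ⟨
      1/[1+m]! ℚ.* ι (pos (suc m) ℤ.* pos (m !))       ≡⟨ cong (λ z → 1/[1+m]! ℚ.* ι z) (ℤ.pos-* (suc m) (m !)) ⟨
      1/[1+m]! ℚ.* ι (pos (suc m !))                   ≡⟨ /⇒* (pos 1) (suc m !) {{suc m ℕ.!≢0}} ⟩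
      ι (pos 1)                                        ∎)

  -- For x = 1 the equation reads (m + 1) s(m + 1) = (1 - m) s(m), which determines s from s(0) over
  -- ℚ.
  binomialSeries-1 : ∀ s → ℚSeries.IsBinomialSeries 1ℚ s → s 0 ≡ 1ℚ → s ℚSeries.≋ ℚSeries.onePlusT
  binomialSeries-1 s bs s₀≡1 = go
    where
    open ≡.≡-Reasoning
    open ℚSolver.+-*-Solver
    next : ∀ m → s (suc m) ℚ.* ι (pos (suc m)) ≡ (1ℚ ℚ.- ι (pos m)) ℚ.* s m
    next m = begin
      s (suc m) ℚ.* ι (pos (suc m))
        ≡⟨ solve 4 (λ a b c d → a :* b := (b :* a :+ c :* d) :- c :* d) refl (s (suc m)) (ι (pos (suc m))) (ι (pos m)) (s m) ⟩
      (ι (pos (suc m)) ℚ.* s (suc m) ℚ.+ ι (pos m) ℚ.* s m) ℚ.- ι (pos m) ℚ.* s m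
        ≡⟨ cong₂ (λ a b → (a ℚ.* s (suc m) ℚ.+ b ℚ.* s m) ℚ.- ι (pos m) ℚ.* s m) (·1≡ι (suc m)) (·1≡ι m) ⟨
      ((suc m · 1ℚ) ℚ.* s (suc m) ℚ.+ (m · 1ℚ) ℚ.* s m) ℚ.- ι (pos m) ℚ.* s m
        ≡⟨ cong (ℚ._- ι (pos m) ℚ.* s m) (bs m) ⟩
      1ℚ ℚ.* s m ℚ.- ι (pos m) ℚ.* s m
        ≡⟨ solve 3 (λ o a b → o :* b :- a :* b := (o :- a) :* b) refl 1ℚ (ι (pos m)) (s m) ⟩
      (1ℚ ℚ.- ι (pos m)) ℚ.* s m ∎

    go : ∀ m → s m ≡ ℚSeries.onePlusT m
    go zero = s₀≡1
    go (suc zero) = trans (sym (ℚ.*-identityʳ (s 1))) (trans (next 0) (trans (ℚ.*-identityˡ (s 0)) s₀≡1))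
    -- The factor 1 - m vanishes at m = 1, which ends the series; all later coefficients inherit the
    -- zero.
    go (suc (suc zero)) = ι-cancel 2 (trans (next 1) (trans (ℚ.*-zeroˡ (s 1)) (sym (ℚ.*-zeroˡ (ι (pos 2))))))
    go (suc (suc (suc m))) = ι-cancel (3 ℕ.+ m) (trans (next (2 ℕ.+ m))
      (trans (cong ((1ℚ ℚ.- ι (pos (2 ℕ.+ m))) ℚ.*_) (go (suc (suc m))))
        (trans (ℚ.*-zeroʳ (1ℚ ℚ.- ι (pos (2 ℕ.+ m)))) (sym (ℚ.*-zeroˡ (ι (pos (3 ℕ.+ m))))))))

  ·1/n≡1 : ∀ n .{{_ : NonZero n}} → n · (pos 1 ℚ./ n) ≡ 1ℚ
  ·1/n≡1 n = trans (general n) (trans (cong (ℚ._* (pos 1 ℚ./ n)) (·1≡ι n)) (trans (ℚ.*-comm (ι (pos n)) _) (/⇒* (pos 1) n)))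
    where
    general : ∀ k {r} → k · r ≡ (k · 1ℚ) ℚ.* r
    general zero    {r} = sym (ℚ.*-zeroˡ r)
    general (suc k) {r} = trans (cong₂ ℚ._+_ (sym (ℚ.*-identityˡ r)) (general k)) (sym (ℚ.*-distribʳ-+ r 1ℚ (k · 1ℚ)))

  binomial-root : ∀ q .{{_ : NonZero q}} →
                  binomial (pos 1 ℚ./ q) ℚSeries.^⋆ q ℚSeries.≋ ℚSeries.onePlusT
  binomial-root q = binomialSeries-1 _
    (subst (λ x → ℚSeries.IsBinomialSeries x (b ℚSeries.^⋆ q)) (·1/n≡1 q)
      (ℚSeries.^⋆-isBinomialSeries {s = b} q (binomial-isBinomialSeries (pos 1 ℚ./ q))))
    (ℚSeries.^⋆-zero {b} q refl)
    where
    b : ℕ → ℚ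
    b = binomial (pos 1 ℚ./ q)

  falling : ℤ → ℕ → ℤ
  falling x zero    = pos 1
  falling x (suc i) = falling x i ℤ.* (x ℤ.- pos i)

  -- Splits off the first factor, where the definition splits off the last.
  falling-shift : ∀ x i → falling (x ℤ.+ pos 1) (suc i) ≡ (x ℤ.+ pos 1) ℤ.* falling x i
  falling-shift x zero    = solve 1
      (λ x → con (pos 1) :* (x :+ con (pos 1) :- con (pos 0)) := (x :+ con (pos 1)) :* con (pos 1)) refl x
    where open ℤSolver.+-*-Solver
  falling-shift x (suc i) = trans
    (cong₂ (λ a b → a ℤ.* (x ℤ.+ pos 1 ℤ.- b)) (falling-shift x i) (ℤ.pos-+ 1 i))
    (solve 3 (λ x f i → (x :+ con (pos 1)) :* f :* (x :+ con (pos 1) :- (con (pos 1) :+ i)) :=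
                        (x :+ con (pos 1)) :* (f :* (x :- i))) refl x (falling x i) (pos i))
    where open ℤSolver.+-*-Solver

  -- Pascal's rule multiplied by (i + 1)!: `falling` at (n + 1, i + 1) is its value at (n, i + 1)
  -- plus i + 1 times its value at (n, i).
  !∣falling : ∀ n i → pos (i !) ∣ℤ falling (pos n) i
  !∣falling n       zero    = ℤ∣.∣-refl
  !∣falling zero    (suc i) = subst (pos (suc i !) ∣ℤ_) (sym (vanish i)) (ℤ∣.divides (pos 0) refl)
    where
    vanish : ∀ i → falling (pos 0) (suc i) ≡ pos 0
    vanish zero    = refl
    vanish (suc i) = trans (cong (ℤ._* (pos 0 ℤ.- pos (suc i))) (vanish i)) (ℤ.*-zeroˡ (pos 0 ℤ.- pos (suc i)))
  !∣falling (suc n) (suc i) = subst (pos (suc i !) ∣ℤ_) difference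
    (ℤ∣.∣m∣n⇒∣m+n (!∣falling n (suc i))
      (subst (_∣ℤ (pos (suc i) ℤ.* falling (pos n) i)) (sym (ℤ.pos-* (suc i) (i !)))
        (ℤ∣.*-monoʳ-∣ (pos (suc i)) (!∣falling n i))))
    where
    open ≡.≡-Reasoning
    f : ℤ
    f = falling (pos n) i
    difference : f ℤ.* (pos n ℤ.- pos i) ℤ.+ pos (suc i) ℤ.* f ≡ falling (pos (suc n)) (suc i)
    difference = begin
      f ℤ.* (pos n ℤ.- pos i) ℤ.+ pos (suc i) ℤ.* f
        ≡⟨ cong (λ z → f ℤ.* (pos n ℤ.- pos i) ℤ.+ z ℤ.* f) (ℤ.pos-+ 1 i) ⟩
      f ℤ.* (pos n ℤ.- pos i) ℤ.+ (pos 1 ℤ.+ pos i) ℤ.* f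
        ≡⟨ solve 3 (λ f n i → f :* (n :- i) :+ (con (pos 1) :+ i) :* f := (n :+ con (pos 1)) :* f) refl f (pos n) (pos i) ⟩
      (pos n ℤ.+ pos 1) ℤ.* f
        ≡⟨ falling-shift (pos n) i ⟨
      falling (pos n ℤ.+ pos 1) (suc i)
        ≡⟨ cong (λ z → falling z (suc i)) (trans (sym (ℤ.pos-+ n 1)) (cong pos (ℕ.+-comm n 1))) ⟩
      falling (pos (suc n)) (suc i) ∎
      where open ℤSolver.+-*-Solver

  -- Two of the M + 1 powers q^0, ..., q^M agree modulo M. So q^t inverts q modulo M up to the
  -- factor q^s, whether or not q and M are coprime.
  powers-collide : ∀ q M .{{_ : NonZero M}} → ∃[ s ] ∃[ t ] pos M ∣ℤ pos (q ℕ.^ s) ℤ.* (pos 1 ℤ.- pos q ℤ.* pos (q ℕ.^ t))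
  powers-collide q M with Fin.pigeonhole (ℕ.n<1+n M) (λ k → (q ℕ.^ toℕ k) ℕ.mod M)
  ... | i , j , i<j , same = s , t , ℤ∣.divides (pos (q ℕ.^ s ℕ./ M) ℤ.- pos (q ℕ.^ toℕ j ℕ./ M)) (begin
      pos (q ℕ.^ s) ℤ.* (pos 1 ℤ.- pos q ℤ.* pos (q ℕ.^ t))
        ≡⟨ solve 3 (λ a q b → a :* (con (pos 1) :- q :* b) := a :- a :* (q :* b)) refl (pos (q ℕ.^ s)) (pos q) (pos (q ℕ.^ t)) ⟩
      pos (q ℕ.^ s) ℤ.- pos (q ℕ.^ s) ℤ.* (pos q ℤ.* pos (q ℕ.^ t))
        ≡⟨ cong (ℤ._-_ (pos (q ℕ.^ s))) (trans (cong (pos (q ℕ.^ s) ℤ.*_) (sym (ℤ.pos-* q (q ℕ.^ t))))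
             (trans (sym (ℤ.pos-* (q ℕ.^ s) (q ℕ.^ suc t)))
             (cong pos (trans (sym (ℕ.^-distribˡ-+-* q s (suc t))) (cong (q ℕ.^_) s+1+t≡j))))) ⟩
      pos (q ℕ.^ s) ℤ.- pos (q ℕ.^ toℕ j)
        ≡⟨ cong₂ ℤ._-_ (split (q ℕ.^ s)) (trans (split (q ℕ.^ toℕ j))
             (cong (λ r → pos r ℤ.+ pos (q ℕ.^ toℕ j ℕ./ M) ℤ.* pos M) (sym rem≡))) ⟩
      (pos (q ℕ.^ s ℕ.% M) ℤ.+ pos (q ℕ.^ s ℕ./ M) ℤ.* pos M) ℤ.- (pos (q ℕ.^ s ℕ.% M) ℤ.+ pos (q ℕ.^ toℕ j ℕ./ M) ℤ.* pos M)
        ≡⟨ solve 4 (λ r a b m → (r :+ a :* m) :- (r :+ b :* m) := (a :- b) :* m) refl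
             (pos (q ℕ.^ s ℕ.% M)) (pos (q ℕ.^ s ℕ./ M)) (pos (q ℕ.^ toℕ j ℕ./ M)) (pos M) ⟩
      (pos (q ℕ.^ s ℕ./ M) ℤ.- pos (q ℕ.^ toℕ j ℕ./ M)) ℤ.* pos M ∎)
    where
    open ≡.≡-Reasoning
    open ℤSolver.+-*-Solver
    s t : ℕ
    s = toℕ i
    t = toℕ j ℕ.∸ suc s
    s+1+t≡j : s ℕ.+ suc t ≡ toℕ j
    s+1+t≡j = trans (ℕ.+-suc s t) (ℕ.m+[n∸m]≡n i<j)
    rem≡ : q ℕ.^ s ℕ.% M ≡ q ℕ.^ toℕ j ℕ.% M
    rem≡ = trans (sym (Fin.toℕ-fromℕ< (ℕ.m%n<n (q ℕ.^ s) M)))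
      (trans (cong toℕ same) (Fin.toℕ-fromℕ< (ℕ.m%n<n (q ℕ.^ toℕ j) M)))
    split : ∀ a → pos a ≡ pos (a ℕ.% M) ℤ.+ pos (a ℕ./ M) ℤ.* pos M
    split a = trans (cong pos (ℕ.m≡m%n+[m/n]*n a M))
      (trans (ℤ.pos-+ (a ℕ.% M) _) (cong (λ z → pos (a ℕ.% M) ℤ.+ z) (ℤ.pos-* (a ℕ./ M) M)))

  -- qⁱ · (1/q)(1/q - 1)⋯(1/q - i + 1)
  scaledFalling : ℕ → ℕ → ℤ
  scaledFalling q zero    = pos 1
  scaledFalling q (suc i) = scaledFalling q i ℤ.* (pos 1 ℤ.- pos i ℤ.* pos q)

  -- Modulo i!, a high enough power of q makes q invertible with some inverse q′,
  -- and q′(q′ - 1)⋯(q′ - i + 1) is divisible by i!.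
  !∣scaledFalling : ∀ q i → ∃[ s ] pos (i !) ∣ℤ pos (q ℕ.^ s) ℤ.* scaledFalling q i
  !∣scaledFalling q i = s , subst (pos (i !) ∣ℤ_)
      (solve 3 (λ a b c → a :* (b :- c) :+ a :* c := a :* b) refl
        (pos (q ℕ.^ s)) (scaledFalling q i) (pos (q ℕ.^ i) ℤ.* falling q′ i))
      (ℤ∣.∣m∣n⇒∣m+n (go i) (ℤ∣.∣n⇒∣m*n (pos (q ℕ.^ s)) (ℤ∣.∣n⇒∣m*n (pos (q ℕ.^ i)) (!∣falling (q ℕ.^ t) i))))
    where
    open ℤSolver.+-*-Solver
    s t : ℕ
    s = proj₁ (powers-collide q (i !) {{i ℕ.!≢0}})
    t = proj₁ (proj₂ (powers-collide q (i !) {{i ℕ.!≢0}}))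
    M∣ : pos (i !) ∣ℤ pos (q ℕ.^ s) ℤ.* (pos 1 ℤ.- pos q ℤ.* pos (q ℕ.^ t))
    M∣ = proj₂ (proj₂ (powers-collide q (i !) {{i ℕ.!≢0}}))
    rearrange : ∀ a p r f q j q′ →
      a ℤ.* (p ℤ.- r ℤ.* f) ℤ.* (pos 1 ℤ.- j ℤ.* q) ℤ.+ a ℤ.* (pos 1 ℤ.- q ℤ.* q′) ℤ.* (r ℤ.* f) ≡
      a ℤ.* (p ℤ.* (pos 1 ℤ.- j ℤ.* q) ℤ.- q ℤ.* r ℤ.* (f ℤ.* (q′ ℤ.- j)))
    rearrange = solve 7 (λ a p r f q j q′ → a :* (p :- r :* f) :* (con (pos 1) :- j :* q) :+
                                            a :* (con (pos 1) :- q :* q′) :* (r :* f)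
                                  := a :* (p :* (con (pos 1) :- j :* q) :- q :* r :* (f :* (q′ :- j)))) refl
    q′ : ℤ
    q′ = pos (q ℕ.^ t)
    -- The factors 1 - j q and q (q′ - j) added at step j differ by 1 - q q′, which q^s makes
    -- divisible by i!. So the two products stay congruent, up to q^s, while their factors are
    -- exchanged one at a time.
    go : ∀ j → pos (i !) ∣ℤ pos (q ℕ.^ s) ℤ.* (scaledFalling q j ℤ.- pos (q ℕ.^ j) ℤ.* falling q′ j)
    go zero    = ℤ∣.divides (pos 0) (trans (ℤ.*-zeroʳ (pos (q ℕ.^ s))) refl)
    go (suc j) = subst (pos (i !) ∣ℤ_)
      (trans (rearrange
              (pos (q ℕ.^ s)) (scaledFalling q j) (pos (q ℕ.^ j)) (falling q′ j) (pos q) (pos j) q′)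
        (cong (λ z → pos (q ℕ.^ s) ℤ.* (scaledFalling q (suc j) ℤ.- z ℤ.* falling q′ (suc j))) (sym (ℤ.pos-* q (q ℕ.^ j)))))
      (ℤ∣.∣m∣n⇒∣m+n (ℤ∣.∣m⇒∣m*n (pos 1 ℤ.- pos j ℤ.* pos q) (go j))
                    (ℤ∣.∣m⇒∣m*n (pos (q ℕ.^ j) ℤ.* falling q′ j) M∣))

  scaledFalling-correct : ∀ q .{{_ : NonZero q}} i →
    fallingFactorial (pos 1 ℚ./ q) i ℚ.* ι (pos (q ℕ.^ i)) ≡ ι (scaledFalling q i)
  scaledFalling-correct q zero    = refl
  scaledFalling-correct q (suc i) = begin
    ff ℚ.* (1/q ℚ.- ι (pos i)) ℚ.* ι (pos (q ℕ.^ suc i))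
      ≡⟨ cong (ff ℚ.* (1/q ℚ.- ι (pos i)) ℚ.*_) (trans (cong ι (ℤ.pos-* q (q ℕ.^ i))) (ι-* (pos q) (pos (q ℕ.^ i)))) ⟩
    ff ℚ.* (1/q ℚ.- ι (pos i)) ℚ.* (ι (pos q) ℚ.* ι (pos (q ℕ.^ i)))
      ≡⟨ solve 5 (λ f r i q p → f :* (r :- i) :* (q :* p) := (f :* p) :* (r :* q :- i :* q)) refl
           ff 1/q (ι (pos i)) (ι (pos q)) (ι (pos (q ℕ.^ i))) ⟩
    (ff ℚ.* ι (pos (q ℕ.^ i))) ℚ.* (1/q ℚ.* ι (pos q) ℚ.- ι (pos i) ℚ.* ι (pos q))
      ≡⟨ cong₂ (λ a b → a ℚ.* (b ℚ.- ι (pos i) ℚ.* ι (pos q))) (scaledFalling-correct q i) (/⇒* (pos 1) q) ⟩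
    ι (scaledFalling q i) ℚ.* (ι (pos 1) ℚ.- ι (pos i) ℚ.* ι (pos q))
      ≡⟨ cong (λ z → ι (scaledFalling q i) ℚ.* (ι (pos 1) ℚ.+ z))
           (sym (trans (ι-neg (pos i ℤ.* pos q)) (cong ℚ.-_ (ι-* (pos i) (pos q))))) ⟩
    ι (scaledFalling q i) ℚ.* (ι (pos 1) ℚ.+ ι (ℤ.- (pos i ℤ.* pos q)))
      ≡⟨ cong (ι (scaledFalling q i) ℚ.*_) (ι-+ (pos 1) (ℤ.- (pos i ℤ.* pos q))) ⟨
    ι (scaledFalling q i) ℚ.* ι (pos 1 ℤ.- pos i ℤ.* pos q)
      ≡⟨ ι-* (scaledFalling q i) (pos 1 ℤ.- pos i ℤ.* pos q) ⟨
    ι (scaledFalling q (suc i)) ∎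
    where
    open ≡.≡-Reasoning
    open ℚSolver.+-*-Solver
    ff 1/q : ℚ
    ff = fallingFactorial (pos 1 ℚ./ q) i
    1/q = pos 1 ℚ./ q

  ι-power : ∀ q s t → ι (pos (q ℕ.^ (s ℕ.+ t))) ≡ ι (pos (q ℕ.^ s)) ℚ.* ι (pos (q ℕ.^ t))
  ι-power q s t = trans (cong (ι ∘ pos) (ℕ.^-distribˡ-+-* q s t))
    (trans (cong ι (ℤ.pos-* (q ℕ.^ s) (q ℕ.^ t))) (ι-* (pos (q ℕ.^ s)) (pos (q ℕ.^ t))))

  -- The power q^i clears the denominators of the factors 1/q - j, and the further q^s makes the
  -- resulting integer divisible by i!.
  binomial-integral : ∀ q .{{_ : NonZero q}} i →
    ∃[ m ] ∃[ s ] binomial (pos 1 ℚ./ q) i ≡ ℚ._/_ m (q ℕ.^ s) {{ℕ.m^n≢0 q s}}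
  binomial-integral q i = m , s ℕ.+ i , *⇒/ m (q ℕ.^ (s ℕ.+ i)) {{ℕ.m^n≢0 q (s ℕ.+ i)}} (ι-cancel (i !) {{i ℕ.!≢0}} (begin
      ff ℚ.* 1/i! ℚ.* ι (pos (q ℕ.^ (s ℕ.+ i))) ℚ.* ι (pos (i !))
        ≡⟨ cong (λ z → ff ℚ.* 1/i! ℚ.* z ℚ.* ι (pos (i !))) (ι-power q s i) ⟩
      ff ℚ.* 1/i! ℚ.* (ι (pos (q ℕ.^ s)) ℚ.* ι (pos (q ℕ.^ i))) ℚ.* ι (pos (i !))
        ≡⟨ rearrange
             ff 1/i! (ι (pos (q ℕ.^ s))) (ι (pos (q ℕ.^ i))) (ι (pos (i !))) ⟩
      ι (pos (q ℕ.^ s)) ℚ.* (ff ℚ.* ι (pos (q ℕ.^ i))) ℚ.* (1/i! ℚ.* ι (pos (i !)))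
        ≡⟨ cong₂ (λ a b → ι (pos (q ℕ.^ s)) ℚ.* a ℚ.* b) (scaledFalling-correct q i) (/⇒* (pos 1) (i !) {{i ℕ.!≢0}}) ⟩
      ι (pos (q ℕ.^ s)) ℚ.* ι (scaledFalling q i) ℚ.* 1ℚ
        ≡⟨ ℚ.*-identityʳ _ ⟩
      ι (pos (q ℕ.^ s)) ℚ.* ι (scaledFalling q i)
        ≡⟨ ι-* (pos (q ℕ.^ s)) (scaledFalling q i) ⟨
      ι (pos (q ℕ.^ s) ℤ.* scaledFalling q i)
        ≡⟨ cong ι eq ⟩
      ι (m ℤ.* pos (i !))
        ≡⟨ ι-* m (pos (i !)) ⟩
      ι m ℚ.* ι (pos (i !)) ∎))
    where
    open ≡.≡-Reasoning
    s : ℕ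
    s = proj₁ (!∣scaledFalling q i)
    open _∣ℤ_ (proj₂ (!∣scaledFalling q i)) renaming (quotient to m; equality to eq)
    rearrange : ∀ f r a b d → f ℚ.* r ℚ.* (a ℚ.* b) ℚ.* d ≡ a ℚ.* (f ℚ.* b) ℚ.* (r ℚ.* d)
    rearrange = solve 5 (λ f r a b d → f :* r :* (a :* b) :* d := a :* (f :* b) :* (r :* d)) refl
      where open ℚSolver.+-*-Solver
    ff 1/i! : ℚ
    ff = fallingFactorial (pos 1 ℚ./ q) i
    1/i! = ℚ._/_ (pos 1) (i !) {{i ℕ.!≢0}}

  fraction-+ : ∀ {q r r′} m n s t → r ℚ.* ι (pos (q ℕ.^ s)) ≡ ι m → r′ ℚ.* ι (pos (q ℕ.^ t)) ≡ ι n →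
    (r ℚ.+ r′) ℚ.* ι (pos (q ℕ.^ (s ℕ.+ t))) ≡ ι (m ℤ.* pos (q ℕ.^ t) ℤ.+ n ℤ.* pos (q ℕ.^ s))
  fraction-+ {q} {r} {r′} m n s t eq eq′ = begin
    (r ℚ.+ r′) ℚ.* ι (pos (q ℕ.^ (s ℕ.+ t)))            ≡⟨ cong ((r ℚ.+ r′) ℚ.*_) (ι-power q s t) ⟩
    (r ℚ.+ r′) ℚ.* (qs ℚ.* qt)
      ≡⟨ solve 4 (λ a b s t → (a :+ b) :* (s :* t) := (a :* s) :* t :+ (b :* t) :* s) refl r r′ qs qt ⟩
    (r ℚ.* qs) ℚ.* qt ℚ.+ (r′ ℚ.* qt) ℚ.* qs            ≡⟨ cong₂ (λ a b → a ℚ.* qt ℚ.+ b ℚ.* qs) eq eq′ ⟩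
    ι m ℚ.* qt ℚ.+ ι n ℚ.* qs
      ≡⟨ cong₂ ℚ._+_ (ι-* m (pos (q ℕ.^ t))) (ι-* n (pos (q ℕ.^ s))) ⟨
    ι (m ℤ.* pos (q ℕ.^ t)) ℚ.+ ι (n ℤ.* pos (q ℕ.^ s)) ≡⟨ ι-+ (m ℤ.* pos (q ℕ.^ t)) (n ℤ.* pos (q ℕ.^ s)) ⟨
    ι (m ℤ.* pos (q ℕ.^ t) ℤ.+ n ℤ.* pos (q ℕ.^ s))     ∎
    where
    open ≡.≡-Reasoning
    open ℚSolver.+-*-Solver
    qs qt : ℚ
    qs = ι (pos (q ℕ.^ s))
    qt = ι (pos (q ℕ.^ t))

  fraction-* : ∀ {q r r′} m n s t → r ℚ.* ι (pos (q ℕ.^ s)) ≡ ι m → r′ ℚ.* ι (pos (q ℕ.^ t)) ≡ ι n →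
    (r ℚ.* r′) ℚ.* ι (pos (q ℕ.^ (s ℕ.+ t))) ≡ ι (m ℤ.* n)
  fraction-* {q} {r} {r′} m n s t eq eq′ = begin
    (r ℚ.* r′) ℚ.* ι (pos (q ℕ.^ (s ℕ.+ t))) ≡⟨ cong ((r ℚ.* r′) ℚ.*_) (ι-power q s t) ⟩
    (r ℚ.* r′) ℚ.* (qs ℚ.* qt)
      ≡⟨ solve 4 (λ a b s t → (a :* b) :* (s :* t) := (a :* s) :* (b :* t)) refl r r′ qs qt ⟩
    (r ℚ.* qs) ℚ.* (r′ ℚ.* qt)               ≡⟨ cong₂ ℚ._*_ eq eq′ ⟩
    ι m ℚ.* ι n                              ≡⟨ ι-* m n ⟨
    ι (m ℤ.* n)                              ∎
    where
    open ≡.≡-Reasoning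
    open ℚSolver.+-*-Solver
    qs qt : ℚ
    qs = ι (pos (q ℕ.^ s))
    qt = ι (pos (q ℕ.^ t))

-- Formal sums and polynomials

em-lower : ∀ {a} b → ExcludedMiddle (a ⊔ b) → ExcludedMiddle a
em-lower b em {P} = Dec.map′ lower lift (em {Lift b P})

module Field {c ℓ₁ ℓ₂} (em : ExcludedMiddle (c ⊔ ℓ₁ ⊔ ℓ₂)) (F : HeytingField c ℓ₁ ℓ₂) where

  commutativeRing : CommutativeRing c ℓ₁
  commutativeRing = HeytingCommutativeRing.commutativeRing (HeytingField.heytingCommutativeRing F)

  open CommutativeRing commutativeRing public
  open HeytingField F public using (_#_; tight; #⇒invertible)
  open HeytingProperties (HeytingField.heytingCommutativeRing F) public
    using (1#0; x-0≈x; x#0y#0→xy#0; #-congʳ)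
  open RingProperties ring public
  open ExpProperties commutativeSemiring public
  open MultProperties semiring public
    using (×-congʳ; ×-congˡ; ×-assoc-*; ×-homo-+; ×-homo-1; ×1-homo-*) renaming (_×_ to _·_)
  module Solver = SemiringSolver commutativeSemiring

  zero-or-# : ∀ x → x ≈ 0# ⊎ x # 0#
  zero-or-# x with em-lower (c ⊔ ℓ₁) em {x # 0#}
  ... | yes x#0 = inj₂ x#0
  ... | no ¬x#0 = inj₁ (proj₁ (tight x 0#) ¬x#0)

  #⇒≉ : ∀ {x} → x # 0# → ¬ x ≈ 0#
  #⇒≉ x#0 x≈0 = proj₂ (tight _ _) x≈0 x#0

  ≉⇒# : ∀ {x} → ¬ x ≈ 0# → x # 0#
  ≉⇒# {x} x≉0 with zero-or-# x
  ... | inj₁ x≈0 = contradiction x≈0 x≉0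
  ... | inj₂ x#0 = x#0

  open Reconstruction F using (inverse)

  inverseˡ : ∀ {x} (x#0 : x # 0#) → inverse x#0 * x ≈ 1#
  inverseˡ {x} x#0 = trans (*-congˡ (sym (x-0≈x x))) (proj₁ (proj₂ (#⇒invertible x#0)))

  *-cancelˡ-# : ∀ {x y z} → x # 0# → x * y ≈ x * z → y ≈ z
  *-cancelˡ-# {x} {y} {z} x#0 eq = trans (sym (undo y)) (trans (*-congˡ eq) (undo z))
    where
    undo : ∀ y → inverse x#0 * (x * y) ≈ y
    undo y = trans (sym (*-assoc _ _ _)) (trans (*-congʳ (inverseˡ x#0)) (*-identityˡ y))

  ^-# : ∀ {x} n → x # 0# → x ^ n # 0#
  ^-# zero    x#0 = 1#0
  ^-# (suc n) x#0 = x#0y#0→xy#0 x#0 (^-# n x#0)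

  1^ : ∀ n → 1# ^ n ≈ 1#
  1^ zero    = refl
  1^ (suc n) = trans (*-identityˡ _) (1^ n)

  0^ : ∀ n .{{_ : NonZero n}} → 0# ^ n ≈ 0#
  0^ (suc n) = zeroˡ _

-- Linear functionals on formal sums, and the ring of formal sums

module Sums {c ℓ₁ ℓ₂} (em : ExcludedMiddle (c ⊔ ℓ₁ ⊔ ℓ₂)) (F : HeytingField c ℓ₁ ℓ₂) where

  module F = Field em F
  open ≡ using (refl; sym; trans; cong; cong₂; subst)
  open F using (Carrier; _≈_; _#_; 0#; 1#)
  open Reconstruction F
  open Exponents using (Exp)
  open Sum
  open SetoidReasoning F.setoid

  module _ {X : Exponents} where
    private module X = Exponents X

    linear : (X.Exp → Carrier) → List (Carrier × X.Exp) → Carrier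
    linear φ = List.foldr (λ (x , v) s → x F.* φ v F.+ s) 0#

    opaque
      δ : X.Exp → X.Exp → Carrier
      δ u v = if does (v X.≟ u) then 1# else 0#

      δ-≡ : ∀ {u v} → v ≡ u → δ u v ≈ 1#
      δ-≡ {u} {v} v≡u with v X.≟ u
      ... | yes _   = F.refl
      ... | no v≢u = contradiction v≡u v≢u

      δ-≢ : ∀ {u v} → v ≢ u → δ u v ≈ 0#
      δ-≢ {u} {v} v≢u with v X.≟ u
      ... | yes v≡u = contradiction v≡u v≢u
      ... | no _    = F.refl

    infix 5 _▹_
    opaque
      unfolding δ

      -- The linear extension of `φ` from exponents to formal sums; `δ u` extends to the coefficient
      -- at `u`. Equality of sums is agreement under all these functionals (`≈ₚ⇒▹`, `▹⇒≈ₚ`), which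
      -- turns ring identities into identities between nested pairings.
      _▹_ : Sum X → (X.Exp → Carrier) → Carrier
      p ▹ φ = linear φ (terms p)

      coeff≈▹ : ∀ p u → coeff p u ≈ p ▹ δ u
      coeff≈▹ ⟪ ts ⟫ u = go ts
        where
        go : ∀ ts → coeff {X} ⟪ ts ⟫ u ≈ linear (δ u) ts
        go []             = F.refl
        go ((x , v) ∷ ts) with v X.≟ u
        ... | yes _ = F.+-cong (F.sym (F.*-identityʳ x)) (go ts)
        ... | no _  = F.trans (go ts) (F.sym (F.trans (F.+-congʳ (F.zeroʳ x)) (F.+-identityˡ _)))

      ▹-cong : ∀ p {φ ψ} → (∀ u → φ u ≈ ψ u) → p ▹ φ ≈ p ▹ ψ
      ▹-cong ⟪ ts ⟫ {φ} {ψ} eq = go ts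
        where
        go : ∀ ts → linear φ ts ≈ linear ψ ts
        go []             = F.refl
        go ((x , v) ∷ ts) = F.+-cong (F.*-congˡ (eq v)) (go ts)

      linear-++ : ∀ φ ts us → linear φ (ts ++ us) ≈ linear φ ts F.+ linear φ us
      linear-++ φ []             us = F.sym (F.+-identityˡ _)
      linear-++ φ ((x , v) ∷ ts) us = F.trans (F.+-congˡ (linear-++ φ ts us)) (F.sym (F.+-assoc _ _ _))

      ▹-+ : ∀ p q φ → (p + q) ▹ φ ≈ (p ▹ φ) F.+ (q ▹ φ)
      ▹-+ p q φ = linear-++ φ (terms p) (terms q)

      ▹-[] : ∀ φ → ⟪ [] ⟫ ▹ φ ≈ 0#
      ▹-[] φ = F.refl

      ▹-neg : ∀ p φ → (- p) ▹ φ ≈ F.- (p ▹ φ)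
      ▹-neg ⟪ ts ⟫ φ = go ts
        where
        go : ∀ ts → (- ⟪ ts ⟫) ▹ φ ≈ F.- linear φ ts
        go []             = F.sym F.-0#≈0#
        go ((x , v) ∷ ts) = F.trans (F.+-cong (F.sym (F.-‿distribˡ-* _ _)) (go ts)) (F.-‿+-comm _ _)

      ▹-0 : ∀ p → p ▹ (λ _ → 0#) ≈ 0#
      ▹-0 ⟪ ts ⟫ = go ts
        where
        go : ∀ ts → linear (λ _ → 0#) ts ≈ 0#
        go []             = F.refl
        go ((x , v) ∷ ts) = F.trans (F.+-cong (F.zeroʳ x) (go ts)) (F.+-identityˡ _)

      ▹-distrib : ∀ p φ ψ → p ▹ (λ u → φ u F.+ ψ u) ≈ (p ▹ φ) F.+ (p ▹ ψ)
      ▹-distrib ⟪ ts ⟫ φ ψ = go ts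
        where
        go : ∀ ts → linear (λ u → φ u F.+ ψ u) ts ≈ linear φ ts F.+ linear ψ ts
        go []             = F.sym (F.+-identityˡ _)
        go ((x , v) ∷ ts) = F.trans (F.+-congˡ (go ts))
          (solve 5 (λ x a b s t → x :* (a :+ b) :+ (s :+ t) := (x :* a :+ s) :+ (x :* b :+ t)) F.refl
            x (φ v) (ψ v) _ _)
          where open F.Solver

      ▹-scale : ∀ p z φ → p ▹ (λ u → z F.* φ u) ≈ z F.* (p ▹ φ)
      ▹-scale ⟪ ts ⟫ z φ = go ts
        where
        go : ∀ ts → linear (λ u → z F.* φ u) ts ≈ z F.* linear φ ts
        go []             = F.sym (F.zeroʳ z)
        go ((x , v) ∷ ts) = F.trans (F.+-congˡ (go ts))
          (solve 4 (λ x z a s → x :* (z :* a) :+ z :* s := z :* (x :* a :+ s)) F.refl x z (φ v) _)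
          where open F.Solver

      ▹-monomial : ∀ x u φ → monomial x u ▹ φ ≈ x F.* φ u
      ▹-monomial x u φ = F.+-identityʳ _

      ▹-* : ∀ p q φ → (p * q) ▹ φ ≈ p ▹ (λ u → q ▹ (λ v → φ (u X.∙ v)))
      ▹-* ⟪ ts ⟫ ⟪ us ⟫ φ = go ts
        where
        row : ∀ x u us → linear φ (List.map (λ (z , v) → x F.* z , u X.∙ v) us)
                         ≈ x F.* linear (λ v → φ (u X.∙ v)) us
        row x u []             = F.sym (F.zeroʳ x)
        row x u ((z , v) ∷ us) = F.trans (F.+-cong (F.*-assoc _ _ _) (row x u us)) (F.sym (F.distribˡ _ _ _))
        go : ∀ ts → (⟪ ts ⟫ * ⟪ us ⟫) ▹ φ ≈ linear (λ u → linear (λ v → φ (u X.∙ v)) us) ts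
        go []             = F.refl
        go ((x , u) ∷ ts) = F.trans (linear-++ φ (List.map _ us) _) (F.+-cong (row x u us) (go ts))

    private
      remove : X.Exp → List (Carrier × X.Exp) → List (Carrier × X.Exp)
      remove v []             = []
      remove v ((x , u) ∷ ts) = if does (u X.≟ v) then remove v ts else (x , u) ∷ remove v ts

      linear-remove : ∀ φ v ts → linear φ ts ≈ coeff {X} ⟪ ts ⟫ v F.* φ v F.+ linear φ (remove v ts)
      linear-remove φ v []             = F.sym (F.trans (F.+-identityʳ _) (F.zeroˡ _))
      linear-remove φ v ((x , u) ∷ ts) with u X.≟ v
      ... | yes refl = F.trans (F.+-congˡ (linear-remove φ v ts))
        (solve 4 (λ x a s t → x :* a :+ (s :* a :+ t) := (x :+ s) :* a :+ t) F.refl x (φ v) _ _)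
        where open F.Solver
      ... | no _     = F.trans (F.+-congˡ (linear-remove φ v ts))
        (solve 3 (λ x s t → x :+ (s :+ t) := s :+ (x :+ t)) F.refl _ _ _)
        where open F.Solver

      coeff-remove-≡ : ∀ v ts → coeff {X} ⟪ remove v ts ⟫ v ≈ 0#
      coeff-remove-≡ v []             = F.refl
      coeff-remove-≡ v ((x , u) ∷ ts) with u X.≟ v
      ... | yes _ = coeff-remove-≡ v ts
      ... | no u≢v with u X.≟ v
      ...   | yes u≡v = contradiction u≡v u≢v
      ...   | no _    = coeff-remove-≡ v ts

      coeff-remove-≢ : ∀ {v w} → w ≢ v → ∀ ts → coeff {X} ⟪ remove v ts ⟫ w ≈ coeff {X} ⟪ ts ⟫ w
      coeff-remove-≢ w≢v []             = F.refl
      coeff-remove-≢ {v} {w} w≢v ((x , u) ∷ ts) with u X.≟ v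
      ... | no _ with u X.≟ w
      ...   | yes _ = F.+-congˡ (coeff-remove-≢ w≢v ts)
      ...   | no _  = coeff-remove-≢ w≢v ts
      coeff-remove-≢ {v} {w} w≢v ((x , u) ∷ ts) | yes u≡v with u X.≟ w
      ...   | yes u≡w = contradiction (trans (sym u≡w) u≡v) w≢v
      ...   | no _    = coeff-remove-≢ w≢v ts

      length-remove : ∀ v ts → List.length (remove v ts) ≤ List.length ts
      length-remove v []             = z≤n
      length-remove v ((x , u) ∷ ts) with u X.≟ v
      ... | yes _ = ℕ.m≤n⇒m≤1+n (length-remove v ts)
      ... | no _  = s≤s (length-remove v ts)

      length-remove-head : ∀ x v ts → List.length (remove v ((x , v) ∷ ts)) ≤ List.length ts
      length-remove-head x v ts with v X.≟ v
      ... | yes _  = length-remove v ts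
      ... | no v≢v = contradiction refl v≢v

    opaque
      unfolding _▹_

      -- Since exponents may be repeated, the induction is on the length of the list and removes all
      -- occurrences of the first exponent at once. Together they contribute `coeff p u * φ u`,
      -- which is zero, and the other coefficients do not change.
      ▹-vanish : ∀ p φ → (∀ u → coeff p u F.* φ u ≈ 0#) → p ▹ φ ≈ 0#
      ▹-vanish ⟪ ts ⟫ φ = go (List.length ts) ts ℕ.≤-refl
        where
        go : ∀ k ts → List.length ts ≤ k → (∀ u → coeff {X} ⟪ ts ⟫ u F.* φ u ≈ 0#) → linear φ ts ≈ 0#
        go k       []                 _       h = F.refl
        go (suc k) ts@((x , v) ∷ ts′) (s≤s l) h = begin
          linear φ ts ≈⟨ linear-remove φ v ts ⟩
          coeff {X} ⟪ ts ⟫ v F.* φ v F.+ linear φ (remove v ts)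
            ≈⟨ F.+-cong (h v) (go k (remove v ts) (ℕ.≤-trans (length-remove-head x v ts′) l) h′) ⟩
          0# F.+ 0#   ≈⟨ F.+-identityˡ 0# ⟩
          0#          ∎
          where
          h′ : ∀ u → coeff {X} ⟪ remove v ts ⟫ u F.* φ u ≈ 0#
          h′ u with u X.≟ v
          ... | yes refl = F.trans (F.*-congʳ (coeff-remove-≡ v ts)) (F.zeroˡ _)
          ... | no u≢v   = F.trans (F.*-congʳ (coeff-remove-≢ u≢v ts)) (h u)

    ≈ₚ⇒▹ : ∀ {p q} → p ≈ₚ q → ∀ φ → p ▹ φ ≈ q ▹ φ
    ≈ₚ⇒▹ {p} {q} eq φ = F.x∙y⁻¹≈ε⇒x≈y _ _ (F.trans (F.sym (difference φ))
      (▹-vanish (p + - q) φ λ u → F.trans (F.*-congʳ (begin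
        coeff (p + - q) u       ≈⟨ coeff≈▹ (p + - q) u ⟩
        (p + - q) ▹ δ u         ≈⟨ difference (δ u) ⟩
        (p ▹ δ u) F.- (q ▹ δ u) ≈⟨ F.+-cong (coeff≈▹ p u) (F.-‿cong (coeff≈▹ q u)) ⟨
        coeff p u F.- coeff q u ≈⟨ F.+-congʳ (eq u) ⟩
        coeff q u F.- coeff q u ≈⟨ F.-‿inverseʳ _ ⟩
        0#                      ∎)) (F.zeroˡ _)))
      where
      difference : ∀ φ → (p + - q) ▹ φ ≈ (p ▹ φ) F.- (q ▹ φ)
      difference φ = F.trans (▹-+ p (- q) φ) (F.+-congˡ (▹-neg q φ))

    ▹⇒≈ₚ : ∀ {p q} → (∀ φ → p ▹ φ ≈ q ▹ φ) → p ≈ₚ q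
    ▹⇒≈ₚ {p} {q} eq u = F.trans (coeff≈▹ p u) (F.trans (eq (δ u)) (F.sym (coeff≈▹ q u)))

    -- An exponent outside the support may still be listed, with cancelling coefficients, so the
    -- terms cannot be compared one by one; `▹-vanish` is applied to the difference of the two
    -- functionals instead.
    ▹-supp : ∀ p {φ ψ} → (∀ u → u ∈supp p → φ u ≈ ψ u) → p ▹ φ ≈ p ▹ ψ
    ▹-supp p {φ} {ψ} eq = begin
      p ▹ φ
        ≈⟨ ▹-cong p (λ u → F.trans (F.sym (F.+-identityʳ _))
             (F.trans (F.+-congˡ (F.sym (F.-‿inverseˡ (ψ u)))) (F.sym (F.+-assoc _ _ _)))) ⟩
      p ▹ (λ u → (φ u F.- ψ u) F.+ ψ u)     ≈⟨ ▹-distrib p (λ u → φ u F.- ψ u) ψ ⟩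
      (p ▹ (λ u → φ u F.- ψ u)) F.+ (p ▹ ψ) ≈⟨ F.+-congʳ (▹-vanish p _ (λ u → vanish u (F.zero-or-# (coeff p u)))) ⟩
      0# F.+ (p ▹ ψ)                        ≈⟨ F.+-identityˡ _ ⟩
      p ▹ ψ                                 ∎
      where
      vanish : ∀ u → coeff p u ≈ 0# ⊎ u ∈supp p → coeff p u F.* (φ u F.- ψ u) ≈ 0#
      vanish u (inj₁ z) = F.trans (F.*-congʳ z) (F.zeroˡ _)
      vanish u (inj₂ s) = F.trans (F.*-congˡ (F.trans (F.+-congʳ (eq u s)) (F.-‿inverseʳ _))) (F.zeroʳ _)

    ▹-single : ∀ p b {φ} → (∀ u → u ∈supp p → u ≢ b → φ u ≈ 0#) → p ▹ φ ≈ coeff p b F.* φ b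
    ▹-single p b {φ} h = begin
      p ▹ φ                     ≈⟨ ▹-supp p agree ⟩
      p ▹ (λ u → φ b F.* δ b u) ≈⟨ ▹-scale p (φ b) (δ b) ⟩
      φ b F.* (p ▹ δ b)         ≈⟨ F.*-congˡ (coeff≈▹ p b) ⟨
      φ b F.* coeff p b         ≈⟨ F.*-comm _ _ ⟩
      coeff p b F.* φ b         ∎
      where
      agree : ∀ u → u ∈supp p → φ u ≈ φ b F.* δ b u
      agree u s with u X.≟ b
      ... | yes refl = F.sym (F.trans (F.*-congˡ (δ-≡ refl)) (F.*-identityʳ _))
      ... | no u≢b   = F.trans (h u s u≢b) (F.sym (F.trans (F.*-congˡ (δ-≢ u≢b)) (F.zeroʳ _)))

    ∈supp⇒∈ : ∀ (p : Sum X) {u} → u ∈supp p → u ∈ₗ List.map proj₂ (terms p)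
    ∈supp⇒∈ ⟪ ts ⟫ {u} s = go ts (F.#⇒≉ s)
      where
      go : ∀ ts → ¬ coeff {X} ⟪ ts ⟫ u ≈ 0# → u ∈ₗ List.map proj₂ ts
      go []             h = contradiction F.refl h
      go ((x , v) ∷ ts) h with v X.≟ u
      ... | yes refl = here refl
      ... | no _     = there (go ts h)

  opaque
    unfolding _▹_

    ▹-swap : ∀ {X Y} (p : Sum X) (q : Sum Y) (φ : Exp X → Exp Y → Carrier) →
             p ▹ (λ u → q ▹ φ u) ≈ q ▹ (λ v → p ▹ (λ u → φ u v))
    ▹-swap {X} {Y} ⟪ ts ⟫ q φ = go ts
      where
      go : ∀ ts → linear {X} (λ u → q ▹ φ u) ts ≈ q ▹ (λ v → linear {X} (λ u → φ u v) ts)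
      go []             = F.sym (▹-0 q)
      go ((x , u) ∷ ts) = F.trans (F.+-cong (F.sym (▹-scale q x (φ u))) (go ts))
                                  (F.sym (▹-distrib q _ _))

  module _ {X Y : Exponents} where

    transform : (Exp X → Carrier) → (Exp X → Exp Y) → Sum X → Sum Y
    transform χ Θ p = ⟪ List.map (λ (x , u) → x F.* χ u , Θ u) (terms p) ⟫

    opaque
      unfolding _▹_

      ▹-transform : ∀ χ Θ p φ → transform χ Θ p ▹ φ ≈ p ▹ (λ u → χ u F.* φ (Θ u))
      ▹-transform χ Θ ⟪ ts ⟫ φ = go ts
        where
        go : ∀ ts → transform χ Θ ⟪ ts ⟫ ▹ φ ≈ linear {X} (λ u → χ u F.* φ (Θ u)) ts
        go []             = F.refl
        go ((x , u) ∷ ts) = F.+-cong (F.*-assoc _ _ _) (go ts)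

  record ExponentLaws (X : Exponents) : Set where
    field
      isCommutativeMonoid : IsCommutativeMonoid _≡_ (Exponents._∙_ X) (Exponents.ε X)
    open IsCommutativeMonoid isCommutativeMonoid public using (assoc; comm; identityˡ; identityʳ)

  ℕ^-laws : ∀ n → ExponentLaws (ℕ^ n)
  ℕ^-laws n = record { isCommutativeMonoid = record
    { isMonoid = record
      { isSemigroup = record { isMagma = ≡.isMagma _ ; assoc = Vec.zipWith-assoc ℕ.+-assoc }
      ; identity = Vec.zipWith-identityˡ ℕ.+-identityˡ , Vec.zipWith-identityʳ ℕ.+-identityʳ }
    ; comm = Vec.zipWith-comm ℕ.+-comm } }

  ℤ^-laws : ∀ n → ExponentLaws (ℤ^ n)
  ℤ^-laws n = record { isCommutativeMonoid = record
    { isMonoid = record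
      { isSemigroup = record { isMagma = ≡.isMagma _ ; assoc = Vec.zipWith-assoc ℤ.+-assoc }
      ; identity = Vec.zipWith-identityˡ ℤ.+-identityˡ , Vec.zipWith-identityʳ ℤ.+-identityʳ }
    ; comm = Vec.zipWith-comm ℤ.+-comm } }

  module Ring {X : Exponents} (laws : ExponentLaws X) where
    private
      module X = Exponents X
      module L = ExponentLaws laws

    *-cong : ∀ {p p′ q q′ : Sum X} → p ≈ₚ p′ → q ≈ₚ q′ → p * q ≈ₚ p′ * q′
    *-cong {p} {p′} {q} {q′} eq eq′ = ▹⇒≈ₚ {p = p * q} {q = p′ * q′} λ φ → begin
      (p * q) ▹ φ                           ≈⟨ ▹-* p q φ ⟩
      p ▹ (λ u → q ▹ (λ v → φ (u X.∙ v)))   ≈⟨ ▹-cong p (λ u → ≈ₚ⇒▹ {p = q} {q = q′} eq′ _) ⟩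
      p ▹ (λ u → q′ ▹ (λ v → φ (u X.∙ v)))  ≈⟨ ≈ₚ⇒▹ {p = p} {q = p′} eq _ ⟩
      p′ ▹ (λ u → q′ ▹ (λ v → φ (u X.∙ v))) ≈⟨ ▹-* p′ q′ φ ⟨
      (p′ * q′) ▹ φ                         ∎

    *-assoc : ∀ (p q r : Sum X) → (p * q) * r ≈ₚ p * (q * r)
    *-assoc p q r = ▹⇒≈ₚ {p = (p * q) * r} {q = p * (q * r)} λ φ → begin
      ((p * q) * r) ▹ φ                                       ≈⟨ ▹-* (p * q) r φ ⟩
      (p * q) ▹ (λ u → r ▹ (λ w → φ (u X.∙ w)))               ≈⟨ ▹-* p q _ ⟩
      p ▹ (λ u → q ▹ (λ v → r ▹ (λ w → φ ((u X.∙ v) X.∙ w))))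
        ≈⟨ ▹-cong p (λ u → ▹-cong q λ v → ▹-cong r λ w → F.reflexive (cong φ (L.assoc u v w))) ⟩
      p ▹ (λ u → q ▹ (λ v → r ▹ (λ w → φ (u X.∙ (v X.∙ w))))) ≈⟨ ▹-cong p (λ u → ▹-* q r (λ v → φ (u X.∙ v))) ⟨
      p ▹ (λ u → (q * r) ▹ (λ v → φ (u X.∙ v)))               ≈⟨ ▹-* p (q * r) φ ⟨
      (p * (q * r)) ▹ φ                                       ∎

    *-comm : ∀ (p q : Sum X) → p * q ≈ₚ q * p
    *-comm p q = ▹⇒≈ₚ {p = p * q} {q = q * p} λ φ → begin
      (p * q) ▹ φ                         ≈⟨ ▹-* p q φ ⟩
      p ▹ (λ u → q ▹ (λ v → φ (u X.∙ v))) ≈⟨ ▹-swap p q _ ⟩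
      q ▹ (λ v → p ▹ (λ u → φ (u X.∙ v))) ≈⟨ ▹-cong q (λ v → ▹-cong p λ u → F.reflexive (cong φ (L.comm u v))) ⟩
      q ▹ (λ v → p ▹ (λ u → φ (v X.∙ u))) ≈⟨ ▹-* q p φ ⟨
      (q * p) ▹ φ                         ∎

    ▹-const : ∀ x (q : Sum X) φ → (const x * q) ▹ φ ≈ x F.* (q ▹ φ)
    ▹-const x q φ = begin
      (const x * q) ▹ φ                             ≈⟨ ▹-* (const x) q φ ⟩
      const {X} x ▹ (λ u → q ▹ (λ v → φ (u X.∙ v))) ≈⟨ ▹-monomial {X} x X.ε (λ u → q ▹ (λ v → φ (u X.∙ v))) ⟩
      x F.* (q ▹ (λ v → φ (X.ε X.∙ v)))
        ≈⟨ F.*-congˡ (▹-cong q (λ v → F.reflexive (cong φ (L.identityˡ v)))) ⟩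
      x F.* (q ▹ φ)                                 ∎

    *-identityˡ : ∀ (q : Sum X) → const 1# * q ≈ₚ q
    *-identityˡ q = ▹⇒≈ₚ {p = const 1# * q} {q = q} λ φ → F.trans (▹-const 1# q φ) (F.*-identityˡ _)

    distribˡ : ∀ (p q r : Sum X) → p * (q + r) ≈ₚ p * q + p * r
    distribˡ p q r = ▹⇒≈ₚ {p = p * (q + r)} {q = p * q + p * r} λ φ → begin
      (p * (q + r)) ▹ φ                                                   ≈⟨ ▹-* p (q + r) φ ⟩
      p ▹ (λ u → (q + r) ▹ (λ v → φ (u X.∙ v)))                           ≈⟨ ▹-cong p (λ u → ▹-+ q r _) ⟩
      p ▹ (λ u → (q ▹ (λ v → φ (u X.∙ v))) F.+ (r ▹ (λ v → φ (u X.∙ v)))) ≈⟨ ▹-distrib p _ _ ⟩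
      (p ▹ (λ u → q ▹ (λ v → φ (u X.∙ v)))) F.+ (p ▹ (λ u → r ▹ (λ v → φ (u X.∙ v))))
        ≈⟨ F.+-cong (▹-* p q φ) (▹-* p r φ) ⟨
      ((p * q) ▹ φ) F.+ ((p * r) ▹ φ)                                     ≈⟨ ▹-+ (p * q) (p * r) φ ⟨
      (p * q + p * r) ▹ φ                                                 ∎

    +-cong : ∀ {p p′ q q′ : Sum X} → p ≈ₚ p′ → q ≈ₚ q′ → p + q ≈ₚ p′ + q′
    +-cong {p} {p′} {q} {q′} eq eq′ = ▹⇒≈ₚ {p = p + q} {q = p′ + q′} λ φ →
      F.trans (▹-+ p q φ)
        (F.trans (F.+-cong (≈ₚ⇒▹ {p = p} {q = p′} eq φ) (≈ₚ⇒▹ {p = q} {q = q′} eq′ φ)) (F.sym (▹-+ p′ q′ φ)))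

    +-assoc : ∀ (p q r : Sum X) → (p + q) + r ≈ₚ p + (q + r)
    +-assoc p q r = ▹⇒≈ₚ {p = (p + q) + r} {q = p + (q + r)} λ φ → begin
      ((p + q) + r) ▹ φ                 ≈⟨ F.trans (▹-+ (p + q) r φ) (F.+-congʳ (▹-+ p q φ)) ⟩
      ((p ▹ φ) F.+ (q ▹ φ)) F.+ (r ▹ φ) ≈⟨ F.+-assoc _ _ _ ⟩
      (p ▹ φ) F.+ ((q ▹ φ) F.+ (r ▹ φ)) ≈⟨ F.trans (▹-+ p (q + r) φ) (F.+-congˡ (▹-+ q r φ)) ⟨
      (p + (q + r)) ▹ φ                 ∎

    +-comm : ∀ (p q : Sum X) → p + q ≈ₚ q + p
    +-comm p q = ▹⇒≈ₚ {p = p + q} {q = q + p} λ φ → F.trans (▹-+ p q φ) (F.trans (F.+-comm _ _) (F.sym (▹-+ q p φ)))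

    +-identityʳ : ∀ (p : Sum X) → p + ⟪ [] ⟫ ≈ₚ p
    +-identityʳ p = ▹⇒≈ₚ {p = p + ⟪ [] ⟫} {q = p} λ φ →
      F.trans (▹-+ p ⟪ [] ⟫ φ) (F.trans (F.+-congˡ (▹-[] φ)) (F.+-identityʳ _))

    -‿cong : ∀ {p q : Sum X} → p ≈ₚ q → - p ≈ₚ - q
    -‿cong {p} {q} eq = ▹⇒≈ₚ {p = - p} {q = - q} λ φ →
      F.trans (▹-neg p φ) (F.trans (F.-‿cong (≈ₚ⇒▹ {p = p} {q = q} eq φ)) (F.sym (▹-neg q φ)))

    -‿inverseʳ : ∀ (p : Sum X) → p + - p ≈ₚ ⟪ [] ⟫
    -‿inverseʳ p = ▹⇒≈ₚ {p = p + - p} {q = ⟪ [] ⟫} λ φ →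
      F.trans (▹-+ p (- p) φ) (F.trans (F.+-congˡ (▹-neg p φ)) (F.trans (F.-‿inverseʳ _) (F.sym (▹-[] φ))))

    polynomialRing : CommutativeRing c ℓ₁
    polynomialRing = record
      { Carrier = Sum X
      ; _≈_ = _≈ₚ_ ; _+_ = _+_ ; _*_ = _*_ ; -_ = -_ ; 0# = ⟪ [] ⟫ ; 1# = const 1#
      ; isCommutativeRing = record
        { isRing = record
          { +-isAbelianGroup = record
            { isGroup = record
              { isMonoid = record
                { isSemigroup = record
                  { isMagma = record
                    { isEquivalence = record
                      { refl = λ u → F.refl ; sym = λ eq u → F.sym (eq u) ; trans = λ eq eq′ u → F.trans (eq u) (eq′ u) }
                    ; ∙-cong = λ {p} {p′} {q} {q′} → +-cong {p} {p′} {q} {q′} }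
                  ; assoc = +-assoc }
                ; identity = (λ p u → F.refl) , +-identityʳ }
              ; inverse = (λ p u → F.trans (+-comm (- p) p u) (-‿inverseʳ p u)) , (λ p → -‿inverseʳ p)
              ; ⁻¹-cong = λ {p} {q} → -‿cong {p} {q} }
            ; comm = +-comm }
          ; *-cong = λ {p} {p′} {q} {q′} → *-cong {p} {p′} {q} {q′}
          ; *-assoc = *-assoc
          ; *-identity = *-identityˡ , λ p u → F.trans (*-comm p (const 1#) u) (*-identityˡ p u)
          ; distrib = distribˡ , λ p q r u → F.trans (*-comm (q + r) p u)
              (F.trans (distribˡ p q r u) (+-cong {p * q} {q * p} {p * r} {r * p} (*-comm p q) (*-comm p r) u)) }
        ; *-comm = *-comm } }

-- Arithmetic of exponent vectors

infixl 6 _⊕_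
_⊕_ : ∀ {n} → Vec ℕ n → Vec ℕ n → Vec ℕ n
_⊕_ = zipWith ℕ._+_

infixl 7 _⊗_
_⊗_ : ∀ {n} → ℕ → Vec ℕ n → Vec ℕ n
j ⊗ a = Vec.map (j ℕ.*_) a

0s : ∀ {n} → Vec ℕ n
0s = replicate _ 0

unit : ∀ {n} → Fin n → Vec ℕ n
unit i = replicate _ 0 [ i ]≔ 1

module _ where
  open ≡ using (refl; sym; trans; cong; cong₂)

  0⊗ : ∀ {n} (a : Vec ℕ n) → 0 ⊗ a ≡ 0s
  0⊗ []      = refl
  0⊗ (x ∷ a) = cong (0 ∷_) (0⊗ a)

  suc⊗ : ∀ {n} j (a : Vec ℕ n) → a ⊕ j ⊗ a ≡ suc j ⊗ a
  suc⊗ j []      = refl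
  suc⊗ j (x ∷ a) = cong (x ℕ.+ j ℕ.* x ∷_) (suc⊗ j a)

  ⊗-injective : ∀ {n} e .{{_ : NonZero e}} {u v : Vec ℕ n} → e ⊗ u ≡ e ⊗ v → u ≡ v
  ⊗-injective e {[]}    {[]}    eq = refl
  ⊗-injective e {x ∷ u} {y ∷ v} eq =
    cong₂ _∷_ (ℕ.*-cancelˡ-≡ x y e (Vec.∷-injectiveˡ eq)) (⊗-injective e (Vec.∷-injectiveʳ eq))

  ⊗-0s : ∀ {n} j → j ⊗ 0s {n} ≡ 0s
  ⊗-0s {n} j = trans (Vec.map-replicate (j ℕ.*_) 0 n) (cong (replicate n) (ℕ.*-zeroʳ j))

  ⊕-identityʳ : ∀ {n} (u : Vec ℕ n) → u ⊕ 0s ≡ u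
  ⊕-identityʳ = Vec.zipWith-identityʳ ℕ.+-identityʳ

  ⊕-identityˡ : ∀ {n} (u : Vec ℕ n) → 0s ⊕ u ≡ u
  ⊕-identityˡ = Vec.zipWith-identityˡ ℕ.+-identityˡ

  1⊗ : ∀ {n} (a : Vec ℕ n) → 1 ⊗ a ≡ a
  1⊗ a = trans (Vec.map-cong ℕ.*-identityˡ a) (Vec.map-id a)

  shear-+ : ∀ {n} i j (u v a : Vec ℕ n) →
            (u ⊕ v) ⊕ (i ℕ.+ j) ⊗ a ≡ (u ⊕ i ⊗ a) ⊕ (v ⊕ j ⊗ a)
  shear-+ i j []      []      []      = refl
  shear-+ i j (x ∷ u) (z ∷ v) (s ∷ a) = cong₂ _∷_
    (solve 5 (λ x z i j s → (x :+ z) :+ (i :+ j) :* s := (x :+ i :* s) :+ (z :+ j :* s)) refl x z i j s)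
    (shear-+ i j u v a)
    where open ℕSolver.+-*-Solver

  -- The vector u - j a, undoing the addition of j copies of a. It lives over ℤ because the
  -- substitution of y/α for y in step 8 produces Laurent sums.
  unshear : ∀ {n} → ℕ → Vec ℕ n → Vec ℕ n → Vec ℤ n
  unshear j u a = zipWith (λ m b → pos m ℤ.+ ℤ.- pos (j ℕ.* b)) u a

  unshear-+ : ∀ {n} i j (u v a : Vec ℕ n) →
            unshear (i ℕ.+ j) (u ⊕ v) a ≡ zipWith ℤ._+_ (unshear i u a) (unshear j v a)
  unshear-+ i j []      []      []      = refl
  unshear-+ i j (x ∷ u) (z ∷ v) (s ∷ a) = cong₂ _∷_
    (trans (cong₂ (λ b d → b ℤ.+ ℤ.- d) (ℤ.pos-+ x z)
      (trans (cong pos (ℕ.*-distribʳ-+ s i j)) (ℤ.pos-+ (i ℕ.* s) (j ℕ.* s))))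
      (solve 4 (λ x z i j → (x :+ z) :+ :- (i :+ j) := (x :+ :- i) :+ (z :+ :- j)) refl
        (pos x) (pos z) (pos (i ℕ.* s)) (pos (j ℕ.* s))))
    (unshear-+ i j u v a)
    where open ℤSolver.+-*-Solver

  unshear-0 : ∀ {n} (u a : Vec ℕ n) → unshear 0 u a ≡ Vec.map pos u
  unshear-0 []      []      = refl
  unshear-0 (x ∷ u) (s ∷ a) = cong₂ _∷_ (ℤ.+-identityʳ (pos x)) (unshear-0 u a)

  unshear-1 : ∀ {n} (a : Vec ℕ n) → unshear 1 0s a ≡ Vec.map (λ j → ℤ.- pos j) a
  unshear-1 []      = refl
  unshear-1 (s ∷ a) = cong₂ _∷_ (trans (ℤ.+-identityˡ _) (cong (λ z → ℤ.- pos z) (ℕ.*-identityˡ s))) (unshear-1 a)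

  ⟨⟩-+ : ∀ {n} (u v k : Vec ℕ n) → ⟨ u ⊕ v , k ⟩ ≡ ⟨ u , k ⟩ ℕ.+ ⟨ v , k ⟩
  ⟨⟩-+ []      []      []      = refl
  ⟨⟩-+ (x ∷ u) (z ∷ v) (s ∷ k) = trans (cong ((x ℕ.+ z) ℕ.* s ℕ.+_) (⟨⟩-+ u v k))
    (solve 5 (λ x z s a b → (x :+ z) :* s :+ (a :+ b) := x :* s :+ a :+ (z :* s :+ b)) refl x z s ⟨ u , k ⟩ ⟨ v , k ⟩)
    where open ℕSolver.+-*-Solver

  ⟨⟩-0 : ∀ {n} (k : Vec ℕ n) → ⟨ 0s , k ⟩ ≡ 0
  ⟨⟩-0 []      = refl
  ⟨⟩-0 (s ∷ k) = ⟨⟩-0 k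

  ⟨⟩-⊗ : ∀ {n} e (u k : Vec ℕ n) → ⟨ e ⊗ u , k ⟩ ≡ e ℕ.* ⟨ u , k ⟩
  ⟨⟩-⊗ e []      []      = sym (ℕ.*-zeroʳ e)
  ⟨⟩-⊗ e (x ∷ u) (s ∷ k) = trans (cong (e ℕ.* x ℕ.* s ℕ.+_) (⟨⟩-⊗ e u k))
    (solve 4 (λ e x s r → e :* x :* s :+ e :* r := e :* (x :* s :+ r)) refl e x s ⟨ u , k ⟩)
    where open ℕSolver.+-*-Solver

  ⟨⟩-unit : ∀ {n} i (k : Vec ℕ n) → ⟨ unit i , k ⟩ ≡ lookup k i
  ⟨⟩-unit zero    (s ∷ k) = trans (cong₂ ℕ._+_ (ℕ.*-identityˡ s) (⟨⟩-0 k)) (ℕ.+-identityʳ s)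
  ⟨⟩-unit (suc i) (s ∷ k) = ⟨⟩-unit i k

-- Monomials, and substitutions of monomials for variables

module Monomials {c ℓ₁ ℓ₂} (em : ExcludedMiddle (c ⊔ ℓ₁ ⊔ ℓ₂)) (F : HeytingField c ℓ₁ ℓ₂) where
  open Sums em F
  open F using (Carrier; _≈_; _#_; 0#; 1#)
  open Reconstruction F
  open Exponents using (Exp)
  open Sum
  open SetoidReasoning F.setoid
  open ≡ using (refl; sym; trans; cong; cong₂; subst)

  -- Equality with `monomial x u`, phrased through functionals so that products and powers follow by
  -- substituting into `φ`.
  IsMonomial : ∀ {X} → Carrier → Exp X → Sum X → Set _
  IsMonomial x u p = ∀ φ → p ▹ φ ≈ x F.* φ u

  monomial-isMonomial : ∀ {X} x u → IsMonomial {X} x u (monomial x u)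
  monomial-isMonomial {X} x u = ▹-monomial {X} x u

  IsMonomial-resp : ∀ {X x z u v p} → x ≈ z → u ≡ v → IsMonomial {X} x u p → IsMonomial z v p
  IsMonomial-resp eq refl m φ = F.trans (m φ) (F.*-congʳ eq)

  IsMonomial-* : ∀ {X x z u v p q} → IsMonomial {X} x u p → IsMonomial z v q →
                 IsMonomial (x F.* z) (Exponents._∙_ X u v) (p * q)
  IsMonomial-* {X} {x} {z} {u} {v} {p} {q} mp mq φ = begin
    (p * q) ▹ φ                                     ≈⟨ ▹-* p q φ ⟩
    p ▹ (λ u → q ▹ (λ v → φ (Exponents._∙_ X u v))) ≈⟨ mp _ ⟩
    x F.* (q ▹ (λ v → φ (Exponents._∙_ X u v)))     ≈⟨ F.*-congˡ (mq _) ⟩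
    x F.* (z F.* φ (Exponents._∙_ X u v))           ≈⟨ F.*-assoc _ _ _ ⟨
    (x F.* z) F.* φ (Exponents._∙_ X u v)           ∎

  IsMonomial-^ : ∀ {n x u} {p : Poly n} → IsMonomial x u p → ∀ j → IsMonomial (x F.^ j) (j ⊗ u) (p ^ j)
  IsMonomial-^ {n} {u = u}     m zero    = IsMonomial-resp F.refl (sym (0⊗ u)) (monomial-isMonomial {ℕ^ n} 1# 0s)
  IsMonomial-^ {u = u} {p = p} m (suc j) = IsMonomial-resp F.refl (suc⊗ j u)
    (IsMonomial-* {p = p} {q = p ^ j} m (IsMonomial-^ {p = p} m j))

  coeff-const : ∀ {n} z → coeff (const {ℕ^ n} z) 0s ≈ z
  coeff-const {n} z = F.trans (coeff≈▹ (const {ℕ^ n} z) 0s) (F.trans (▹-monomial {ℕ^ n} z 0s (δ 0s))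
    (F.trans (F.*-congˡ (δ-≡ {ℕ^ n} refl)) (F.*-identityʳ z)))

  -- A substitution of terms for the variables, sending x^u to χ(u) x^Θ(u), separated into its
  -- effect on coefficients and on exponents. The homomorphism laws make both determined by the unit
  -- vectors.
  record MonomialMap (n : ℕ) (X : Exponents) : Set (c ⊔ ℓ₁) where
    private module X = Exponents X
    field
      χ   : Vec ℕ n → Carrier
      Θ   : Vec ℕ n → X.Exp
      χ-0 : χ 0s ≈ 1#
      χ-+ : ∀ u v → χ (u ⊕ v) ≈ χ u F.* χ v
      Θ-0 : Θ 0s ≡ X.ε
      Θ-+ : ∀ u v → Θ (u ⊕ v) ≡ Θ u X.∙ Θ v

  -- A relation, since the polynomials to which it is applied are often given only by a defining
  -- property. Successive transformations compose by feeding the functional of one into the next.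
  IsTransform : ∀ {X Y} → (Exp X → Carrier) → (Exp X → Exp Y) → Sum X → Sum Y → Set _
  IsTransform χ Θ p q = ∀ φ → q ▹ φ ≈ p ▹ (λ u → χ u F.* φ (Θ u))

  module _ {X : Exponents} (laws : ExponentLaws X) where
    open Ring laws
    private module R = CommutativeRing polynomialRing

    -- Both sides are multiplicative in the exponent, so the images of the variables decide. The
    -- recursion peels off the first variable and passes on the restriction `M′` of the substitution
    -- to the others.
    product-isMonomial : ∀ n (t : Vector.Vector (Sum X) n) (M : MonomialMap n X) →
      (∀ i → IsMonomial (MonomialMap.χ M (unit i)) (MonomialMap.Θ M (unit i)) (t i)) →
      ∀ u → IsMonomial (MonomialMap.χ M u) (MonomialMap.Θ M u) (product (λ i → t i ^ lookup u i))
    product-isMonomial zero    t M h []      =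
      IsMonomial-resp (F.sym χ-0) (sym Θ-0) (monomial-isMonomial {X} 1# (Exponents.ε X))
      where open MonomialMap M
    product-isMonomial (suc n) t M h (j ∷ u) = IsMonomial-resp
      (F.trans (F.sym (χ-+ (j ∷ 0s) (0 ∷ u))) (F.reflexive (cong χ split)))
      (trans (sym (Θ-+ (j ∷ 0s) (0 ∷ u))) (cong Θ split))
      (IsMonomial-* {p = t zero ^ j} {q = product (λ i → t (suc i) ^ lookup u i)} (power j)
        (product-isMonomial n (t ∘ suc) M′ (h ∘ suc) u))
      where
      open MonomialMap M
      split : (j ∷ 0s) ⊕ (0 ∷ u) ≡ j ∷ u
      split = cong₂ _∷_ (ℕ.+-identityʳ j) (⊕-identityˡ u)
      M′ : MonomialMap n X
      M′ = record { χ = χ ∘ (0 ∷_) ; Θ = Θ ∘ (0 ∷_) ; χ-0 = χ-0 ; χ-+ = λ u v → χ-+ (0 ∷ u) (0 ∷ v)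
                  ; Θ-0 = Θ-0 ; Θ-+ = λ u v → Θ-+ (0 ∷ u) (0 ∷ v) }
      power : ∀ j → IsMonomial (χ (j ∷ 0s)) (Θ (j ∷ 0s)) (t zero ^ j)
      power zero    = IsMonomial-resp (F.sym χ-0) (sym Θ-0) (monomial-isMonomial {X} 1# (Exponents.ε X))
      power (suc j) = IsMonomial-resp
        (F.trans (F.sym (χ-+ (1 ∷ 0s) (j ∷ 0s))) (F.reflexive (cong (χ ∘ (suc j ∷_)) (⊕-identityˡ 0s))))
        (trans (sym (Θ-+ (1 ∷ 0s) (j ∷ 0s))) (cong (Θ ∘ (suc j ∷_)) (⊕-identityˡ 0s)))
        (IsMonomial-* {p = t zero} {q = t zero ^ j} (h zero) (power j))

    opaque
      unfolding _▹_

      eval-isTransform : ∀ {n} (t : Vector.Vector (Sum X) n) (M : MonomialMap n X) →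
        (∀ i → IsMonomial (MonomialMap.χ M (unit i)) (MonomialMap.Θ M (unit i)) (t i)) →
        ∀ p → IsTransform (MonomialMap.χ M) (MonomialMap.Θ M) p (eval t p)
      eval-isTransform {n} t M h ⟪ ts ⟫ φ = go ts
        where
        open MonomialMap M
        mon : Vec ℕ n → Sum X
        mon u = product (λ i → t i ^ lookup u i)
        go : ∀ ts → eval t ⟪ ts ⟫ ▹ φ ≈ linear {ℕ^ n} (λ u → χ u F.* φ (Θ u)) ts
        go []             = F.refl
        go ((x , u) ∷ ts) = F.trans (▹-+ (const x * mon u) (eval t ⟪ ts ⟫) φ)
          (F.+-cong (F.trans (▹-const x (mon u) φ) (F.*-congˡ (product-isMonomial n t M h u φ))) (go ts))

  module _ {n : ℕ} where

    opaque
      unfolding _▹_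

      ▹-embed : ∀ (p : Poly n) φ → embed p ▹ φ ≈ p ▹ (φ ∘ Vec.map pos)
      ▹-embed ⟪ ts ⟫ φ = go ts
        where
        go : ∀ ts → embed ⟪ ts ⟫ ▹ φ ≈ linear {ℕ^ n} (φ ∘ Vec.map pos) ts
        go []             = F.refl
        go ((x , u) ∷ ts) = F.+-congˡ (go ts)

    -- The coordinatewise absolute value is a left inverse of the inclusion of ℕ^n in ℤ^n, so every
    -- functional on polynomials extends to Laurent sums.
    embed-injective : ∀ {p q : Poly n} → embed p ≈ₚ embed q → p ≈ₚ q
    embed-injective {p} {q} eq = ▹⇒≈ₚ {p = p} {q = q} λ φ → begin
      p ▹ φ                                         ≈⟨ ▹-cong p (λ u → F.reflexive (cong φ (abs-pos u))) ⟨
      p ▹ (λ u → φ (Vec.map ℤ.∣_∣ (Vec.map pos u))) ≈⟨ ▹-embed p _ ⟨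
      embed p ▹ (φ ∘ Vec.map ℤ.∣_∣)                 ≈⟨ ≈ₚ⇒▹ {p = embed p} {q = embed q} eq _ ⟩
      embed q ▹ (φ ∘ Vec.map ℤ.∣_∣)                 ≈⟨ ▹-embed q _ ⟩
      q ▹ (λ u → φ (Vec.map ℤ.∣_∣ (Vec.map pos u))) ≈⟨ ▹-cong q (λ u → F.reflexive (cong φ (abs-pos u))) ⟩
      q ▹ φ                                         ∎
      where
      abs-pos : ∀ {n} (u : Vec ℕ n) → Vec.map ℤ.∣_∣ (Vec.map pos u) ≡ u
      abs-pos []      = refl
      abs-pos (x ∷ u) = cong (x ∷_) (abs-pos u)

    embed-isMonomial : ∀ {x u} {p : Poly n} → IsMonomial x u p → IsMonomial x (Vec.map pos u) (embed p)
    embed-isMonomial {p = p} m φ = F.trans (▹-embed p φ) (m _)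

    -- Serves each step "choose the polynomial that equals this Laurent expression": `descend` shows
    -- that there is one when the exponents arising from the support of `f` are natural, and
    -- `descent-transform` describes whichever one is chosen.
    module Descent {X} {f : Sum X} {L : Laurent n} {χ : Exp X → Carrier}
      {Θ : Exp X → Vec ℤ n} (θ : Exp X → Vec ℕ n)
      (L-transform : IsTransform χ Θ f L)
      (natural : ∀ u → u ∈supp f → Θ u ≡ Vec.map pos (θ u)) where

      descend : ∃[ P ] embed P ≈ₚ L
      descend = transform χ θ f , ▹⇒≈ₚ {p = embed (transform χ θ f)} {q = L} λ φ → begin
        embed (transform χ θ f) ▹ φ         ≈⟨ ▹-embed (transform χ θ f) φ ⟩
        transform χ θ f ▹ (φ ∘ Vec.map pos) ≈⟨ ▹-transform χ θ f _ ⟩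
        f ▹ (λ u → χ u F.* φ (Vec.map pos (θ u)))
          ≈⟨ ▹-supp f (λ u s → F.*-congˡ (F.reflexive (cong φ (sym (natural u s))))) ⟩
        f ▹ (λ u → χ u F.* φ (Θ u))         ≈⟨ L-transform φ ⟨
        L ▹ φ                               ∎

      descent-transform : ∀ P → embed P ≈ₚ L → IsTransform χ θ f P
      descent-transform P eq φ = F.trans
        (≈ₚ⇒▹ {p = P} {q = transform χ θ f}
          (embed-injective {P} {transform χ θ f} (λ u → F.trans (eq u) (F.sym (proj₂ descend u)))) φ)
        (▹-transform χ θ f φ)

-- Term orders

record TermOrder (n : ℕ) : Set₁ where
  infix 4 _≺_ _≼_
  field
    _≺_      : Vec ℕ n → Vec ℕ n → Set
    compare  : ∀ u v → u ≡ v ⊎ u ≺ v ⊎ v ≺ u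
    ≺-trans  : ∀ {u v w} → u ≺ v → v ≺ w → u ≺ w
    ≺-irrefl : ∀ {u} → ¬ u ≺ u
    ≺-⊕      : ∀ {u v} w → u ≺ v → u ⊕ w ≺ v ⊕ w

  _≼_ : Vec ℕ n → Vec ℕ n → Set
  b ≼ u = u ≡ b ⊎ b ≺ u

  ≺-⊕ˡ : ∀ {u v} w → u ≺ v → w ⊕ u ≺ w ⊕ v
  ≺-⊕ˡ {u} {v} w l = ≡.subst₂ _≺_ (Vec.zipWith-comm ℕ.+-comm u w) (Vec.zipWith-comm ℕ.+-comm v w) (≺-⊕ w l)

  ≼-≺-⊕ : ∀ {b b′ u v} → b ≼ u → b′ ≺ v → b ⊕ b′ ≺ u ⊕ v
  ≼-≺-⊕ {b} (inj₁ ≡.refl) l′ = ≺-⊕ˡ b l′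
  ≼-≺-⊕ {b} {b′} {u} (inj₂ l) l′ = ≺-trans (≺-⊕ b′ l) (≺-⊕ˡ u l′)

  ≺-≼-⊕ : ∀ {b b′ u v} → b ≺ u → b′ ≼ v → b ⊕ b′ ≺ u ⊕ v
  ≺-≼-⊕ {b′ = b′} l (inj₁ ≡.refl) = ≺-⊕ b′ l
  ≺-≼-⊕ {b} {b′} {u} l (inj₂ l′) = ≼-≺-⊕ (inj₂ l) l′

module _ {n : ℕ} where
  open TermOrder
  open ≡ using (refl; sym; trans; cong; cong₂; subst₂)

  -- Least terms for the reversed order are greatest terms. The orders considered here are total and
  -- compatible with addition but may have infinite descent; finiteness of supports supplies least
  -- terms all the same.
  reverse : TermOrder n → TermOrder n
  reverse O = record
    { _≺_ = λ u v → _≺_ O v u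
    ; compare = λ u v → compare′ (compare O u v)
    ; ≺-trans = λ l l′ → ≺-trans O l′ l
    ; ≺-irrefl = ≺-irrefl O
    ; ≺-⊕ = ≺-⊕ O }
    where
    compare′ : ∀ {u v} → u ≡ v ⊎ _≺_ O u v ⊎ _≺_ O v u → u ≡ v ⊎ _≺_ O v u ⊎ _≺_ O u v
    compare′ (inj₁ eq)       = inj₁ eq
    compare′ (inj₂ (inj₁ l)) = inj₂ (inj₂ l)
    compare′ (inj₂ (inj₂ l)) = inj₂ (inj₁ l)

  refine : Vec ℕ n → TermOrder n → TermOrder n
  refine k O = record
    { _≺_ = λ u v → w u < w v ⊎ w u ≡ w v × _≺_ O u v
    ; compare = cmp
    ; ≺-trans = tr
    ; ≺-irrefl = λ { (inj₁ l) → ℕ.<-irrefl refl l ; (inj₂ (_ , l)) → ≺-irrefl O l }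
    ; ≺-⊕ = mono }
    where
    w : Vec ℕ n → ℕ
    w u = ⟨ u , k ⟩
    cmp : ∀ u v → u ≡ v ⊎ (w u < w v ⊎ w u ≡ w v × _≺_ O u v) ⊎ (w v < w u ⊎ w v ≡ w u × _≺_ O v u)
    cmp u v with ℕ.<-cmp (w u) (w v)
    ... | tri< l _ _ = inj₂ (inj₁ (inj₁ l))
    ... | tri> _ _ l = inj₂ (inj₂ (inj₁ l))
    ... | tri≈ _ eq _ with compare O u v
    ...   | inj₁ u≡v      = inj₁ u≡v
    ...   | inj₂ (inj₁ l) = inj₂ (inj₁ (inj₂ (eq , l)))
    ...   | inj₂ (inj₂ l) = inj₂ (inj₂ (inj₂ (sym eq , l)))
    tr : ∀ {u v x} → w u < w v ⊎ w u ≡ w v × _≺_ O u v → w v < w x ⊎ w v ≡ w x × _≺_ O v x →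
         w u < w x ⊎ w u ≡ w x × _≺_ O u x
    tr (inj₁ l)        (inj₁ l′)         = inj₁ (ℕ.<-trans l l′)
    tr (inj₁ l)        (inj₂ (eq , _))   = inj₁ (ℕ.<-≤-trans l (ℕ.≤-reflexive eq))
    tr (inj₂ (eq , _)) (inj₁ l′)         = inj₁ (ℕ.≤-<-trans (ℕ.≤-reflexive eq) l′)
    tr (inj₂ (eq , l)) (inj₂ (eq′ , l′)) = inj₂ (trans eq eq′ , ≺-trans O l l′)
    mono : ∀ {u v} x → w u < w v ⊎ w u ≡ w v × _≺_ O u v →
           w (u ⊕ x) < w (v ⊕ x) ⊎ w (u ⊕ x) ≡ w (v ⊕ x) × _≺_ O (u ⊕ x) (v ⊕ x)
    mono {u} {v} x (inj₁ l)        = inj₁ (subst₂ _<_ (sym (⟨⟩-+ u x k)) (sym (⟨⟩-+ v x k)) (ℕ.+-monoˡ-< (w x) l))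
    mono {u} {v} x (inj₂ (eq , l)) = inj₂ (trans (⟨⟩-+ u x k) (trans (cong (ℕ._+ w x) eq) (sym (⟨⟩-+ v x k))) , ≺-⊕ O x l)

  refine-≼⇒≤ : ∀ k O {u v} → _≼_ (refine k O) u v → ⟨ u , k ⟩ ≤ ⟨ v , k ⟩
  refine-≼⇒≤ k O (inj₁ refl)            = ℕ.≤-refl
  refine-≼⇒≤ k O (inj₂ (inj₁ l))        = ℕ.<⇒≤ l
  refine-≼⇒≤ k O (inj₂ (inj₂ (eq , _))) = ℕ.≤-reflexive eq

data _<ₗₑₓ_ : ∀ {n} → Vec ℕ n → Vec ℕ n → Set where
  this : ∀ {n x y} {u v : Vec ℕ n} → x < y → (x ∷ u) <ₗₑₓ (y ∷ v)
  next : ∀ {n x} {u v : Vec ℕ n} → u <ₗₑₓ v → (x ∷ u) <ₗₑₓ (x ∷ v)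

lexicographic : ∀ {n} → TermOrder n
lexicographic = record
  { _≺_ = _<ₗₑₓ_ ; compare = cmp ; ≺-trans = tr ; ≺-irrefl = irr ; ≺-⊕ = mono }
  where
  open ≡ using (refl; cong)
  cmp : ∀ {n} (u v : Vec ℕ n) → u ≡ v ⊎ u <ₗₑₓ v ⊎ v <ₗₑₓ u
  cmp []      []      = inj₁ refl
  cmp (x ∷ u) (y ∷ v) with ℕ.<-cmp x y
  ... | tri< l _ _ = inj₂ (inj₁ (this l))
  ... | tri> _ _ l = inj₂ (inj₂ (this l))
  ... | tri≈ _ refl _ = ⊎.map (cong (x ∷_)) (⊎.map next next) (cmp u v)
  tr : ∀ {n} {u v w : Vec ℕ n} → u <ₗₑₓ v → v <ₗₑₓ w → u <ₗₑₓ w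
  tr (this l) (this l′) = this (ℕ.<-trans l l′)
  tr (this l) (next _)  = this l
  tr (next _) (this l′) = this l′
  tr (next l) (next l′) = next (tr l l′)
  irr : ∀ {n} {u : Vec ℕ n} → ¬ u <ₗₑₓ u
  irr (this l) = ℕ.<-irrefl refl l
  irr (next l) = irr l
  mono : ∀ {n} {u v : Vec ℕ n} w → u <ₗₑₓ v → (u ⊕ w) <ₗₑₓ (v ⊕ w)
  mono (x ∷ w) (this l) = this (ℕ.+-monoˡ-< x l)
  mono (x ∷ w) (next l) = next (mono w l)

-- Least terms of products, and the lightest term of a root

module LeastTerms {c ℓ₁ ℓ₂} (em : ExcludedMiddle (c ⊔ ℓ₁ ⊔ ℓ₂)) (F : HeytingField c ℓ₁ ℓ₂) where
  open Sums em F
  open Monomials em F using (coeff-const)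
  open F using (Carrier; _≈_; _#_; 0#; 1#)
  open Reconstruction F
  open Sum
  open SetoidReasoning F.setoid

  module _ {n : ℕ} (O : TermOrder n) where
    open TermOrder O
    open ≡ using (refl; sym; trans; cong; cong₂; subst)
    open Ring (ℕ^-laws n)

    IsLeast : Poly n → Vec ℕ n → Set _
    IsLeast p b = b ∈supp p × (∀ u → u ∈supp p → b ≼ u)

    least : ∀ (p : Poly n) {u} → u ∈supp p → ∃ (IsLeast p)
    least p {u} s = conclude (search (List.map proj₂ (terms p)))
      where
      Search : List (Vec ℕ n) → Set _
      Search us = (∀ u → u ∈ₗ us → ¬ u ∈supp p) ⊎ ∃[ b ] b ∈supp p × (∀ u → u ∈ₗ us → u ∈supp p → b ≼ u)
      search : ∀ us → Search us
      search []       = inj₁ λ _ ()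
      search (v ∷ us) with em-lower (c ⊔ ℓ₁) em {v ∈supp p} | search us
      ... | no ¬s | inj₁ none          = inj₁ λ { u (here refl) → ¬s ; u (there i) → none u i }
      ... | no ¬s | inj₂ (b , bs , lb) = inj₂ (b , bs , λ
        { u (here refl) s → contradiction s ¬s ; u (there i) s → lb u i s })
      ... | yes s | inj₁ none          = inj₂ (v , s , λ
        { u (here refl) _ → inj₁ refl ; u (there i) s → contradiction s (none u i) })
      ... | yes s | inj₂ (b , bs , lb) with compare b v
      ...   | inj₁ refl     = inj₂ (b , bs , λ { u (here refl) _ → inj₁ refl ; u (there i) s → lb u i s })
      ...   | inj₂ (inj₁ l) = inj₂ (b , bs , λ { u (here refl) _ → inj₂ l ; u (there i) s → lb u i s })
      ...   | inj₂ (inj₂ l) = inj₂ (v , s , λ { u (here refl) _ → inj₁ refl ; u (there i) s → inj₂ (below (lb u i s)) })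
        where
        below : ∀ {u} → b ≼ u → v ≺ u
        below (inj₁ refl) = l
        below (inj₂ l′)   = ≺-trans l l′
      conclude : Search (List.map proj₂ (terms p)) → ∃ (IsLeast p)
      conclude (inj₁ none)          = contradiction s (none u (∈supp⇒∈ p s))
      conclude (inj₂ (b , bs , lb)) = b , bs , λ u s → lb u (∈supp⇒∈ p s) s

    module _ (p q : Poly n) {b b′ : Vec ℕ n} (lp : IsLeast p b) (lq : IsLeast q b′) where

      coeff-* : ∀ w → coeff (p * q) w ≈ p ▹ (λ u → q ▹ (λ v → δ {ℕ^ n} w (u ⊕ v)))
      coeff-* w = F.trans (coeff≈▹ (p * q) w) (▹-* p q (δ {ℕ^ n} w))

      -- For every other pair of support exponents the sum lies strictly above `b ⊕ b′`, so a single
      -- product of terms contributes and nothing can cancel it.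
      coeff-least-* : coeff (p * q) (b ⊕ b′) ≈ coeff p b F.* coeff q b′
      coeff-least-* = begin
        coeff (p * q) (b ⊕ b′)                                ≈⟨ coeff-* (b ⊕ b′) ⟩
        p ▹ (λ u → q ▹ (λ v → δ {ℕ^ n} (b ⊕ b′) (u ⊕ v)))     ≈⟨ ▹-single p b outer ⟩
        coeff p b F.* (q ▹ (λ v → δ {ℕ^ n} (b ⊕ b′) (b ⊕ v))) ≈⟨ F.*-congˡ (▹-single q b′ inner) ⟩
        coeff p b F.* (coeff q b′ F.* δ {ℕ^ n} (b ⊕ b′) (b ⊕ b′))
          ≈⟨ F.*-congˡ (F.trans (F.*-congˡ (δ-≡ {X = ℕ^ n} {b ⊕ b′} refl)) (F.*-identityʳ _)) ⟩
        coeff p b F.* coeff q b′                              ∎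
        where
        ≺⇒≢ : ∀ {w w′} → w ≺ w′ → w′ ≢ w
        ≺⇒≢ l refl = ≺-irrefl l
        strict : ∀ {v b} → v ≢ b → b ≼ v → b ≺ v
        strict v≢b (inj₁ v≡b) = contradiction v≡b v≢b
        strict v≢b (inj₂ l)   = l
        inner : ∀ v → v ∈supp q → v ≢ b′ → δ (b ⊕ b′) (b ⊕ v) ≈ 0#
        inner v s v≢b′ = δ-≢ {X = ℕ^ n} (≺⇒≢ (≺-⊕ˡ b (strict v≢b′ (proj₂ lq v s))))
        outer : ∀ u → u ∈supp p → u ≢ b → q ▹ (λ v → δ {ℕ^ n} (b ⊕ b′) (u ⊕ v)) ≈ 0#
        outer u s u≢b = F.trans
          (▹-supp q λ v s′ → δ-≢ {X = ℕ^ n} (≺⇒≢ (≺-≼-⊕ (strict u≢b (proj₂ lp u s)) (proj₂ lq v s′))))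
          (▹-0 q)

      least-* : IsLeast (p * q) (b ⊕ b′)
      least-* = F.#-congʳ (F.sym coeff-least-*) (F.x#0y#0→xy#0 (proj₁ lp) (proj₁ lq)) , bound
        where
        ≼-⊕ : ∀ {u v} → b ≼ u → b′ ≼ v → b ⊕ b′ ≼ u ⊕ v
        ≼-⊕ l           (inj₂ l′) = inj₂ (≼-≺-⊕ l l′)
        ≼-⊕ (inj₂ l)    l′        = inj₂ (≺-≼-⊕ l l′)
        ≼-⊕ (inj₁ refl) (inj₁ refl) = inj₁ refl
        bound : ∀ w → w ∈supp (p * q) → b ⊕ b′ ≼ w
        bound w s with compare (b ⊕ b′) w
        ... | inj₁ eq       = inj₁ (sym eq)
        ... | inj₂ (inj₁ l) = inj₂ l
        ... | inj₂ (inj₂ l) = contradiction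
          (F.trans (coeff-* w) (F.trans (▹-supp p λ u su → F.trans
            (▹-supp q λ v sv → δ-≢ {X = ℕ^ n} λ { refl → below l (≼-⊕ (proj₂ lp u su) (proj₂ lq v sv)) })
            (▹-0 q)) (▹-0 p)))
          (F.#⇒≉ s)
          where
          below : ∀ {w w′} → w ≺ w′ → ¬ w′ ≼ w
          below l (inj₁ refl) = ≺-irrefl l
          below l (inj₂ l′)   = ≺-irrefl (≺-trans l l′)

    module _ (p : Poly n) {b : Vec ℕ n} (lp : IsLeast p b) where

      least-^ : ∀ m → IsLeast (p ^ m) (m ⊗ b)
      least-^ zero    = subst (IsLeast (const 1#)) (sym (0⊗ b)) (F.#-congʳ (F.sym (coeff-const {n} 1#)) F.1#0 , bound)
        where
        bound : ∀ u → u ∈supp const {ℕ^ n} 1# → 0s ≼ u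
        bound u s with Exponents._≟_ (ℕ^ n) 0s u
        ... | yes eq = inj₁ (sym eq)
        ... | no _   = contradiction F.refl (F.#⇒≉ s)
      least-^ (suc m) = subst (IsLeast (p ^ suc m)) (suc⊗ m b) (least-* p (p ^ m) lp (least-^ m))

      coeff-least-^ : ∀ m → coeff (p ^ m) (m ⊗ b) ≈ coeff p b F.^ m
      coeff-least-^ zero    = F.trans (F.reflexive (cong (coeff (const {ℕ^ n} 1#)) (0⊗ b))) (coeff-const {n} 1#)
      coeff-least-^ (suc m) = F.trans (F.reflexive (cong (coeff (p ^ suc m)) (sym (suc⊗ m b))))
        (F.trans (coeff-least-* p (p ^ m) lp (least-^ m)) (F.*-congˡ (coeff-least-^ m)))

  module PowerRoot {n} {f g : Poly n} (e : ℕ) (f≈gᵉ : f ≈ₚ g ^ e) (k a : Vec ℕ n)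
    (a∈f : a ∈supp f) (a-minimal : ∀ u → u ∈supp f → u ≢ a → ⟨ a , k ⟩ < ⟨ u , k ⟩)
    .{{_ : NonZero e}} where
    open ≡ using (refl; sym; trans; cong; cong₂; subst)

    private
      w : Vec ℕ n → ℕ
      w u = ⟨ u , k ⟩

    ∈gᵉ⇒∈f : ∀ {u} → u ∈supp (g ^ e) → u ∈supp f
    ∈gᵉ⇒∈f {u} = F.#-congʳ (F.sym (f≈gᵉ u))

    g-nonzero : ∃[ u ] u ∈supp g
    g-nonzero with em-lower (c ⊔ ℓ₁) em {∃[ u ] u ∈supp g}
    ... | yes s = s
    ... | no ¬s = contradiction (F.trans (f≈gᵉ a) (gᵉ≈0 e a)) (F.#⇒≉ a∈f)
      where
      gᵉ≈0 : ∀ e .{{_ : NonZero e}} u → coeff (g ^ e) u ≈ 0#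
      gᵉ≈0 (suc e) u = F.trans (coeff≈▹ (g * g ^ e) u) (F.trans (▹-* g (g ^ e) (δ {ℕ^ n} u))
        (▹-vanish g _ λ v → F.trans (F.*-congʳ (vanish v)) (F.zeroˡ _)))
        where
        vanish : ∀ v → coeff g v ≈ 0#
        vanish v with F.zero-or-# (coeff g v)
        ... | inj₁ z = z
        ... | inj₂ s = contradiction (v , s) ¬s

    -- The terms of least weight of g lie between its lexicographically first and
    -- last ones, and the e-th powers of both are the only term of least weight of f.
    leastˡ : ∃ (IsLeast (refine k lexicographic) g)
    leastˡ = least (refine k lexicographic) g (proj₂ g-nonzero)

    leastʳ : ∃ (IsLeast (refine k (reverse lexicographic)) g)
    leastʳ = least (refine k (reverse lexicographic)) g (proj₂ g-nonzero)

    -- The exponent `e ⊗ b` occurs in f and is least in g^e, so by the refined order it weighs no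
    -- more than `a`. As `a` is the only lightest exponent of f, the two coincide.
    extreme : ∀ O {b} → IsLeast (refine k O) g b → e ⊗ b ≡ a
    extreme O {b} lb with Exponents._≟_ (ℕ^ n) (e ⊗ b) a
    ... | yes eq = eq
    ... | no neq = contradiction
      (a-minimal (e ⊗ b) (∈gᵉ⇒∈f (proj₁ lbᵉ)) neq)
      (ℕ.≤⇒≯ (refine-≼⇒≤ k O (proj₂ lbᵉ a (F.#-congʳ (f≈gᵉ a) a∈f))))
      where
      lbᵉ : IsLeast (refine k O) (g ^ e) (e ⊗ b)
      lbᵉ = least-^ (refine k O) g lb e

    b : Vec ℕ n
    b = proj₁ leastˡ

    b∈g : b ∈supp g
    b∈g = proj₁ (proj₂ leastˡ)

    eb≡a : e ⊗ b ≡ a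
    eb≡a = extreme lexicographic (proj₂ leastˡ)

    coeff-bᵉ : coeff g b F.^ e ≈ coeff f a
    coeff-bᵉ = F.trans (F.sym (coeff-least-^ (refine k lexicographic) g (proj₂ leastˡ) e))
      (F.trans (F.reflexive (cong (coeff (g ^ e)) eb≡a)) (F.sym (f≈gᵉ a)))

    b≡b′ : b ≡ proj₁ leastʳ
    b≡b′ = ⊗-injective e (trans eb≡a (sym (extreme (reverse lexicographic) (proj₂ leastʳ))))

    -- Another exponent of the same weight would lie lexicographically strictly between `b` and
    -- `proj₁ leastʳ`, which are equal.
    b-minimal : ∀ u → u ∈supp g → u ≢ b → w b < w u
    b-minimal u s u≢b with proj₂ (proj₂ leastˡ) u s | proj₂ (proj₂ leastʳ) u s
    ... | inj₁ u≡b                | _                       = contradiction u≡b u≢b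
    ... | inj₂ (inj₁ l)           | _                       = l
    ... | inj₂ (inj₂ _)           | inj₁ u≡b′               = contradiction (trans u≡b′ (sym b≡b′)) u≢b
    ... | inj₂ (inj₂ (eq , _))    | inj₂ (inj₁ l)           =
      contradiction (subst (λ v → w v < w u) (sym b≡b′) l) (ℕ.<-irrefl eq)
    ... | inj₂ (inj₂ (_ , b<u))   | inj₂ (inj₂ (_ , u<b′))  = contradiction
      (subst (u <ₗₑₓ_) (sym b≡b′) u<b′) (λ u<b → TermOrder.≺-irrefl lexicographic (TermOrder.≺-trans lexicographic b<u u<b))

    -- The e-th power of the greatest term of g survives in f. This is what later bounds the
    -- y-degree of the normalised root by that of `F♯`.
    heaviest : ∃[ t ] (∀ u → u ∈supp g → w u ≤ w t) × (e ⊗ t) ∈supp f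
    heaviest with least (reverse (refine k lexicographic)) g (proj₂ g-nonzero)
    ... | t , lt = t , (λ u s → refine-≼⇒≤ k lexicographic (flip≼ (proj₂ lt u s)))
                 , ∈gᵉ⇒∈f (proj₁ (least-^ (reverse (refine k lexicographic)) g lt e))
      where
      flip≼ : ∀ {u} → TermOrder._≼_ (reverse (refine k lexicographic)) t u → TermOrder._≼_ (refine k lexicographic) u t
      flip≼ (inj₁ eq) = inj₁ (sym eq)
      flip≼ (inj₂ l)  = inj₂ l

-- The Frobenius endomorphism

nC0≡1 : ∀ n → n C 0 ≡ 1
nC0≡1 n = ≡.trans (nCk≡nC[n∸k] {0} {n} z≤n) (nCn≡1 n)

-- Kept for an arbitrary commutative ring on which the inner binomial coefficients act as zero,
-- because it is applied both to F and to its polynomial rings.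
module FreshmansDream {c ℓ} (R : CommutativeRing c ℓ) where
  open CommutativeRing R hiding (zero)
  open MultProperties semiring using (×-congˡ; ×-congʳ; ×-homo-1) renaming (_×_ to _·_)
  open ExpProperties commutativeSemiring
  open SumProperties semiring using (sum; sum-cong-≋; sum-init-last; sum-replicate-zero)
  open BinomialTheorem commutativeSemiring using (theorem; binomialTerm)
  open SetoidReasoning setoid

  module _ (p : ℕ) .{{_ : NonZero p}} (C-vanishes : ∀ k → 0 < k → k < p → ∀ x → (p C k) · x ≈ 0#) where

    ^p-+ : ∀ x y → (x + y) ^ p ≈ x ^ p + y ^ p
    ^p-+ x y = go p C-vanishes
      where
      go : ∀ p .{{_ : NonZero p}} → (∀ k → 0 < k → k < p → ∀ x → (p C k) · x ≈ 0#) →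
           (x + y) ^ p ≈ x ^ p + y ^ p
      go (suc p) vanishes = begin
        (x + y) ^ suc p                           ≈⟨ theorem (suc p) x y ⟩
        t zero + sum (t ∘ suc)                    ≈⟨ +-congˡ (sum-init-last (t ∘ suc)) ⟩
        t zero + (sum middle + t (suc (fromℕ p))) ≈⟨ +-cong first (+-cong middle≈0 final) ⟩
        y ^ suc p + (0# + x ^ suc p)              ≈⟨ +-congˡ (+-identityˡ _) ⟩
        y ^ suc p + x ^ suc p                     ≈⟨ +-comm _ _ ⟩
        x ^ suc p + y ^ suc p                     ∎
        where
        t : Fin (suc (suc p)) → Carrier
        t = binomialTerm x y (suc p)
        middle : Fin p → Carrier
        middle i = t (suc (inject₁ i))
        middle≈0 : sum middle ≈ 0#
        middle≈0 = trans
          (sum-cong-≋ {n = p} {middle} {λ _ → 0#}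
            λ i → vanishes (suc (toℕ (inject₁ i))) ℕ.z<s (s≤s (≡.subst (_< p) (≡.sym (Fin.toℕ-inject₁ i)) (Fin.toℕ<n i))) _)
          (sum-replicate-zero p)
        first : t zero ≈ y ^ suc p
        first = trans (×-congˡ (nC0≡1 (suc p))) (trans (×-homo-1 _) (*-identityˡ _))
        final : t (suc (fromℕ p)) ≈ x ^ suc p
        final = trans
          (reflexive (≡.cong (λ j → (suc p C suc j) · (x ^ suc j * y ^ (p ℕ.∸ j))) (Fin.toℕ-fromℕ p)))
          (trans (×-congˡ (nCn≡1 (suc p))) (trans (×-homo-1 _)
            (trans (*-congˡ (^-congʳ y (ℕ.n∸n≡0 p))) (*-identityʳ _))))

    ^pʳ-+ : ∀ r x y → (x + y) ^ (p ℕ.^ r) ≈ x ^ (p ℕ.^ r) + y ^ (p ℕ.^ r)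
    ^pʳ-+ zero    x y = trans (*-identityʳ _) (sym (+-cong (*-identityʳ x) (*-identityʳ y)))
    ^pʳ-+ (suc r) x y = begin
      (x + y) ^ (p ℕ.* p ℕ.^ r)                 ≈⟨ ^-assocʳ (x + y) p (p ℕ.^ r) ⟨
      ((x + y) ^ p) ^ (p ℕ.^ r)                 ≈⟨ ^-congˡ (p ℕ.^ r) (^p-+ x y) ⟩
      (x ^ p + y ^ p) ^ (p ℕ.^ r)               ≈⟨ ^pʳ-+ r (x ^ p) (y ^ p) ⟩
      (x ^ p) ^ (p ℕ.^ r) + (y ^ p) ^ (p ℕ.^ r) ≈⟨ +-cong (^-assocʳ x p (p ℕ.^ r)) (^-assocʳ y p (p ℕ.^ r)) ⟩
      x ^ (p ℕ.* p ℕ.^ r) + y ^ (p ℕ.* p ℕ.^ r) ∎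

module Frobenius {c ℓ₁ ℓ₂} (em : ExcludedMiddle (c ⊔ ℓ₁ ⊔ ℓ₂)) (F : HeytingField c ℓ₁ ℓ₂)
  (p : ℕ) .{{p≢0 : NonZero p}} (char : Reconstruction.Characteristic F p) where
  open Sums em F
  open Monomials em F
  open F using (Carrier; _≈_; _#_; 0#; 1#; _·_)
  open Reconstruction F
  open Sum
  open SetoidReasoning F.setoid
  open ≡ using (refl; sym; trans; cong; cong₂; subst)

  ·1-# : ∀ {m} → p ∤ m → m · 1# # 0#
  ·1-# {m} p∤m = F.≉⇒# (p∤m ∘ Equivalence.to (char m))

  !-# : ∀ m → m < p → (m !) · 1# # 0#
  !-# zero    _   = F.#-congʳ (F.sym (F.×-homo-1 1#)) F.1#0
  !-# (suc m) m<p = F.#-congʳ (F.sym (F.×1-homo-* (suc m) (m !)))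
    (F.x#0y#0→xy#0 (·1-# (∣.>⇒∤ m<p)) (!-# m (ℕ.<-trans (ℕ.n<1+n m) m<p)))

  -- The product of `p C k`, k! and (p - k)! is p!, which is zero in F, whereas k! and (p - k)! are
  -- products of positive integers below p and so nonzero in F. Primality of p enters only as the
  -- absence of zero divisors.
  C-vanishes : ∀ k → 0 < k → k < p → (p C k) · 1# ≈ 0#
  C-vanishes k 0<k k<p with F.zero-or-# ((p C k) · 1#)
  ... | inj₁ z = z
  ... | inj₂ s = contradiction
      (F.trans (F.sym (F.×1-homo-* (p C k) (k ! ℕ.* (p ℕ.∸ k) !)))
        (Equivalence.from (char _) (subst (p ∣_) (sym C*k!≡p!) (p∣p! p))))
      (F.#⇒≉ (F.x#0y#0→xy#0 s
        (F.#-congʳ (F.sym (F.×1-homo-* (k !) ((p ℕ.∸ k) !)))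
          (F.x#0y#0→xy#0 (!-# k k<p) (!-# (p ℕ.∸ k) (ℕ.∸-monoʳ-< 0<k (ℕ.<⇒≤ k<p)))))))
    where
    C*k!≡p! : (p C k) ℕ.* (k ! ℕ.* (p ℕ.∸ k) !) ≡ p !
    C*k!≡p! = trans (cong (ℕ._* (k ! ℕ.* (p ℕ.∸ k) !)) (nCk≡n!/k![n-k]! (ℕ.<⇒≤ k<p)))
                    (ℕ.m/n*n≡m {{k ℕ.!* (p ℕ.∸ k) !≢0}} (k![n∸k]!∣n! (ℕ.<⇒≤ k<p)))
    p∣p! : ∀ p .{{_ : NonZero p}} → p ∣ p !
    p∣p! (suc p) = ∣.m∣m*n (p !)

  field-^pʳ-+ : ∀ r x y → (x F.+ y) F.^ (p ℕ.^ r) ≈ x F.^ (p ℕ.^ r) F.+ y F.^ (p ℕ.^ r)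
  field-^pʳ-+ = FreshmansDream.^pʳ-+ F.commutativeRing p λ k l l′ x →
    F.trans (F.×-congʳ (p C k) (F.sym (F.*-identityˡ x)))
      (F.trans (F.sym (F.×-assoc-* (p C k) 1# x)) (F.trans (F.*-congʳ (C-vanishes k l l′)) (F.zeroˡ x)))

  module _ (r : ℕ) where

    private
      m : ℕ
      m = p ℕ.^ r
      instance
        m≢0 : NonZero m
        m≢0 = ℕ.m^n≢0 p r

    -- Additivity of the power map gives (x - z)^m + z^m = x^m, so (x - z)^m is zero, and a nonzero
    -- field element has no zero power.
    ^pʳ-injective : ∀ {x z} → x F.^ m ≈ z F.^ m → x ≈ z
    ^pʳ-injective {x} {z} eq with F.zero-or-# (x F.- z)
    ... | inj₁ x-z≈0 = F.x∙y⁻¹≈ε⇒x≈y x z x-z≈0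
    ... | inj₂ x-z#0 = contradiction
        (F.+-identityˡ-unique _ (z F.^ m) (F.trans (F.sym (field-^pʳ-+ r (x F.- z) z))
          (F.trans (F.^-congˡ m (F.trans (F.+-assoc _ _ _) (F.trans (F.+-congˡ (F.-‿inverseˡ z)) (F.+-identityʳ x)))) eq)))
        (F.#⇒≉ (F.^-# m x-z#0))

    module _ {n : ℕ} where
      open Ring (ℕ^-laws n)
      private module P = CommutativeRing polynomialRing
      open MultProperties P.semiring using () renaming (_×_ to _·ₚ_)

      poly-^pʳ-+ : ∀ (A B : Poly n) → (A + B) ^ m ≈ₚ A ^ m + B ^ m
      poly-^pʳ-+ = FreshmansDream.^pʳ-+ polynomialRing p
        (λ k l l′ P → ▹⇒≈ₚ {p = (p C k) ·ₚ P} {q = ⟪ [] ⟫} λ φ → begin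
          ((p C k) ·ₚ P) ▹ φ         ≈⟨ multiple (p C k) P φ ⟩
          ((p C k) · 1#) F.* (P ▹ φ) ≈⟨ F.*-congʳ (C-vanishes k l l′) ⟩
          0# F.* (P ▹ φ)             ≈⟨ F.zeroˡ _ ⟩
          0#                         ≈⟨ ▹-[] φ ⟨
          ⟪ [] ⟫ ▹ φ                 ∎) r
        where
        multiple : ∀ k P φ → (k ·ₚ P) ▹ φ ≈ (k · 1#) F.* (P ▹ φ)
        multiple zero    P φ = F.trans (▹-[] φ) (F.sym (F.zeroˡ _))
        multiple (suc k) P φ = F.trans (▹-+ P (k ·ₚ P) φ) (F.trans
          (F.+-cong (F.sym (F.*-identityˡ _)) (multiple k P φ)) (F.sym (F.distribʳ _ _ _)))

      -- The functional `φ` on the sum of the m-th powers of the listed terms, with equal exponents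
      -- not yet collected.
      frobenius : List (Carrier × Vec ℕ n) → (Vec ℕ n → Carrier) → Carrier
      frobenius ts φ = List.foldr (λ (x , v) s → x F.^ m F.* φ (m ⊗ v) F.+ s) 0# ts

      ^pʳ-▹ : ∀ (A : Poly n) φ → A ^ m ▹ φ ≈ frobenius (terms A) φ
      ^pʳ-▹ ⟪ ts ⟫ φ = go ts
        where
        go : ∀ ts → ⟪ ts ⟫ ^ m ▹ φ ≈ frobenius ts φ
        go []             = zero^ m
          where
          zero^ : ∀ m .{{_ : NonZero m}} → ⟪ [] ⟫ ^ m ▹ φ ≈ 0#
          zero^ (suc m) = ▹-[] φ
        go ((x , v) ∷ ts) = begin
          ⟪ (x , v) ∷ ts ⟫ ^ m ▹ φ
            ≈⟨ ≈ₚ⇒▹ {p = ⟪ (x , v) ∷ ts ⟫ ^ m} {q = monomial x v ^ m + ⟪ ts ⟫ ^ m} (poly-^pʳ-+ (monomial x v) ⟪ ts ⟫) φ ⟩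
          (monomial x v ^ m + ⟪ ts ⟫ ^ m) ▹ φ ≈⟨ ▹-+ (monomial x v ^ m) (⟪ ts ⟫ ^ m) φ ⟩
          (monomial x v ^ m ▹ φ) F.+ (⟪ ts ⟫ ^ m ▹ φ)
            ≈⟨ F.+-cong (IsMonomial-^ {p = monomial x v} (monomial-isMonomial {ℕ^ n} x v) m φ) (go ts) ⟩
          frobenius ((x , v) ∷ ts) φ          ∎

      -- Multiplication of exponents by m is injective, so the terms of `A` at v and no others reach
      -- `m ⊗ v`. If v is listed several times, additivity of the power map in F collects the
      -- coefficients.
      coeff-^pʳ : ∀ (A : Poly n) v → coeff (A ^ m) (m ⊗ v) ≈ coeff A v F.^ m
      coeff-^pʳ A@(⟪ ts ⟫) v = F.trans (coeff≈▹ (A ^ m) (m ⊗ v)) (F.trans (^pʳ-▹ A (δ (m ⊗ v))) (go ts))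
        where
        go : ∀ ts → frobenius ts (δ {ℕ^ n} (m ⊗ v)) ≈ coeff {ℕ^ n} ⟪ ts ⟫ v F.^ m
        go []             = F.sym (F.0^ m)
        go ((x , u) ∷ ts) with Exponents._≟_ (ℕ^ n) u v
        ... | yes refl = F.trans
          (F.+-cong (F.trans (F.*-congˡ (δ-≡ {ℕ^ n} refl)) (F.*-identityʳ _)) (go ts))
          (F.sym (field-^pʳ-+ r x _))
        ... | no u≢v   = F.trans
          (F.+-cong (F.trans (F.*-congˡ (δ-≢ {ℕ^ n} (u≢v ∘ ⊗-injective m))) (F.zeroʳ _)) (go ts))
          (F.+-identityˡ _)

      ^pʳ-support : ∀ (A : Poly n) u → u ∈supp (A ^ m) → ∃[ v ] u ≡ m ⊗ v
      ^pʳ-support A@(⟪ ts ⟫) u s = go ts (F.#⇒≉ s ∘ F.trans (F.trans (coeff≈▹ (A ^ m) u) (^pʳ-▹ A (δ u))))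
        where
        go : ∀ ts → ¬ frobenius ts (δ {ℕ^ n} u) ≈ 0# → ∃[ v ] u ≡ m ⊗ v
        go []             h = contradiction F.refl h
        go ((x , v) ∷ ts) h with Exponents._≟_ (ℕ^ n) (m ⊗ v) u
        ... | yes eq = v , sym eq
        ... | no neq = go ts λ z → h (F.trans
            (F.+-cong (F.trans (F.*-congˡ (δ-≢ {ℕ^ n} neq)) (F.zeroʳ _)) z) (F.+-identityˡ _))

      ^pʳ-termsArePowers : ∀ (A H : Poly n) → A ^ m ≈ₚ H → TermsArePowers m H
      ^pʳ-termsArePowers A H eq u s with ^pʳ-support A u (F.#-congʳ (F.sym (eq u)) s)
      ... | v , refl = (λ i → subst (m ∣_) (sym (Vec.lookup-map i (m ℕ.*_) v)) (∣.m∣m*n (lookup v i)))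
                     , coeff A v , F.trans (F.sym (coeff-^pʳ A v)) (eq (m ⊗ v))

      -- Step 6 may pick any polynomial with the prescribed m-th powers as coefficients; injectivity
      -- of the power map in F leaves only `A`.
      termwiseRoot-unique : ∀ (A H : Poly n) → A ^ m ≈ₚ H → (H′ : TermwiseRoot m H) → proj₁ H′ ≈ₚ A
      termwiseRoot-unique A H eq (H′ , root) v =
        ^pʳ-injective (F.trans (root v) (F.trans (F.sym (eq (m ⊗ v))) (coeff-^pʳ A v)))

-- From ℤ[1/q] to F

module BinomialImage {c ℓ₁ ℓ₂} (em : ExcludedMiddle (c ⊔ ℓ₁ ⊔ ℓ₂)) (F : HeytingField c ℓ₁ ℓ₂) where
  module F = Field em F
  open F using (Carrier; _≈_; _#_; 0#; 1#; _·_)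
  open Reconstruction F
  open SetoidReasoning F.setoid
  module FSeries = Series F.commutativeRing

  private
    cancel-suc : ∀ x z → (1# F.+ x) F.- (1# F.+ z) ≈ x F.- z
    cancel-suc x z = begin
      (1# F.+ x) F.- (1# F.+ z) ≈⟨ F.+-congˡ (F.-‿+-comm 1# z) ⟨
      (1# F.+ x) F.+ (F.- 1# F.+ F.- z)
        ≈⟨ solve 4 (λ a b c d → (a :+ b) :+ (c :+ d) := (b :+ d) :+ (a :+ c)) F.refl 1# x (F.- 1#) (F.- z) ⟩
      (x F.- z) F.+ (1# F.- 1#) ≈⟨ F.trans (F.+-congˡ (F.-‿inverseʳ 1#)) (F.+-identityʳ _) ⟩
      x F.- z                   ∎
      where open F.Solver

  fromℤ-⊖ : ∀ a b → fromℤ (a ℤ.⊖ b) ≈ (a · 1#) F.- (b · 1#)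
  fromℤ-⊖ zero    zero    = F.sym (F.-‿inverseʳ 0#)
  fromℤ-⊖ zero    (suc b) = F.sym (F.+-identityˡ _)
  fromℤ-⊖ (suc a) zero    = F.sym (F.trans (F.+-congˡ F.-0#≈0#) (F.+-identityʳ _))
  fromℤ-⊖ (suc a) (suc b) = F.trans (F.reflexive (≡.cong fromℤ (ℤ.[1+m]⊖[1+n]≡m⊖n a b)))
    (F.trans (fromℤ-⊖ a b) (F.sym (cancel-suc _ _)))

  fromℤ-+ : ∀ i j → fromℤ (i ℤ.+ j) ≈ fromℤ i F.+ fromℤ j
  fromℤ-+ (pos a)  (pos b)  = F.×-homo-+ 1# a b
  fromℤ-+ (pos a)  -[1+ b ] = fromℤ-⊖ a (suc b)
  fromℤ-+ -[1+ a ] (pos b)  = F.trans (fromℤ-⊖ b (suc a)) (F.+-comm _ _)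
  fromℤ-+ -[1+ a ] -[1+ b ] = F.trans
    (F.-‿cong (F.trans (F.×-congˡ (≡.cong suc (≡.sym (ℕ.+-suc a b)))) (F.×-homo-+ 1# (suc a) (suc b))))
    (F.sym (F.-‿+-comm _ _))

  fromℤ-neg : ∀ i → fromℤ (ℤ.- i) ≈ F.- fromℤ i
  fromℤ-neg (pos zero)    = F.sym F.-0#≈0#
  fromℤ-neg (pos (suc a)) = F.refl
  fromℤ-neg -[1+ a ]      = F.sym (F.-‿involutive _)

  fromℤ-pos-* : ∀ a j → fromℤ (pos a ℤ.* j) ≈ (a · 1#) F.* fromℤ j
  fromℤ-pos-* a (pos b)  = F.trans (F.reflexive (≡.cong fromℤ (≡.sym (ℤ.pos-* a b)))) (F.×1-homo-* a b)
  fromℤ-pos-* a -[1+ b ] = begin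
    fromℤ (pos a ℤ.* ℤ.- pos (suc b))   ≡⟨ ≡.cong fromℤ (ℤ.neg-distribʳ-* (pos a) (pos (suc b))) ⟨
    fromℤ (ℤ.- (pos a ℤ.* pos (suc b))) ≈⟨ fromℤ-neg (pos a ℤ.* pos (suc b)) ⟩
    F.- fromℤ (pos a ℤ.* pos (suc b))   ≈⟨ F.-‿cong (fromℤ-pos-* a (pos (suc b))) ⟩
    F.- ((a · 1#) F.* (suc b · 1#))     ≈⟨ F.-‿distribʳ-* _ _ ⟩
    (a · 1#) F.* fromℤ -[1+ b ]         ∎

  fromℤ-* : ∀ i j → fromℤ (i ℤ.* j) ≈ fromℤ i F.* fromℤ j
  fromℤ-* (pos a)  j = fromℤ-pos-* a j
  fromℤ-* -[1+ a ] j = begin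
    fromℤ ((ℤ.- pos (suc a)) ℤ.* j) ≡⟨ ≡.cong fromℤ (ℤ.neg-distribˡ-* (pos (suc a)) j) ⟨
    fromℤ (ℤ.- (pos (suc a) ℤ.* j)) ≈⟨ fromℤ-neg (pos (suc a) ℤ.* j) ⟩
    F.- fromℤ (pos (suc a) ℤ.* j)   ≈⟨ F.-‿cong (fromℤ-pos-* (suc a) j) ⟩
    F.- ((suc a · 1#) F.* fromℤ j)  ≈⟨ F.-‿distribˡ-* _ _ ⟩
    fromℤ -[1+ a ] F.* fromℤ j      ∎

  module _ (q : ℕ) .{{q≢0 : NonZero q}} (q#0 : q · 1# # 0#) where

    private
      Q : Carrier
      Q = q · 1#

    fromℤ-power : ∀ s → fromℤ (pos (q ℕ.^ s)) ≈ Q F.^ s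
    fromℤ-power zero    = F.×-homo-1 1#
    fromℤ-power (suc s) = F.trans (F.×1-homo-* q (q ℕ.^ s)) (F.*-congˡ (fromℤ-power s))

    -- The graph of ℤ[1/q] → F, in a form stable under the ring operations.
    record Image (r : ℚ) (z : Carrier) : Set ℓ₁ where
      constructor image
      field
        m    : ℤ
        s    : ℕ
        in-ℚ : r ℚ.* ι (pos (q ℕ.^ s)) ≡ ι m
        in-F : z F.* Q F.^ s ≈ fromℤ m

    isImage⇒Image : ∀ {r z} → IsImage q r z → Image r z
    isImage⇒Image (m , s , ≡.refl , eq) = image m s (/⇒* m (q ℕ.^ s) {{ℕ.m^n≢0 q s}}) eq

    Image-fromℤ : ∀ m → Image (ι m) (fromℤ m)
    Image-fromℤ m = image m 0 (ℚ.*-identityʳ (ι m)) (F.*-identityʳ _)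

    Image-+ : ∀ {r r′ z z′} → Image r z → Image r′ z′ → Image (r ℚ.+ r′) (z F.+ z′)
    Image-+ {r} {r′} {z} {z′} (image m s eq eq₁) (image n t eq′ eq₁′) = image
      (m ℤ.* pos (q ℕ.^ t) ℤ.+ n ℤ.* pos (q ℕ.^ s)) (s ℕ.+ t)
      (fraction-+ {q} {r} {r′} m n s t eq eq′)
      (begin
        (z F.+ z′) F.* Q F.^ (s ℕ.+ t)                              ≈⟨ F.*-congˡ (F.^-homo-* Q s t) ⟩
        (z F.+ z′) F.* (Q F.^ s F.* Q F.^ t)
          ≈⟨ solve 4 (λ a b s t → (a :+ b) :* (s :* t) := (a :* s) :* t :+ (b :* t) :* s) F.refl z z′ _ _ ⟩
        (z F.* Q F.^ s) F.* Q F.^ t F.+ (z′ F.* Q F.^ t) F.* Q F.^ s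
          ≈⟨ F.+-cong (F.*-cong eq₁ (F.sym (fromℤ-power t))) (F.*-cong eq₁′ (F.sym (fromℤ-power s))) ⟩
        fromℤ m F.* fromℤ (pos (q ℕ.^ t)) F.+ fromℤ n F.* fromℤ (pos (q ℕ.^ s))
          ≈⟨ F.+-cong (fromℤ-* m _) (fromℤ-* n _) ⟨
        fromℤ (m ℤ.* pos (q ℕ.^ t)) F.+ fromℤ (n ℤ.* pos (q ℕ.^ s)) ≈⟨ fromℤ-+ (m ℤ.* pos (q ℕ.^ t)) _ ⟨
        fromℤ (m ℤ.* pos (q ℕ.^ t) ℤ.+ n ℤ.* pos (q ℕ.^ s))         ∎)
      where
      open F.Solver

    Image-* : ∀ {r r′ z z′} → Image r z → Image r′ z′ → Image (r ℚ.* r′) (z F.* z′)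
    Image-* {r} {r′} {z} {z′} (image m s eq eq₁) (image n t eq′ eq₁′) = image
      (m ℤ.* n) (s ℕ.+ t)
      (fraction-* {q} {r} {r′} m n s t eq eq′)
      (begin
        (z F.* z′) F.* Q F.^ (s ℕ.+ t)       ≈⟨ F.*-congˡ (F.^-homo-* Q s t) ⟩
        (z F.* z′) F.* (Q F.^ s F.* Q F.^ t)
          ≈⟨ solve 4 (λ a b s t → (a :* b) :* (s :* t) := (a :* s) :* (b :* t)) F.refl z z′ _ _ ⟩
        (z F.* Q F.^ s) F.* (z′ F.* Q F.^ t) ≈⟨ F.*-cong eq₁ eq₁′ ⟩
        fromℤ m F.* fromℤ n                  ≈⟨ fromℤ-* m n ⟨
        fromℤ (m ℤ.* n)                      ∎)
      where
      open F.Solver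

    -- Invertibility of q in F allows the power of q to be cancelled, so the relation has at most
    -- one value. Integral `r` suffices because the coefficients of 1 + T are 0 and 1.
    Image-unique : ∀ {m r z} → r ≡ ι m → Image r z → z ≈ fromℤ m
    Image-unique {m} {z = z} ≡.refl (image n s eq eq′) = F.*-cancelˡ-# (F.^-# s q#0) (begin
      Q F.^ s F.* z                     ≈⟨ F.*-comm _ _ ⟩
      z F.* Q F.^ s                     ≈⟨ eq′ ⟩
      fromℤ n
        ≡⟨ ≡.cong fromℤ (ι-injective {m ℤ.* pos (q ℕ.^ s)} {n} (≡.trans (ι-* m _) eq)) ⟨
      fromℤ (m ℤ.* pos (q ℕ.^ s))       ≈⟨ fromℤ-* m _ ⟩
      fromℤ m F.* fromℤ (pos (q ℕ.^ s)) ≈⟨ F.*-comm _ _ ⟩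
      fromℤ (pos (q ℕ.^ s)) F.* fromℤ m ≈⟨ F.*-congʳ (fromℤ-power s) ⟩
      Q F.^ s F.* fromℤ m               ∎)

    Image-⋆ : ∀ {s t : ℕ → ℚ} {z z′ : ℕ → Carrier} → (∀ m → Image (s m) (z m)) → (∀ m → Image (t m) (z′ m)) →
              ∀ m → Image ((s ℚSeries.⋆ t) m) ((z FSeries.⋆ z′) m)
    Image-⋆ h h′ zero    = Image-* (h 0) (h′ 0)
    Image-⋆ h h′ (suc m) = Image-+ (Image-* (h 0) (h′ (suc m))) (Image-⋆ (h ∘ suc) h′ m)

    Image-^⋆ : ∀ {s : ℕ → ℚ} {z : ℕ → Carrier} → (∀ m → Image (s m) (z m)) →
               ∀ k m → Image ((s ℚSeries.^⋆ k) m) ((z FSeries.^⋆ k) m)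
    Image-^⋆ h zero    zero    = image (pos 1) 0 (ℚ.*-identityʳ 1ℚ) (F.trans (F.*-identityʳ _) (F.sym (F.×-homo-1 1#)))
    Image-^⋆ h zero    (suc m) = Image-fromℤ (pos 0)
    Image-^⋆ {s} {z} h (suc k) m = Image-⋆ {s} {s ℚSeries.^⋆ k} {z} {z FSeries.^⋆ k} h (Image-^⋆ {s} {z} h k) m

    binomialImages : BinomialImages q
    binomialImages i = let (m , s , eq) = binomial-integral q i in
      fromℤ m F.* inverse (F.^-# s q#0) , m , s , eq ,
      F.trans (F.*-assoc _ _ _) (F.trans (F.*-congˡ (F.inverseˡ (F.^-# s q#0))) (F.*-identityʳ _))

    -- Each coefficient of the q-th power is a polynomial expression in the γ(i), hence an image of
    -- the same expression over ℚ, which `binomial-root` evaluates.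
    binomialImages-root : (γ : BinomialImages q) → proj₁ ∘ γ FSeries.^⋆ q FSeries.≋ FSeries.onePlusT
    binomialImages-root γ m = go m (Image-^⋆ {binomial (pos 1 ℚ./ q)} {proj₁ ∘ γ} (λ i → isImage⇒Image (proj₂ (γ i))) q m)
      where
      go : ∀ m → Image ((binomial (pos 1 ℚ./ q) ℚSeries.^⋆ q) m) ((proj₁ ∘ γ FSeries.^⋆ q) m) →
           (proj₁ ∘ γ FSeries.^⋆ q) m ≈ FSeries.onePlusT m
      go zero          h = F.trans (Image-unique {pos 1} (binomial-root q 0) h) (F.×-homo-1 1#)
      go (suc zero)    h = F.trans (Image-unique {pos 1} (binomial-root q 1) h) (F.×-homo-1 1#)
      go (suc (suc m)) h = Image-unique {pos 0} (binomial-root q (suc (suc m))) h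

    binomialImages-0 : (γ : BinomialImages q) → proj₁ (γ 0) ≈ 1#
    binomialImages-0 γ = F.trans (Image-unique {pos 1} ≡.refl (isImage⇒Image (proj₂ (γ 0)))) (F.×-homo-1 1#)

-- The approximate root

module TruncatedRoot {c ℓ₁ ℓ₂} (em : ExcludedMiddle (c ⊔ ℓ₁ ⊔ ℓ₂)) (F : HeytingField c ℓ₁ ℓ₂) (n : ℕ) where
  open Sums em F
  open Monomials em F
  open F using (Carrier; _≈_; _#_; 0#; 1#; _·_)
  open Reconstruction F
  open Sum
  open ≡ using (refl; sym; trans; cong; cong₂; subst)
  open Ring (ℕ^-laws (suc n)) using (polynomialRing; ▹-const)
  private
    module P = CommutativeRing polynomialRing
    module PSeries = Series polynomialRing
    module FSeries = Series F.commutativeRing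
  open MultProperties P.semiring using () renaming (_×_ to _·ₚ_)

  -- Divisibility by the j-th power of `y`, the variable of index zero, read off the coefficients.
  record I (j : ℕ) (p : Poly (suc n)) : Set ℓ₁ where
    constructor mkI
    field vanishes : ∀ u → Vec.head u < j → coeff p u ≈ 0#
  open I

  private
    head-⊕ : ∀ (u v : Vec ℕ (suc n)) → Vec.head (u ⊕ v) ≡ Vec.head u ℕ.+ Vec.head v
    head-⊕ (_ ∷ _) (_ ∷ _) = refl

    coeff-+ : ∀ (p q : Poly (suc n)) u → coeff (p + q) u ≈ coeff p u F.+ coeff q u
    coeff-+ p q u = F.trans (coeff≈▹ (p + q) u) (F.trans (▹-+ p q (δ u))
      (F.sym (F.+-cong (coeff≈▹ p u) (coeff≈▹ q u))))

    coeff-neg : ∀ (p : Poly (suc n)) u → coeff (- p) u ≈ F.- coeff p u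
    coeff-neg p u = F.trans (coeff≈▹ (- p) u) (F.trans (▹-neg p (δ u)) (F.-‿cong (F.sym (coeff≈▹ p u))))

  I-* : ∀ {j k p q} → I j p → I k q → I (j ℕ.+ k) (p * q)
  I-* {j} {k} {p} {q} hp hq = mkI λ w w<j+k →
    F.trans (coeff≈▹ (p * q) w) (F.trans (▹-* p q (δ w)) (F.trans
      (▹-supp p λ u us → F.trans (▹-supp q λ v vs → δ-≢ {ℕ^ (suc n)} λ { refl →
          ℕ.<⇒≱ w<j+k (ℕ.≤-trans (ℕ.+-mono-≤ (bound hp us) (bound hq vs)) (ℕ.≤-reflexive (sym (head-⊕ u v)))) })
        (▹-0 q))
      (▹-0 p)))
    where
    bound : ∀ {j p u} → I j p → u ∈supp p → j ≤ Vec.head u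
    bound {j} {p} {u} h s with j ℕ.≤? Vec.head u
    ... | yes l = l
    ... | no ¬l = contradiction (vanishes h u (ℕ.≰⇒> ¬l)) (F.#⇒≉ s)

  yAdic : Filtered.Filtration polynomialRing ℓ₁
  yAdic = record
    { I      = I
    ; I-resp = λ eq h → mkI λ u l → F.trans (F.sym (eq u)) (vanishes h u l)
    ; I-all  = λ _ → mkI λ _ ()
    ; I-suc  = λ h → mkI λ u l → vanishes h u (ℕ.m<n⇒m<1+n l)
    ; I-+    = λ {_} {p} {q} h h′ → mkI λ u l → F.trans (coeff-+ p q u)
                 (F.trans (F.+-cong (vanishes h u l) (vanishes h′ u l)) (F.+-identityˡ 0#))
    ; I-neg  = λ {_} {p} h → mkI λ u l → F.trans (coeff-neg p u) (F.trans (F.-‿cong (vanishes h u l)) F.-0#≈0#)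
    ; I-*    = I-*
    ; I-0#   = mkI λ _ _ → F.refl }

  open Filtered.Approximation polynomialRing yAdic using (_≡_mod_; binomialSum-root)

  private
    C : Carrier → Poly (suc n)
    C = const

    ▹-C : ∀ x φ → C x ▹ φ ≈ x F.* φ 0s
    ▹-C x = ▹-monomial {ℕ^ (suc n)} x 0s

    C-cong : ∀ {x z} → x ≈ z → C x ≈ₚ C z
    C-cong {x} {z} eq = ▹⇒≈ₚ {p = C x} {q = C z} λ φ → F.trans (▹-C x φ) (F.trans (F.*-congʳ eq) (F.sym (▹-C z φ)))

    C-0 : C 0# ≈ₚ ⟪ [] ⟫
    C-0 = ▹⇒≈ₚ {p = C 0#} {q = ⟪ [] ⟫} λ φ → F.trans (▹-C 0# φ) (F.trans (F.zeroˡ _) (F.sym (▹-[] φ)))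

    C-+ : ∀ x z → C x + C z ≈ₚ C (x F.+ z)
    C-+ x z = ▹⇒≈ₚ {p = C x + C z} {q = C (x F.+ z)} λ φ → F.trans (▹-+ (C x) (C z) φ)
      (F.trans (F.+-cong (▹-C x φ) (▹-C z φ)) (F.trans (F.sym (F.distribʳ _ _ _)) (F.sym (▹-C _ φ))))

    C-* : ∀ x z → C x * C z ≈ₚ C (x F.* z)
    C-* x z = ▹⇒≈ₚ {p = C x * C z} {q = C (x F.* z)} λ φ → F.trans (▹-const x (C z) φ)
      (F.trans (F.*-congˡ (▹-C z φ)) (F.trans (F.sym (F.*-assoc _ _ _)) (F.sym (▹-C _ φ))))

    C-· : ∀ k → k ·ₚ C 1# ≈ₚ C (k · 1#)
    C-· zero    = P.sym {C 0#} {⟪ [] ⟫} C-0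
    C-· (suc k) = P.trans {C 1# + k ·ₚ C 1#} {C 1# + C (k · 1#)} {C (suc k · 1#)}
      (P.+-congˡ {C 1#} {k ·ₚ C 1#} {C (k · 1#)} (C-· k)) (C-+ 1# (k · 1#))

    -- Constants form a subring, so the root identity for coefficients in F becomes one in the
    -- polynomial ring, where `binomialSum-root` is applied.
    C-⋆ : ∀ s t → C ∘ s PSeries.⋆ C ∘ t PSeries.≋ C ∘ (s FSeries.⋆ t)
    C-⋆ s t zero    = C-* (s 0) (t 0)
    C-⋆ s t (suc m) = P.trans
      {C (s 0) * C (t (suc m)) + (C ∘ s ∘ suc PSeries.⋆ C ∘ t) m}
      {C (s 0 F.* t (suc m)) + C ((s ∘ suc FSeries.⋆ t) m)} {C ((s FSeries.⋆ t) (suc m))}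
      (P.+-cong {C (s 0) * C (t (suc m))} {C (s 0 F.* t (suc m))}
        {(C ∘ s ∘ suc PSeries.⋆ C ∘ t) m} {C ((s ∘ suc FSeries.⋆ t) m)}
        (C-* (s 0) (t (suc m))) (C-⋆ (s ∘ suc) t m))
      (C-+ (s 0 F.* t (suc m)) ((s ∘ suc FSeries.⋆ t) m))

    C-^⋆ : ∀ s k → C ∘ s PSeries.^⋆ k PSeries.≋ C ∘ (s FSeries.^⋆ k)
    C-^⋆ s zero    zero    = P.refl {C 1#}
    C-^⋆ s zero    (suc m) = P.sym {C 0#} {⟪ [] ⟫} C-0
    C-^⋆ s (suc k) m       = P.trans
      {(C ∘ s PSeries.⋆ C ∘ s PSeries.^⋆ k) m} {(C ∘ s PSeries.⋆ C ∘ (s FSeries.^⋆ k)) m}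
      {C ((s FSeries.⋆ s FSeries.^⋆ k) m)}
      (PSeries.⋆-congʳ (C ∘ s) {C ∘ s PSeries.^⋆ k} {C ∘ (s FSeries.^⋆ k)} (C-^⋆ s k) m)
      (C-⋆ s (s FSeries.^⋆ k) m)

    Terms : Set c
    Terms = List (Carrier × Vec ℕ (suc n))

    coeff-∷ : ∀ u t {ts us : Terms} → coeff {ℕ^ (suc n)} ⟪ ts ⟫ u ≈ coeff {ℕ^ (suc n)} ⟪ us ⟫ u →
              coeff {ℕ^ (suc n)} ⟪ t ∷ ts ⟫ u ≈ coeff {ℕ^ (suc n)} ⟪ t ∷ us ⟫ u
    coeff-∷ u (x , v) eq with Exponents._≟_ (ℕ^ (suc n)) v u
    ... | yes _ = F.+-congˡ eq
    ... | no _  = eq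

    coeff-∷-≢ : ∀ {u v} → v ≢ u → ∀ x {ts : Terms} → coeff {ℕ^ (suc n)} ⟪ (x , v) ∷ ts ⟫ u ≈ coeff {ℕ^ (suc n)} ⟪ ts ⟫ u
    coeff-∷-≢ {u} {v} v≢u x with Exponents._≟_ (ℕ^ (suc n)) v u
    ... | yes v≡u = contradiction v≡u v≢u
    ... | no _    = F.refl

    module _ (N : ℕ) (u : Vec ℕ (suc n)) where

      low? : (t : Carrier × Vec ℕ (suc n)) → Dec (Vec.head (proj₂ t) ≤ N)
      low? (_ , v) = Vec.head v ℕ.≤? N

      truncate-accept : ∀ {x v} → Vec.head v ≤ N → ∀ ts →
        coeff (truncate N ⟪ (x , v) ∷ ts ⟫) u ≈ coeff {ℕ^ (suc n)} ⟪ (x , v) ∷ List.filter low? ts ⟫ u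
      truncate-accept {x} {v} l ts =
        F.reflexive (cong (λ ts → coeff {ℕ^ (suc n)} ⟪ ts ⟫ u) (List.filter-accept low? {x , v} {ts} l))

      truncate-reject : ∀ {x v} → ¬ Vec.head v ≤ N → ∀ ts →
        coeff (truncate N ⟪ (x , v) ∷ ts ⟫) u ≈ coeff (truncate N ⟪ ts ⟫) u
      truncate-reject {x} {v} ¬l ts =
        F.reflexive (cong (λ ts → coeff {ℕ^ (suc n)} ⟪ ts ⟫ u) (List.filter-reject low? {x , v} {ts} ¬l))

      coeff-truncate-≤ : ∀ (p : Poly (suc n)) → Vec.head u ≤ N → coeff (truncate N p) u ≈ coeff p u
      coeff-truncate-≤ ⟪ ts ⟫ l = go ts
        where
        go : ∀ ts → coeff (truncate N ⟪ ts ⟫) u ≈ coeff {ℕ^ (suc n)} ⟪ ts ⟫ u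
        go []             = F.refl
        go ((x , v) ∷ ts) = step (low? (x , v))
          where
          step : Dec (Vec.head v ≤ N) → coeff (truncate N ⟪ (x , v) ∷ ts ⟫) u ≈ coeff {ℕ^ (suc n)} ⟪ (x , v) ∷ ts ⟫ u
          step (yes l) = F.trans (truncate-accept {x} {v} l ts) (coeff-∷ u (x , v) {List.filter low? ts} {ts} (go ts))
          step (no ¬l) = F.trans (truncate-reject {x} {v} ¬l ts)
            (F.trans (go ts) (F.sym (coeff-∷-≢ {u} {v} (λ { refl → ¬l l }) x {ts})))

      coeff-truncate-> : ∀ (p : Poly (suc n)) → ¬ Vec.head u ≤ N → coeff (truncate N p) u ≈ 0#
      coeff-truncate-> ⟪ ts ⟫ ¬l = go ts
        where
        go : ∀ ts → coeff (truncate N ⟪ ts ⟫) u ≈ 0#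
        go []             = F.refl
        go ((x , v) ∷ ts) = step (low? (x , v))
          where
          step : Dec (Vec.head v ≤ N) → coeff (truncate N ⟪ (x , v) ∷ ts ⟫) u ≈ 0#
          step (yes l) = F.trans (truncate-accept {x} {v} l ts)
            (F.trans (coeff-∷-≢ {u} {v} (λ { refl → ¬l l }) x {List.filter low? ts}) (go ts))
          step (no ¬l) = F.trans (truncate-reject {x} {v} ¬l ts) (go ts)

  module _ (q : ℕ) .{{_ : NonZero q}} (q#0 : q · 1# # 0#) (γ : BinomialImages q)
    (N : ℕ) (H G : Poly (suc n)) (H≈Gᑫ : H ≈ₚ G ^ q) (G≡1 : G ≡ const 1# mod 1)
    (degree : ∀ u → u ∈supp G → Vec.head u ≤ N) where

    private
      root : C ∘ proj₁ ∘ γ PSeries.^⋆ q PSeries.≋ PSeries.onePlusT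
      root m = P.trans {(C ∘ proj₁ ∘ γ PSeries.^⋆ q) m} {C (FSeries.onePlusT m)} {PSeries.onePlusT m}
        (P.trans {(C ∘ proj₁ ∘ γ PSeries.^⋆ q) m} {C ((proj₁ ∘ γ FSeries.^⋆ q) m)} {C (FSeries.onePlusT m)}
          (C-^⋆ (proj₁ ∘ γ) q m) (C-cong (BinomialImage.binomialImages-root em F q q#0 γ m)))
        (onePlusT m)
        where
        onePlusT : ∀ m → C (FSeries.onePlusT m) ≈ₚ PSeries.onePlusT m
        onePlusT zero          = P.refl {C 1#}
        onePlusT (suc zero)    = P.refl {C 1#}
        onePlusT (suc (suc m)) = C-0

      invertible : (q ·ₚ C 1#) * C (inverse q#0) ≈ₚ C 1#
      invertible = P.trans {(q ·ₚ C 1#) * C (inverse q#0)} {C (q · 1#) * C (inverse q#0)} {C 1#}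
        (P.*-congʳ {C (inverse q#0)} {q ·ₚ C 1#} {C (q · 1#)} (C-· q))
        (P.trans {C (q · 1#) * C (inverse q#0)} {C ((q · 1#) F.* inverse q#0)} {C 1#} (C-* (q · 1#) (inverse q#0))
          (C-cong (F.trans (F.*-comm _ _) (F.inverseˡ q#0))))

      binomialSum : Poly (suc n)
      binomialSum = sum {n = suc N} λ i → const (proj₁ (γ (toℕ i))) * (H + - const 1#) ^ toℕ i

      binomialSum≡G : binomialSum ≡ G mod suc N
      binomialSum≡G = binomialSum-root {C (inverse q#0)} q N (C ∘ proj₁ ∘ γ) {H} {G} invertible root
        (C-cong (BinomialImage.binomialImages-0 em F q q#0 γ)) H≈Gᑫ G≡1

    -- The binomial sum equals `G` only modulo y^(N+1). Above degree N both sides vanish, the left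
    -- by truncation and the right by the degree bound, so the congruence becomes an equality.
    truncatedRoot-correct : truncatedRoot q γ N H ≈ₚ G
    truncatedRoot-correct u = split (Vec.head u ℕ.≤? N)
      where
      split : Dec (Vec.head u ≤ N) → coeff (truncatedRoot q γ N H) u ≈ coeff G u
      split (yes l) = F.trans (coeff-truncate-≤ N u binomialSum l)
        (F.x∙y⁻¹≈ε⇒x≈y _ _ (F.trans (F.sym (F.trans (coeff-+ binomialSum (- G) u) (F.+-congˡ (coeff-neg G u))))
          (vanishes binomialSum≡G u (s≤s l))))
      split (no ¬l) = F.trans (coeff-truncate-> N u binomialSum ¬l) (F.sym (outside (F.zero-or-# (coeff G u))))
        where
        outside : coeff G u ≈ 0# ⊎ u ∈supp G → coeff G u ≈ 0#
        outside (inj₁ z) = z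
        outside (inj₂ s) = contradiction (degree u s) ¬l

  ≡1-mod-y : ∀ (G : Poly (suc n)) → (∀ v → coeff G (0 ∷ v) ≈ coeff (const {ℕ^ (suc n)} 1#) (0 ∷ v)) → G ≡ const 1# mod 1
  ≡1-mod-y G h = mkI λ
    { (zero ∷ v) _ → F.trans (coeff-+ G (- const 1#) (0 ∷ v))
        (F.trans (F.+-cong (h v) (coeff-neg (const 1#) (0 ∷ v))) (F.-‿inverseʳ _))
    ; (suc _ ∷ _) (s≤s ()) }

-- Existence of the chosen objects

module _ {s} (em : ExcludedMiddle s) {S : ℕ → Set s} where
  open ≡ using (refl; sym; trans; subst)

  maximum : ∀ M → (∀ j → S j → j ≤ M) → ∃ S → ∃[ m ] S m × (∀ j → S j → j ≤ m)
  maximum zero    bound (j , sj) = 0 , subst S (ℕ.n≤0⇒n≡0 (bound j sj)) sj , bound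
  maximum (suc M) bound ∃S with em {S (suc M)}
  ... | yes s = suc M , s , bound
  ... | no ¬s = maximum M bound′ ∃S
    where
    bound′ : ∀ j → S j → j ≤ M
    bound′ j sj with ℕ.m≤n⇒m<n∨m≡n (bound j sj)
    ... | inj₁ (s≤s l) = l
    ... | inj₂ refl    = contradiction sj ¬s

  minimum : ∃ S → ∃[ m ] S m × (∀ j → S j → m ≤ j)
  minimum (m , sm) = go m m ℕ.≤-refl sm
    where
    go : ∀ k m → m ≤ k → S m → ∃[ m ] S m × (∀ j → S j → m ≤ j)
    go zero    m m≤0 sm = m , sm , λ j _ → ℕ.≤-trans m≤0 z≤n
    go (suc k) m m≤k sm with em {∃[ j ] j < m × S j}
    ... | yes (j , j<m , sj) = go k j (ℕ.s≤s⁻¹ (ℕ.≤-trans j<m m≤k)) sj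
    ... | no none            = m , sm , λ j sj → ℕ.≮⇒≥ λ j<m → none (j , j<m , sj)

module _ where
  open ≡ using (refl; sym; trans; cong; cong₂; subst)
  open ℕSolver.+-*-Solver

  -- With the larger number written as the smaller plus 1 + k, the gap is (1 + k)^2 = 1 + (2k +
  -- k^2); no subtraction of natural numbers is left.
  2xy<x²+y² : ∀ x y → x ≢ y → 2 ℕ.* (x ℕ.* y) < x ℕ.* x ℕ.+ y ℕ.* y
  2xy<x²+y² x y x≢y with ℕ.<-cmp x y
  ... | tri< l _ _ = subst (λ y → 2 ℕ.* (x ℕ.* y) < x ℕ.* x ℕ.+ y ℕ.* y) (ℕ.m+[n∸m]≡n l) (ordered x (y ℕ.∸ suc x))
    where
    ordered : ∀ x k → 2 ℕ.* (x ℕ.* (suc x ℕ.+ k)) < x ℕ.* x ℕ.+ (suc x ℕ.+ k) ℕ.* (suc x ℕ.+ k)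
    ordered x k = ℕ.≤-trans (ℕ.m≤m+n _ (2 ℕ.* k ℕ.+ k ℕ.* k))
      (ℕ.≤-reflexive (solve 2 (λ x k → con 1 :+ con 2 :* (x :* (con 1 :+ x :+ k)) :+ (con 2 :* k :+ k :* k) :=
         x :* x :+ (con 1 :+ x :+ k) :* (con 1 :+ x :+ k)) refl x k))
  ... | tri≈ _ eq _ = contradiction eq x≢y
  ... | tri> _ _ l = subst (λ x → 2 ℕ.* (x ℕ.* y) < x ℕ.* x ℕ.+ y ℕ.* y) (ℕ.m+[n∸m]≡n l) (ordered y (x ℕ.∸ suc y))
    where
    ordered : ∀ y k → 2 ℕ.* ((suc y ℕ.+ k) ℕ.* y) < (suc y ℕ.+ k) ℕ.* (suc y ℕ.+ k) ℕ.+ y ℕ.* y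
    ordered y k = ℕ.≤-trans (ℕ.m≤m+n _ (2 ℕ.* k ℕ.+ k ℕ.* k))
      (ℕ.≤-reflexive (solve 2 (λ y k → con 1 :+ con 2 :* ((con 1 :+ y :+ k) :* y) :+ (con 2 :* k :+ k :* k) :=
         (con 1 :+ y :+ k) :* (con 1 :+ y :+ k) :+ y :* y) refl y k))

  2xy≤x²+y² : ∀ x y → 2 ℕ.* (x ℕ.* y) ≤ x ℕ.* x ℕ.+ y ℕ.* y
  2xy≤x²+y² x y with x ℕ.≟ y
  ... | yes refl = ℕ.≤-reflexive (solve 1 (λ x → con 2 :* (x :* x) := x :* x :+ x :* x) refl x)
  ... | no x≢y   = ℕ.<⇒≤ (2xy<x²+y² x y x≢y)

  private
    regroup : ∀ x y v c → (x ℕ.+ y) ℕ.+ (v ℕ.+ c) ≡ (x ℕ.+ v) ℕ.+ (y ℕ.+ c)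
    regroup = solve 4 (λ x y v c → (x :+ y) :+ (v :+ c) := (x :+ v) :+ (y :+ c)) refl

  ⟨⟩-≤ : ∀ {n} (u v : Vec ℕ n) → 2 ℕ.* ⟨ u , v ⟩ ≤ ⟨ u , u ⟩ ℕ.+ ⟨ v , v ⟩
  ⟨⟩-≤ []      []      = z≤n
  ⟨⟩-≤ (x ∷ u) (y ∷ v) = ℕ.≤-trans (ℕ.≤-reflexive (ℕ.*-distribˡ-+ 2 (x ℕ.* y) ⟨ u , v ⟩))
    (ℕ.≤-trans (ℕ.+-mono-≤ (2xy≤x²+y² x y) (⟨⟩-≤ u v)) (ℕ.≤-reflexive (regroup (x ℕ.* x) (y ℕ.* y) ⟨ u , u ⟩ ⟨ v , v ⟩)))

  ⟨⟩-< : ∀ {n} (u v : Vec ℕ n) → u ≢ v → 2 ℕ.* ⟨ u , v ⟩ < ⟨ u , u ⟩ ℕ.+ ⟨ v , v ⟩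
  ⟨⟩-< []      []      u≢v = contradiction refl u≢v
  ⟨⟩-< (x ∷ u) (y ∷ v) u≢v = ℕ.≤-<-trans (ℕ.≤-reflexive (ℕ.*-distribˡ-+ 2 (x ℕ.* y) ⟨ u , v ⟩))
    (ℕ.<-≤-trans (split (x ℕ.≟ y)) (ℕ.≤-reflexive (regroup (x ℕ.* x) (y ℕ.* y) ⟨ u , u ⟩ ⟨ v , v ⟩)))
    where
    split : Dec (x ≡ y) → 2 ℕ.* (x ℕ.* y) ℕ.+ 2 ℕ.* ⟨ u , v ⟩ < (x ℕ.* x ℕ.+ y ℕ.* y) ℕ.+ (⟨ u , u ⟩ ℕ.+ ⟨ v , v ⟩)
    split (yes refl) = ℕ.+-mono-≤-< (2xy≤x²+y² x y) (⟨⟩-< u v (u≢v ∘ cong (x ∷_)))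
    split (no x≢y)   = ℕ.+-mono-<-≤ (2xy<x²+y² x y x≢y) (⟨⟩-≤ u v)

  -- The vector from u to the corner (D, ..., D), when the coordinates of u are at most D. It serves
  -- both as the position whose norm is maximised and as the vector of weights.
  complement : ∀ {n} → ℕ → Vec ℕ n → Vec ℕ n
  complement D = Vec.map (D ℕ.∸_)

  ⟨⟩-complement : ∀ {n} D (u c : Vec ℕ n) → (∀ i → lookup u i ≤ D) →
                  ⟨ u , c ⟩ ℕ.+ ⟨ complement D u , c ⟩ ≡ D ℕ.* Vec.sum c
  ⟨⟩-complement D []      []      h = sym (ℕ.*-zeroʳ D)
  ⟨⟩-complement D (x ∷ u) (y ∷ c) h = trans
    (solve 5 (λ x d y a b → (x :* y :+ a) :+ (d :* y :+ b) := (x :+ d) :* y :+ (a :+ b)) refl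
      x (D ℕ.∸ x) y ⟨ u , c ⟩ ⟨ complement D u , c ⟩)
    (trans (cong₂ (λ a b → a ℕ.* y ℕ.+ b) (ℕ.m+[n∸m]≡n (h zero)) (⟨⟩-complement D u c (h ∘ suc)))
      (sym (ℕ.*-distribˡ-+ D y (Vec.sum c))))

  complement-injective : ∀ {n} D (u v : Vec ℕ n) → (∀ i → lookup u i ≤ D) → (∀ i → lookup v i ≤ D) →
                         complement D u ≡ complement D v → u ≡ v
  complement-injective D []      []      h h′ eq = refl
  complement-injective D (x ∷ u) (y ∷ v) h h′ eq = cong₂ _∷_
    (ℕ.∸-cancelˡ-≡ (h zero) (h′ zero) (Vec.∷-injectiveˡ eq))
    (complement-injective D u v (h ∘ suc) (h′ ∘ suc) (Vec.∷-injectiveʳ eq))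

  -- For c = complement D a of maximal norm, Cauchy–Schwarz singles out a as the
  -- minimizer of ⟨_, c⟩.
  complement-minimizes : ∀ {n} D (a u : Vec ℕ n) → (∀ i → lookup a i ≤ D) → (∀ i → lookup u i ≤ D) →
    ⟨ complement D u , complement D u ⟩ ≤ ⟨ complement D a , complement D a ⟩ → u ≢ a →
    ⟨ a , complement D a ⟩ < ⟨ u , complement D a ⟩
  complement-minimizes D a u ha hu norm u≢a = ℕ.≰⇒> λ ⟨u,c⟩≤⟨a,c⟩ → ℕ.<-irrefl same
    (ℕ.+-mono-≤-< ⟨u,c⟩≤⟨a,c⟩ ⟨v,c⟩<⟨c,c⟩)
    where
    c v : Vec ℕ _
    c = complement D a
    v = complement D u
    ⟨v,c⟩<⟨c,c⟩ : ⟨ v , c ⟩ < ⟨ c , c ⟩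
    ⟨v,c⟩<⟨c,c⟩ = ℕ.*-cancelˡ-< 2 _ _ (ℕ.<-≤-trans (⟨⟩-< v c (u≢a ∘ complement-injective D u a hu ha))
      (ℕ.≤-trans (ℕ.+-monoˡ-≤ ⟨ c , c ⟩ norm) (ℕ.≤-reflexive (cong (⟨ c , c ⟩ ℕ.+_) (sym (ℕ.+-identityʳ ⟨ c , c ⟩))))))
    -- Both sides are D times the sum of c, so the smaller pairing of `v` with c must be made up by
    -- a larger pairing of `u`.
    same : ⟨ u , c ⟩ ℕ.+ ⟨ v , c ⟩ ≡ ⟨ a , c ⟩ ℕ.+ ⟨ c , c ⟩
    same = trans (⟨⟩-complement D u c hu) (sym (⟨⟩-complement D a c ha))

module Existence {c ℓ₁ ℓ₂} (em : ExcludedMiddle (c ⊔ ℓ₁ ⊔ ℓ₂)) (F : HeytingField c ℓ₁ ℓ₂) where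
  open Sums em F
  open Monomials em F using (coeff-const)
  open F using (Carrier; _≈_; _#_; 0#; 1#; _·_)
  open Reconstruction F
  open Exponents using (Exp)
  open Sum
  open ≡ using (refl; sym; trans; cong; cong₂; subst)

  private
    em₁ : ExcludedMiddle ℓ₁
    em₁ = em-lower (c ⊔ ℓ₂) em
    em₂ : ExcludedMiddle ℓ₂
    em₂ = em-lower (c ⊔ ℓ₁) em

  supp-bounded : ∀ {X} (p : Sum X) (h : Exp X → ℕ) → ∃[ M ] ∀ u → u ∈supp p → h u ≤ M
  supp-bounded {X} p h = let M , bound = go (List.map proj₂ (terms p)) in M , λ u s → bound u (∈supp⇒∈ p s)
    where
    go : ∀ us → ∃[ M ] ∀ u → u ∈ₗ us → h u ≤ M
    go []       = 0 , λ _ ()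
    go (v ∷ us) = let M , bound = go us in
      h v ℕ.+ M , λ { u (here refl) → ℕ.m≤m+n (h v) M ; u (there i) → ℕ.≤-trans (bound u i) (ℕ.m≤n+m M (h v)) }

  lookup≤sum : ∀ {n} (u : Vec ℕ n) i → lookup u i ≤ Vec.sum u
  lookup≤sum (x ∷ u) zero    = ℕ.m≤m+n x _
  lookup≤sum (x ∷ u) (suc i) = ℕ.≤-trans (lookup≤sum u i) (ℕ.m≤n+m _ x)

  nonconstant⇒nonempty : ∀ {n} (f : Poly n) → ¬ IsConstant f → ∃[ u ] u ∈supp f
  nonconstant⇒nonempty {n} f ¬const with em₂ {∃[ u ] u ∈supp f}
  ... | yes s = s
  ... | no ¬s = contradiction (0# , λ u → F.trans (vanish u) (F.sym (F.trans (coeff≈▹ (const {ℕ^ n} 0#) u)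
      (F.trans (▹-monomial {ℕ^ n} 0# 0s (δ u)) (F.zeroˡ _))))) ¬const
    where
    vanish : ∀ u → coeff f u ≈ 0#
    vanish u with F.zero-or-# (coeff f u)
    ... | inj₁ z = z
    ... | inj₂ s = contradiction (u , s) ¬s

  -- The individual degree is a maximum over exponents and variables. In zero variables there would
  -- be nothing to maximise over, but there every polynomial is constant.
  nonconstant⇒variable : ∀ {n} (f : Poly n) → ¬ IsConstant f → Fin n
  nonconstant⇒variable {zero}  f ¬const = contradiction (coeff f [] , λ { [] → F.sym (coeff-const {0} (coeff f [])) }) ¬const
  nonconstant⇒variable {suc n} f ¬const = zero

  indeg : ∀ {n} (f : Poly n) → ¬ IsConstant f → ∃ (IsIndeg f)
  indeg f ¬const = let M , bound = supp-bounded f Vec.sum ; u , s = nonconstant⇒nonempty f ¬const in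
    maximum em₂ M (λ { j (u , i , s , refl) → ℕ.≤-trans (lookup≤sum u i) (bound u s) })
      (_ , u , nonconstant⇒variable f ¬const , s , refl)

  weights : ∀ {n} (f : Poly n) → ¬ IsConstant f → ∀ {d} → IsIndeg f d → Weights f d
  weights {n} f ¬const {d} (_ , max) = build
    (maximum em₂ {S = λ j → ∃[ u ] u ∈supp f × ⟨ complement D u , complement D u ⟩ ≡ j}
      (proj₁ bounded) (λ { j (u , s , refl) → proj₂ bounded u s })
      (_ , proj₁ nonempty , proj₂ nonempty , refl))
    where
    D : ℕ
    -- One more than the largest exponent, so that the weights D - aᵢ are at least 1; they are at
    -- most d + 1, within the allowed 2d + 2.
    D = suc d
    bounded : ∃[ M ] ∀ u → u ∈supp f → ⟨ complement D u , complement D u ⟩ ≤ M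
    bounded = supp-bounded f λ u → ⟨ complement D u , complement D u ⟩
    nonempty : ∃[ u ] u ∈supp f
    nonempty = nonconstant⇒nonempty f ¬const
    lookup≤d : ∀ {u} → u ∈supp f → ∀ i → lookup u i ≤ d
    lookup≤d {u} s i = max (lookup u i) (u , i , s , refl)
    lookup≤D : ∀ {u} → u ∈supp f → ∀ i → lookup u i ≤ D
    lookup≤D s i = ℕ.m≤n⇒m≤1+n (lookup≤d s i)
    build : (∃[ m ] (∃[ u ] u ∈supp f × ⟨ complement D u , complement D u ⟩ ≡ m) ×
              (∀ j → (∃[ u ] u ∈supp f × ⟨ complement D u , complement D u ⟩ ≡ j) → j ≤ m)) → Weights f d
    build (_ , (a , a∈f , refl) , norm) = record
      { k = complement D a
      ; 1≤k≤2d+2 = λ i → subst (λ k → (1 ≤ k) × (k ≤ 2 ℕ.* d ℕ.+ 2)) (sym (Vec.lookup-map i (D ℕ.∸_) a))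
          ( ℕ.m<n⇒0<n∸m (s≤s (lookup≤d a∈f i))
          , ℕ.≤-trans (ℕ.m∸n≤m D (lookup a i))
              (ℕ.≤-trans (ℕ.≤-reflexive (ℕ.+-comm 1 d)) (ℕ.+-mono-≤ (ℕ.m≤m+n d (d ℕ.+ 0)) (s≤s z≤n))))
      ; a = a
      ; a∈supp = a∈f
      ; a-minimal = λ u s → complement-minimizes D a u (lookup≤D a∈f) (lookup≤D s) (norm _ (u , s , refl)) }

  yDegree : ∀ {n} (p : Poly (suc n)) {u} → u ∈supp p → ∃ (IsYDegree p)
  yDegree p {j ∷ u} s = let M , bound = supp-bounded p Vec.head in
    maximum em₂ M (λ { j (u , s) → bound (j ∷ u) s }) (j , u , s)

  characteristic : ∃ Characteristic
  characteristic with em₁ {∃[ m ] (0 < m) × (m · 1# ≈ 0#)}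
  ... | no none = 0 , λ m → mk⇔ (to m) λ 0∣m → F.×-congˡ (∣.0∣⇒≡0 0∣m)
    where
    to : ∀ m → m · 1# ≈ 0# → 0 ∣ m
    to zero    _ = ∣.∣-refl
    to (suc m) z = contradiction (suc m , s≤s z≤n , z) none
  ... | yes some = build (minimum em₁ some)
    where
    build : (∃[ p ] ((0 < p) × (p · 1# ≈ 0#)) × (∀ j → (0 < j) × (j · 1# ≈ 0#) → p ≤ j)) → ∃ Characteristic
    build (p , (0<p , p·1≈0) , least) = p , λ m → mk⇔ (to m) λ { (divides k refl) → multiple k }
      where
      instance
        p≢0 : NonZero p
        p≢0 = ℕ.>-nonZero 0<p
      multiple : ∀ k → (k ℕ.* p) · 1# ≈ 0#
      multiple k = F.trans (F.×1-homo-* k p) (F.trans (F.*-congˡ p·1≈0) (F.zeroʳ _))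
      to : ∀ m → m · 1# ≈ 0# → p ∣ m
      to m z with m ℕ.% p ℕ.≟ 0
      ... | yes r≡0 = ∣.m%n≡0⇒n∣m m p r≡0
      ... | no r≢0  = contradiction (ℕ.m%n<n m p) (ℕ.≤⇒≯ (least (m ℕ.% p) (ℕ.n≢0⇒n>0 r≢0 , (begin
          (m ℕ.% p) · 1#                          ≈⟨ F.+-identityʳ _ ⟨
          (m ℕ.% p) · 1# F.+ 0#                   ≈⟨ F.+-congˡ (multiple (m ℕ./ p)) ⟨
          (m ℕ.% p) · 1# F.+ (m ℕ./ p ℕ.* p) · 1# ≈⟨ F.×-homo-+ 1# (m ℕ.% p) (m ℕ./ p ℕ.* p) ⟨
          (m ℕ.% p ℕ.+ m ℕ./ p ℕ.* p) · 1#        ≡⟨ cong (_· 1#) (ℕ.m≡m%n+[m/n]*n m p) ⟨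
          m · 1#                                  ≈⟨ z ⟩
          0#                                      ∎))))
          where open SetoidReasoning F.setoid

  split : ∀ {p} → Characteristic p → 0 < p → ∀ e → 0 < e → Split p e
  split {p} char 0<p e 0<e = go e e ℕ.≤-refl 0<e
    where
    -- Characteristic 1 would mean 1 = 0 in F. The bound makes e/p smaller than e, so that the
    -- repeated division ends.
    1<p : 1 < p
    1<p = ℕ.≤∧≢⇒< 0<p λ { refl → F.#⇒≉ F.1#0 (F.trans (F.sym (F.×-homo-1 1#)) (Equivalence.from (char 1) ∣.∣-refl)) }
    go : ∀ k e → e ≤ k → 0 < e → Split p e
    go zero    e e≤0 0<e = contradiction (ℕ.<-≤-trans 0<e e≤0) λ ()
    go (suc k) e e≤k 0<e with p ∣? e
    ... | no p∤e = record { r = 0 ; q = e ; e≡pʳq = sym (ℕ.+-identityʳ e) ; p∤q = p∤e }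
    ... | yes (divides (suc t) refl) = record
        { r = suc (Split.r S) ; q = Split.q S ; p∤q = Split.p∤q S
        ; e≡pʳq = trans (ℕ.*-comm (suc t) p)
            (trans (cong (p ℕ.*_) (Split.e≡pʳq S)) (sym (ℕ.*-assoc p (p ℕ.^ Split.r S) (Split.q S)))) }
      where
      S : Split p (suc t)
      S = go k (suc t) (ℕ.s≤s⁻¹ (ℕ.<-≤-trans (ℕ.m<m*n (suc t) p 1<p) e≤k)) (s≤s z≤n)

  interpolate : ∀ {X} (h : Exp X → Carrier) (us : List (Exp X)) → (∀ v → h v ≈ 0# ⊎ v ∈ₗ us) →
                ∃[ P ] ∀ v → coeff {X} P v ≈ h v
  interpolate {X} h us covered = let P , spec = go us in P , λ v → conclude {P} {us} v (spec v) (covered v)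
    where
    Good : Sum X → List (Exp X) → Exp X → Set _
    Good P us v = coeff P v ≈ h v ⊎ (¬ v ∈ₗ us) × coeff P v ≈ 0#
    go : ∀ us → ∃[ P ] ∀ v → Good P us v
    go []       = ⟪ [] ⟫ , λ v → inj₂ ((λ ()) , F.refl)
    go (w ∷ us) = P′ , good
      where
      P P′ : Sum X
      P = proj₁ (go us)
      -- Subtracting what `P` already has at `w` keeps the new coefficient right even if `us` lists
      -- an exponent twice.
      P′ = ⟪ (h w F.- coeff P w , w) ∷ terms P ⟫
      good : ∀ v → Good P′ (w ∷ us) v
      good v with Exponents._≟_ X w v
      ... | yes refl = inj₁ (F.trans (F.+-assoc _ _ _) (F.trans (F.+-congˡ (F.-‿inverseˡ _)) (F.+-identityʳ _)))
      ... | no w≢v   = ⊎.map₂ (λ (v∉us , z) → (λ { (here refl) → w≢v refl ; (there i) → v∉us i }) , z) (proj₂ (go us) v)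
    conclude : ∀ {P us} v → Good P us v → h v ≈ 0# ⊎ v ∈ₗ us → coeff P v ≈ h v
    conclude v (inj₁ eq)          _        = eq
    conclude v (inj₂ (_ , z))     (inj₁ z′) = F.trans z (F.sym z′)
    conclude v (inj₂ (v∉us , _))  (inj₂ i)  = contradiction i v∉us

  -- The exponents of the root are sought among those listed in `H`, divided by m and rounded down.
  -- Rounding may add candidates whose m-fold is outside the support; they receive coefficient zero.
  termwiseRoot : ∀ {n} m .{{_ : NonZero m}} (H : Poly n) → TermsArePowers m H → TermwiseRoot m H
  termwiseRoot {n} m H powers =
    let P , eq = interpolate {ℕ^ n} h (List.map (Vec.map (ℕ._/ m)) (List.map proj₂ (terms H))) covered in
    P , λ v → F.trans (F.^-congˡ m (eq v)) (root^ v (F.zero-or-# (coeff H (m ⊗ v))))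
    where
    root : ∀ v → coeff H (m ⊗ v) ≈ 0# ⊎ (m ⊗ v) ∈supp H → Carrier
    root v (inj₁ _) = 0#
    root v (inj₂ s) = proj₁ (proj₂ (powers (m ⊗ v) s))
    h : Vec ℕ n → Carrier
    h v = root v (F.zero-or-# (coeff H (m ⊗ v)))
    root^ : ∀ v z → root v z F.^ m ≈ coeff H (m ⊗ v)
    root^ v (inj₁ z) = F.trans (F.0^ m) (F.sym z)
    root^ v (inj₂ s) = proj₂ (proj₂ (powers (m ⊗ v) s))
    undo : ∀ {n} (v : Vec ℕ n) → Vec.map (ℕ._/ m) (m ⊗ v) ≡ v
    undo []      = refl
    undo (x ∷ v) = cong₂ _∷_ (trans (cong (ℕ._/ m) (ℕ.*-comm m x)) (ℕ.m*n/n≡m x m)) (undo v)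
    covered : ∀ v → h v ≈ 0# ⊎ v ∈ₗ List.map (Vec.map (ℕ._/ m)) (List.map proj₂ (terms H))
    covered v with F.zero-or-# (coeff H (m ⊗ v))
    ... | inj₁ z = inj₁ F.refl
    ... | inj₂ s = inj₂ (subst (_∈ₗ _) (undo v) (∈ₗ.∈-map⁺ (Vec.map (ℕ._/ m)) (∈supp⇒∈ H s)))

  termRoot : ∀ {n} e .{{_ : NonZero e}} {z} {a : Vec ℕ n} → z # 0# →
             ¬ (¬ HasRoot e z ⊎ ∃[ i ] e ∤ lookup a i) → TermRoot e z a
  termRoot e {z} {a} z#0 ok with em-lower ℓ₂ em {HasRoot e z}
  ... | no ¬root       = contradiction (inj₁ ¬root) ok
  ... | yes (β , β^e)  = record
      { β = β
      ; β#0 = F.≉⇒# λ β≈0 → F.#⇒≉ z#0 (F.trans (F.sym β^e) (F.trans (F.^-congˡ e β≈0) (F.0^ e)))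
      ; β^e = β^e
      ; b = proj₁ (divide a (λ i e∤ → ok (inj₂ (i , e∤))))
      ; eb≡a = proj₂ (divide a (λ i e∤ → ok (inj₂ (i , e∤)))) }
    where
    divide : ∀ {n} (a : Vec ℕ n) → (∀ i → ¬ e ∤ lookup a i) → ∃[ b ] e ⊗ b ≡ a
    divide []      h = [] , refl
    divide (x ∷ a) h with e ∣? x
    ... | no e∤x            = contradiction e∤x (h zero)
    ... | yes (divides t eq) = let b , eq′ = divide a (h ∘ suc) in
        t ∷ b , cong₂ _∷_ (trans (ℕ.*-comm e t) (sym eq)) eq′

-- Substitutions and their effect

infix 4 _≤ᵥ_
_≤ᵥ_ : ∀ {n} → Vec ℕ n → Vec ℕ n → Set
_≤ᵥ_ = Pointwise _≤_

infixl 6 _∸ᵥ_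
_∸ᵥ_ : ∀ {n} → Vec ℕ n → Vec ℕ n → Vec ℕ n
_∸ᵥ_ = zipWith ℕ._∸_

module _ where
  open ≡ using (refl; sym; trans; cong; cong₂)

  ≤ᵥ-⊕ : ∀ {n} (b u : Vec ℕ n) → b ≤ᵥ b ⊕ u
  ≤ᵥ-⊕ []      []      = []
  ≤ᵥ-⊕ (x ∷ b) (y ∷ u) = ℕ.m≤m+n x y ∷ ≤ᵥ-⊕ b u

  ≤ᵥ-shear : ∀ {n b a} (u : Vec ℕ n) {j} → b ≤ᵥ a → 0 < j → b ≤ᵥ u ⊕ j ⊗ a
  ≤ᵥ-shear []      []          0<j = []
  ≤ᵥ-shear (x ∷ u) {suc j} (l ∷ ls) 0<j =
    ℕ.≤-trans l (ℕ.≤-trans (ℕ.m≤m+n _ _) (ℕ.m≤n+m _ x)) ∷ ≤ᵥ-shear u ls 0<j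

  ≤ᵥ-⊗ : ∀ {n} e .{{_ : NonZero e}} (b : Vec ℕ n) → b ≤ᵥ e ⊗ b
  ≤ᵥ-⊗ e []      = []
  ≤ᵥ-⊗ e (x ∷ b) = ℕ.m≤n*m x e ∷ ≤ᵥ-⊗ e b

  ⊕-∸ᵥ : ∀ {n} {b s : Vec ℕ n} → b ≤ᵥ s → b ⊕ (s ∸ᵥ b) ≡ s
  ⊕-∸ᵥ []       = refl
  ⊕-∸ᵥ (l ∷ ls) = cong₂ _∷_ (ℕ.m+[n∸m]≡n l) (⊕-∸ᵥ ls)

  ⊕-0⊗-∸ᵥ : ∀ {n} (b a : Vec ℕ n) → (b ⊕ 0 ⊗ a) ∸ᵥ b ≡ 0s
  ⊕-0⊗-∸ᵥ []      []      = refl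
  ⊕-0⊗-∸ᵥ (x ∷ b) (_ ∷ a) = cong₂ _∷_ (ℕ.m+n∸m≡n x 0) (⊕-0⊗-∸ᵥ b a)

  pos-∸ : ∀ {m n} → m ≤ n → ℤ.- pos m ℤ.+ pos n ≡ pos (n ℕ.∸ m)
  pos-∸ {m} {n} l = trans (ℤ.+-comm (ℤ.- pos m) (pos n)) (trans (ℤ.m-n≡m⊖n n m) (ℤ.⊖-≥ l))

  neg-⊕-pos : ∀ {n} {a s : Vec ℕ n} → a ≤ᵥ s →
              zipWith ℤ._+_ (Vec.map (λ j → ℤ.- pos j) a) (Vec.map pos s) ≡ Vec.map pos (s ∸ᵥ a)
  neg-⊕-pos []       = refl
  neg-⊕-pos (l ∷ ls) = cong₂ _∷_ (pos-∸ l) (neg-⊕-pos ls)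

  unshear-shear : ∀ {n} j (b u a : Vec ℕ n) → b ≤ᵥ u ⊕ j ⊗ a →
                  zipWith ℤ._+_ (Vec.map pos b) (unshear j ((u ⊕ j ⊗ a) ∸ᵥ b) a) ≡ Vec.map pos u
  unshear-shear j []      []      []      []       = refl
  unshear-shear j (x ∷ b) (z ∷ u) (s ∷ a) (l ∷ ls) = cong₂ _∷_
    (trans (cong (λ r → pos x ℤ.+ (r ℤ.+ ℤ.- pos (j ℕ.* s))) (sym (pos-∸ l)))
      (trans (cong (λ r → pos x ℤ.+ (ℤ.- pos x ℤ.+ r ℤ.+ ℤ.- pos (j ℕ.* s))) (ℤ.pos-+ z (j ℕ.* s)))
        (solve 3 (λ x z t → x :+ (:- x :+ (z :+ t) :+ :- t) := z) refl (pos x) (pos z) (pos (j ℕ.* s)))))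
    (unshear-shear j b u a ls)
    where open ℤSolver.+-*-Solver

-- The substitutions of the procedure, and normalisation by a lightest term

module Homogenization {c ℓ₁ ℓ₂} (em : ExcludedMiddle (c ⊔ ℓ₁ ⊔ ℓ₂)) (F : HeytingField c ℓ₁ ℓ₂) where
  open Sums em F
  open Monomials em F
  open F using (Carrier; _≈_; _#_; 0#; 1#; _·_)
  open Reconstruction F
  open Exponents using (Exp)
  open Sum
  open ≡ using (refl; sym; trans; cong; cong₂; subst)
  open SetoidReasoning F.setoid

  ▹-monomial-* : ∀ {X} x s (q : Sum X) φ → (monomial x s * q) ▹ φ ≈ x F.* (q ▹ (λ v → φ (Exponents._∙_ X s v)))
  ▹-monomial-* {X} x s q φ = F.trans (▹-* (monomial x s) q φ)
    (▹-monomial {X} x s (λ u → q ▹ (λ v → φ (Exponents._∙_ X u v))))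

  y-isMonomial : ∀ {n} → IsMonomial 1# (1 ∷ 0s) (y {n})
  y-isMonomial {n} = monomial-isMonomial {ℕ^ (suc n)} 1# (1 ∷ 0s)

  x-isMonomial : ∀ {n} (i : Fin n) → IsMonomial 1# (0 ∷ unit i) (x i)
  x-isMonomial {n} i = monomial-isMonomial {ℕ^ (suc n)} 1# (0 ∷ unit i)

  transform-cong : ∀ {X Y χ Θ} {p q : Sum X} → p ≈ₚ q → transform {X} {Y} χ Θ p ≈ₚ transform χ Θ q
  transform-cong {X} {Y} {χ} {Θ} {p} {q} eq = ▹⇒≈ₚ {p = transform {X} {Y} χ Θ p} {q = transform χ Θ q} λ φ →
    F.trans (▹-transform χ Θ p φ) (F.trans (≈ₚ⇒▹ {p = p} {q = q} eq _) (F.sym (▹-transform χ Θ q φ)))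

  transform-supp : ∀ {X Y χ Θ} {p : Sum X} {q : Sum Y} → IsTransform χ Θ p q → ∀ {ℓ} (Q : Exp Y → Set ℓ) →
    (∀ u → u ∈supp p → Q (Θ u)) → ∀ {v} → v ∈supp q → Dec (Q v) → Q v
  transform-supp tr Q h s (yes Qv) = Qv
  transform-supp {X} {Y} {χ} {Θ} {p} {q} tr Q h {v} s (no ¬Qv) = contradiction
    (F.trans (coeff≈▹ q v) (F.trans (tr (δ v)) (F.trans
      (▹-supp p λ u us → F.trans (F.*-congˡ (δ-≢ {Y} λ { refl → ¬Qv (h u us) })) (F.zeroʳ _)) (▹-0 p))))
    (F.#⇒≉ s)

  module _ {n m} (M : MonomialMap n (ℕ^ m)) where
    open MonomialMap M
    private
      T : Poly n → Poly m
      T = transform χ Θ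

    transform-* : ∀ p q → T (p * q) ≈ₚ T p * T q
    transform-* p q = ▹⇒≈ₚ {p = T (p * q)} {q = T p * T q} λ φ → begin
      T (p * q) ▹ φ                                           ≈⟨ ▹-transform χ Θ (p * q) φ ⟩
      (p * q) ▹ (λ u → χ u F.* φ (Θ u))                       ≈⟨ ▹-* p q _ ⟩
      p ▹ (λ u → q ▹ (λ v → χ (u ⊕ v) F.* φ (Θ (u ⊕ v))))
        ≈⟨ ▹-cong p (λ u → F.trans (▹-cong q λ v →
             F.trans (F.*-cong (χ-+ u v) (F.reflexive (cong φ (Θ-+ u v)))) (F.*-assoc _ _ _)) (▹-scale q (χ u) _)) ⟩
      p ▹ (λ u → χ u F.* (q ▹ (λ v → χ v F.* φ (Θ u ⊕ Θ v)))) ≈⟨ ▹-cong p (λ u → F.*-congˡ (▹-transform χ Θ q _)) ⟨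
      p ▹ (λ u → χ u F.* (T q ▹ (λ v → φ (Θ u ⊕ v))))         ≈⟨ ▹-transform χ Θ p (λ u → T q ▹ (λ v → φ (u ⊕ v))) ⟨
      T p ▹ (λ u → T q ▹ (λ v → φ (u ⊕ v)))                   ≈⟨ ▹-* (T p) (T q) φ ⟨
      (T p * T q) ▹ φ                                         ∎

    transform-^ : ∀ p k → T (p ^ k) ≈ₚ T p ^ k
    transform-^ p zero    = ▹⇒≈ₚ {p = T (const 1#)} {q = const 1#} λ φ →
      F.trans (▹-transform χ Θ (const 1#) φ) (F.trans (▹-monomial {ℕ^ n} 1# 0s (λ u → χ u F.* φ (Θ u)))
        (F.trans (F.*-congˡ (F.trans (F.*-cong χ-0 (F.reflexive (cong φ Θ-0))) (F.*-identityˡ _)))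
          (F.sym (▹-monomial {ℕ^ m} 1# 0s φ))))
    transform-^ p (suc k) u = F.trans (transform-* p (p ^ k) u)
      (Ring.*-cong (ℕ^-laws m) {T p} {T p} {T (p ^ k)} {T p ^ k} (λ _ → F.refl) (transform-^ p k) u)

  -- Multiplication by a term shifts the coefficients along an injective map and scales them by a
  -- unit. Identities between quotients can thus be proved after clearing the denominator.
  monomial-cancel : ∀ {n z s} (P Q : Poly n) → z # 0# → P * monomial z s ≈ₚ Q * monomial z s → P ≈ₚ Q
  monomial-cancel {n} {z} {s} P Q z#0 eq u = F.*-cancelˡ-# z#0 (begin
    z F.* coeff P u                ≈⟨ pick P ⟨
    (monomial z s * P) ▹ δ (s ⊕ u) ≈⟨ ≈ₚ⇒▹ {p = monomial z s * P} {q = monomial z s * Q} swapped (δ (s ⊕ u)) ⟩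
    (monomial z s * Q) ▹ δ (s ⊕ u) ≈⟨ pick Q ⟩
    z F.* coeff Q u                ∎)
    where
    ⊕-cancel : ∀ {n} (s : Vec ℕ n) {u v} → s ⊕ u ≡ s ⊕ v → u ≡ v
    ⊕-cancel []      {[]}    {[]}    eq = refl
    ⊕-cancel (x ∷ s) {y ∷ u} {z ∷ v} eq = cong₂ _∷_
      (ℕ.+-cancelˡ-≡ x y z (Vec.∷-injectiveˡ eq)) (⊕-cancel s (Vec.∷-injectiveʳ eq))
    pick : ∀ R → (monomial z s * R) ▹ δ (s ⊕ u) ≈ z F.* coeff R u
    pick R = F.trans (▹-monomial-* z s R (δ (s ⊕ u))) (F.*-congˡ (F.trans
      (▹-single R u λ v _ v≢u → δ-≢ {ℕ^ n} λ same → v≢u (⊕-cancel s same))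
      (F.trans (F.*-congˡ (δ-≡ {ℕ^ n} refl)) (F.*-identityʳ _))))
    swapped : monomial z s * P ≈ₚ monomial z s * Q
    swapped v = F.trans (Ring.*-comm (ℕ^-laws n) (monomial z s) P v)
      (F.trans (eq v) (Ring.*-comm (ℕ^-laws n) Q (monomial z s) v))

  module Weighted {n : ℕ} (k a : Vec ℕ n) (z : Carrier) where

    w : Vec ℕ n → ℕ
    w u = ⟨ u , k ⟩

    -- The x-exponent of x^u y^j once y has been replaced by z x^a y.
    shear : ℕ → Vec ℕ n → Vec ℕ n
    shear j u = u ⊕ j ⊗ a

    weightMap : MonomialMap n (ℕ^ (suc n))
    weightMap = record
      { χ = λ _ → 1# ; Θ = λ u → w u ∷ u
      ; χ-0 = F.refl ; χ-+ = λ _ _ → F.sym (F.*-identityˡ 1#)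
      ; Θ-0 = cong (_∷ 0s) (⟨⟩-0 k) ; Θ-+ = λ u v → cong (_∷ u ⊕ v) (⟨⟩-+ u v k) }

    shearMap : MonomialMap (suc n) (ℕ^ (suc n))
    shearMap = record
      { χ = λ { (j ∷ u) → z F.^ j } ; Θ = λ { (j ∷ u) → j ∷ shear j u }
      ; χ-0 = F.refl ; χ-+ = λ { (i ∷ u) (j ∷ v) → F.^-homo-* z i j }
      ; Θ-0 = cong (0 ∷_) (trans (cong (0s ⊕_) (0⊗ a)) (⊕-identityʳ 0s))
      ; Θ-+ = λ { (i ∷ u) (j ∷ v) → cong (i ℕ.+ j ∷_) (shear-+ i j u v a) } }

    unshearMap : Carrier → MonomialMap (suc n) (ℤ^ (suc n))
    unshearMap z⁻¹ = record
      { χ = λ { (j ∷ u) → z⁻¹ F.^ j } ; Θ = λ { (j ∷ u) → pos j ∷ unshear j u a }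
      ; χ-0 = F.refl ; χ-+ = λ { (i ∷ u) (j ∷ v) → F.^-homo-* z⁻¹ i j }
      ; Θ-0 = cong (pos 0 ∷_) (trans (unshear-0 0s a) (Vec.map-replicate pos 0 n))
      ; Θ-+ = λ { (i ∷ u) (j ∷ v) → cong₂ _∷_ (ℤ.pos-+ i j) (unshear-+ i j u v a) } }

    -- The weight substitution followed by the shear. As a homomorphism between polynomial rings,
    -- with no division by lightest terms, it commutes with e-th powers.
    homogenize : MonomialMap n (ℕ^ (suc n))
    homogenize = record
      { χ = λ u → z F.^ w u ; Θ = λ u → w u ∷ shear (w u) u
      ; χ-0 = F.^-congʳ z (⟨⟩-0 k)
      ; χ-+ = λ u v → F.trans (F.^-congʳ z (⟨⟩-+ u v k)) (F.^-homo-* z (w u) (w v))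
      ; Θ-0 = cong₂ _∷_ (⟨⟩-0 k) (trans (cong (λ j → shear j 0s) (⟨⟩-0 k)) (trans (cong (0s ⊕_) (0⊗ a)) (⊕-identityʳ 0s)))
      ; Θ-+ = λ u v → cong₂ _∷_ (⟨⟩-+ u v k)
          (trans (cong (λ j → shear j (u ⊕ v)) (⟨⟩-+ u v k)) (shear-+ (w u) (w v) u v a)) }

    evalWeights : ∀ p → IsTransform (λ _ → 1#) (λ u → w u ∷ u) p (eval (λ i → x i * y ^ lookup k i) p)
    evalWeights = eval-isTransform (ℕ^-laws (suc n)) (λ i → x i * y ^ lookup k i) weightMap λ i →
      IsMonomial-resp (F.trans (F.*-identityˡ _) (F.1^ (lookup k i)))
        (trans (cong (λ v → (0 ∷ unit i) ⊕ (lookup k i ℕ.* 1 ∷ v)) (⊗-0s (lookup k i)))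
          (cong₂ _∷_ (trans (ℕ.*-identityʳ _) (sym (⟨⟩-unit i k))) (⊕-identityʳ (unit i))))
        (IsMonomial-* {p = x i} {q = y ^ lookup k i} (x-isMonomial i) (IsMonomial-^ {p = y} y-isMonomial (lookup k i)))

    evalShear : ∀ p → IsTransform (MonomialMap.χ shearMap) (MonomialMap.Θ shearMap) p
                        (eval ((y * monomial z (0 ∷ a)) Vector.∷ x) p)
    evalShear = eval-isTransform (ℕ^-laws (suc n)) ((y * monomial z (0 ∷ a)) Vector.∷ x) shearMap λ
      { zero → IsMonomial-resp (F.*-comm 1# z) (cong (λ v → 1 ∷ 0s ⊕ v) (sym (1⊗ a)))
          (IsMonomial-* {p = y} {q = monomial z (0 ∷ a)} y-isMonomial (monomial-isMonomial {ℕ^ (suc n)} z (0 ∷ a)))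
      ; (suc i) → IsMonomial-resp F.refl (cong (0 ∷_) (sym (trans (cong (unit i ⊕_) (0⊗ a)) (⊕-identityʳ (unit i)))))
          (x-isMonomial i) }

    evalUnshear : ∀ z⁻¹ p → IsTransform (MonomialMap.χ (unshearMap z⁻¹)) (MonomialMap.Θ (unshearMap z⁻¹)) p
      (eval ((embed y * monomial z⁻¹ (Vec.map (λ j → ℤ.- pos j) (0 ∷ a))) Vector.∷ (embed ∘ x)) p)
    evalUnshear z⁻¹ = eval-isTransform (ℤ^-laws (suc n))
      ((embed y * monomial z⁻¹ (Vec.map (λ j → ℤ.- pos j) (0 ∷ a))) Vector.∷ (embed ∘ x)) (unshearMap z⁻¹) λ
      { zero → IsMonomial-resp (F.*-comm 1# z⁻¹)
          (cong (pos 1 ∷_) (trans (cong₂ (zipWith ℤ._+_) (Vec.map-replicate pos 0 n) refl)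
            (trans (Vec.zipWith-identityˡ ℤ.+-identityˡ _) (sym (unshear-1 a)))))
          (IsMonomial-* {p = embed y} {q = monomial z⁻¹ (Vec.map (λ j → ℤ.- pos j) (0 ∷ a))}
            (embed-isMonomial {p = y} y-isMonomial) (monomial-isMonomial {ℤ^ (suc n)} z⁻¹ _))
      ; (suc i) → IsMonomial-resp F.refl (cong (pos 0 ∷_) (sym (unshear-0 (unit i) a)))
          (embed-isMonomial {p = x i} (x-isMonomial i)) }

    -- The polynomial γ⁻¹ x^{-b} y^{-⟨b,k⟩} h(x₁y^{k₁},…,xₙy^{kₙ}) with y replaced by z x^a y.
    module Normalized (h : Poly n) (b : Vec ℕ n) (γ γ⁻¹ : Carrier) (γ⁻¹γ≈1 : γ⁻¹ F.* γ ≈ 1#)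
      (low : ∀ u → u ∈supp h → w b ≤ w u × b ≤ᵥ shear (w u ℕ.∸ w b) u) where

      ht : Vec ℕ n → ℕ
      ht u = w u ℕ.∸ w b

      χ : Vec ℕ n → Carrier
      χ u = γ⁻¹ F.* z F.^ ht u

      θ : Vec ℕ n → Vec ℕ (suc n)
      θ u = ht u ∷ shear (ht u) u ∸ᵥ b

      -- The image of γ x^b under `homogenize`. The normalised polynomial is the image of h divided
      -- by this term; `homogenization` states that quotient multiplied out.
      unit-term : Poly (suc n)
      unit-term = monomial (γ F.* z F.^ w b) (w b ∷ shear (w b) b)

      homogenization : ∀ {P} → IsTransform χ θ h P →
        P * unit-term ≈ₚ transform (MonomialMap.χ homogenize) (MonomialMap.Θ homogenize) h
      homogenization {P} tr = ▹⇒≈ₚ {p = P * unit-term} {q = T} λ φ → begin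
        (P * unit-term) ▹ φ
          ≈⟨ ≈ₚ⇒▹ {p = P * unit-term} {q = unit-term * P} (Ring.*-comm (ℕ^-laws (suc n)) P unit-term) φ ⟩
        (unit-term * P) ▹ φ                                     ≈⟨ ▹-monomial-* _ _ P φ ⟩
        (γ F.* z F.^ w b) F.* (P ▹ (λ v → φ (s ⊕ v)))           ≈⟨ F.*-congˡ (tr _) ⟩
        (γ F.* z F.^ w b) F.* (h ▹ (λ u → χ u F.* φ (s ⊕ θ u))) ≈⟨ ▹-scale h _ _ ⟨
        h ▹ (λ u → (γ F.* z F.^ w b) F.* (χ u F.* φ (s ⊕ θ u)))
          ≈⟨ ▹-supp h (λ u us → F.trans (F.sym (F.*-assoc _ _ _))
               (F.*-cong (coefficient u (proj₁ (low u us))) (F.reflexive (cong φ (exponent u (low u us)))))) ⟩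
        h ▹ (λ u → z F.^ w u F.* φ (w u ∷ shear (w u) u))       ≈⟨ ▹-transform _ _ h φ ⟨
        T ▹ φ                                                   ∎
        where
        T : Poly (suc n)
        T = transform (MonomialMap.χ homogenize) (MonomialMap.Θ homogenize) h
        s : Vec ℕ (suc n)
        s = w b ∷ shear (w b) b
        coefficient : ∀ u → w b ≤ w u → (γ F.* z F.^ w b) F.* χ u ≈ z F.^ w u
        coefficient u l = begin
          (γ F.* z F.^ w b) F.* (γ⁻¹ F.* z F.^ ht u)
            ≈⟨ solve 4 (λ g s r t → (g :* s) :* (r :* t) := (r :* g) :* (s :* t)) F.refl γ _ γ⁻¹ _ ⟩
          (γ⁻¹ F.* γ) F.* (z F.^ w b F.* z F.^ ht u) ≈⟨ F.*-cong γ⁻¹γ≈1 (F.sym (F.^-homo-* z (w b) (ht u))) ⟩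
          1# F.* z F.^ (w b ℕ.+ ht u)                ≈⟨ F.*-identityˡ _ ⟩
          z F.^ (w b ℕ.+ ht u)                       ≈⟨ F.^-congʳ z (ℕ.m+[n∸m]≡n l) ⟩
          z F.^ w u                                  ∎
          where open F.Solver
        exponent : ∀ u → w b ≤ w u × b ≤ᵥ shear (ht u) u → s ⊕ θ u ≡ w u ∷ shear (w u) u
        exponent u (l , ls) = cong₂ _∷_ (ℕ.m+[n∸m]≡n l)
          (trans (swap b (w b ⊗ a) (shear (ht u) u ∸ᵥ b)) (trans (cong (_⊕ w b ⊗ a) (⊕-∸ᵥ ls))
            (trans (collect (ht u) (w b) u a) (cong (λ j → shear j u) (ℕ.m∸n+n≡m l)))))
          where
          swap : ∀ {n} (b c d : Vec ℕ n) → (b ⊕ c) ⊕ d ≡ (b ⊕ d) ⊕ c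
          swap []      []      []      = refl
          swap (x ∷ b) (y ∷ c) (z ∷ d) = cong₂ _∷_
            (trans (ℕ.+-assoc x y z) (trans (cong (x ℕ.+_) (ℕ.+-comm y z)) (sym (ℕ.+-assoc x z y)))) (swap b c d)
          collect : ∀ {n} i j (u a : Vec ℕ n) → (u ⊕ i ⊗ a) ⊕ j ⊗ a ≡ u ⊕ (i ℕ.+ j) ⊗ a
          collect i j []      []      = refl
          collect i j (x ∷ u) (s ∷ a) = cong₂ _∷_
            (trans (ℕ.+-assoc x _ _) (cong (x ℕ.+_) (sym (ℕ.*-distribʳ-+ s i j)))) (collect i j u a)

-- The procedure followed on a power f = g^e

module Correctness {c ℓ₁ ℓ₂} (em : ExcludedMiddle (c ⊔ ℓ₁ ⊔ ℓ₂)) (F : HeytingField c ℓ₁ ℓ₂) where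
  open Sums em F
  open Monomials em F
  open LeastTerms em F
  open Homogenization em F
  open Existence em F
  open F using (Carrier; _≈_; _#_; 0#; 1#; _·_)
  open Reconstruction F
  open Exponents using (Exp)
  open Sum
  open ≡ using (refl; sym; trans; cong; cong₂; subst)

  module _ {n : ℕ} (f : Poly n) (e : ℕ) .{{e≢0 : NonZero e}} {d} (W : Weights f d) where
    open Weights W
    open SetoidReasoning F.setoid

    private
      z z⁻¹ : Carrier
      z = coeff f a
      z⁻¹ = inverse a∈supp
    open Weighted k a z

    a-lightest : ∀ u → u ∈supp f → w a ≤ w u
    a-lightest u s with Exponents._≟_ (ℕ^ n) u a
    ... | yes refl = ℕ.≤-refl
    ... | no u≢a   = ℕ.<⇒≤ (a-minimal u s u≢a)

    -- Any exponent other than `a` is heavier by at least 1, so the shear adds at least one copy of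
    -- `a`. This is why dividing by α in step 5 leaves a polynomial.
    low-f : ∀ u → u ∈supp f → w a ≤ w u × a ≤ᵥ shear (w u ℕ.∸ w a) u
    low-f u s with Exponents._≟_ (ℕ^ n) u a
    ... | yes refl = ℕ.≤-refl , ≤ᵥ-⊕ a _
    ... | no u≢a   = ℕ.<⇒≤ (a-minimal u s u≢a) , ≤ᵥ-shear u (Pointwise.refl ℕ.≤-refl) (ℕ.m<n⇒0<n∸m (a-minimal u s u≢a))

    private
      -kf : Vec ℤ (suc n)
      -kf = ℤ.- pos ⟨ a , k ⟩ ∷ replicate n (pos 0)

    F♯-laurent : Laurent (suc n)
    F♯-laurent = monomial 1# -kf * embed (eval (λ i → x i * y ^ lookup k i) f)

    θ♯ : Vec ℕ n → Vec ℕ (suc n)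
    θ♯ u = w u ℕ.∸ w a ∷ u

    F♯-laurent-transform : IsTransform (λ _ → 1#) (λ u → zipWith ℤ._+_ -kf (Vec.map pos (w u ∷ u))) f F♯-laurent
    F♯-laurent-transform φ = begin
      F♯-laurent ▹ φ                                                   ≈⟨ ▹-monomial-* 1# -kf (embed E) φ ⟩
      1# F.* (embed E ▹ (λ v → φ (zipWith ℤ._+_ -kf v)))               ≈⟨ F.*-identityˡ _ ⟩
      embed E ▹ (λ v → φ (zipWith ℤ._+_ -kf v))                        ≈⟨ ▹-embed E _ ⟩
      E ▹ (λ v → φ (zipWith ℤ._+_ -kf (Vec.map pos v)))                ≈⟨ evalWeights f _ ⟩
      f ▹ (λ u → 1# F.* φ (zipWith ℤ._+_ -kf (Vec.map pos (w u ∷ u)))) ∎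
      where
      E : Poly (suc n)
      E = eval (λ i → x i * y ^ lookup k i) f

    F♯-natural : ∀ u → u ∈supp f → zipWith ℤ._+_ -kf (Vec.map pos (w u ∷ u)) ≡ Vec.map pos (θ♯ u)
    F♯-natural u s = cong₂ _∷_ (pos-∸ (a-lightest u s)) (Vec.zipWith-identityˡ ℤ.+-identityˡ (Vec.map pos u))

    module F♯-Descent = Descent {X = ℕ^ n} {f = f} {L = F♯-laurent} {χ = λ _ → 1#} θ♯ F♯-laurent-transform F♯-natural

    module Normal-f = Normalized f a z z⁻¹ (F.inverseˡ a∈supp) low-f

    module _ (F♯ : Poly (suc n)) (F♯≈ : embed F♯ ≈ₚ F♯-laurent) where

      F♯-transform : IsTransform (λ _ → 1#) θ♯ f F♯
      F♯-transform = F♯-Descent.descent-transform F♯ F♯≈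

      -- The exponent `θ♯ v` still contains v, so distinct terms of f stay distinct and none can
      -- cancel.
      ∈f⇒∈F♯ : ∀ {v} → v ∈supp f → θ♯ v ∈supp F♯
      ∈f⇒∈F♯ {v} s = F.#-congʳ (F.sym (begin
        coeff F♯ (θ♯ v)                        ≈⟨ coeff≈▹ F♯ (θ♯ v) ⟩
        F♯ ▹ δ (θ♯ v)                          ≈⟨ F♯-transform (δ (θ♯ v)) ⟩
        f ▹ (λ u → 1# F.* δ (θ♯ v) (θ♯ u))
          ≈⟨ ▹-single f v (λ u _ u≢v → F.trans (F.*-identityˡ _) (δ-≢ {ℕ^ (suc n)} (u≢v ∘ Vec.∷-injectiveʳ))) ⟩
        coeff f v F.* (1# F.* δ (θ♯ v) (θ♯ v)) ≈⟨ F.*-congˡ (F.trans (F.*-identityˡ _) (δ-≡ {ℕ^ (suc n)} refl)) ⟩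
        coeff f v F.* 1#                       ≈⟨ F.*-identityʳ _ ⟩
        coeff f v                              ∎)) s

      private
        α : Poly (suc n)
        α = monomial z (0 ∷ a)
        -a : Vec ℤ (suc n)
        -a = Vec.map (λ j → ℤ.- pos j) (0 ∷ a)
        α⁻¹ : Laurent (suc n)
        α⁻¹ = monomial z⁻¹ -a

      H-laurent : Laurent (suc n)
      H-laurent = α⁻¹ * embed (eval ((y * α) Vector.∷ x) F♯)

      -- Division by α, shear and weights are unwound from the outside in, each turning `φ` into a
      -- functional for the stage before. The coefficients collect to z⁻¹ times a power of z whose
      -- exponent is the height above `a`.
      H-laurent-transform : IsTransform Normal-f.χ
        (λ u → zipWith ℤ._+_ -a (Vec.map pos (Normal-f.ht u ∷ shear (Normal-f.ht u) u))) f H-laurent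
      H-laurent-transform φ = begin
        H-laurent ▹ φ
          ≈⟨ ▹-monomial-* z⁻¹ -a (embed E) φ ⟩
        z⁻¹ F.* (embed E ▹ (λ v → φ (zipWith ℤ._+_ -a v)))
          ≈⟨ F.*-congˡ (▹-embed E _) ⟩
        z⁻¹ F.* (E ▹ (λ v → φ (zipWith ℤ._+_ -a (Vec.map pos v))))
          ≈⟨ F.*-congˡ (evalShear F♯ _) ⟩
        z⁻¹ F.* (F♯ ▹ _)
          ≈⟨ F.*-congˡ (F♯-transform _) ⟩
        z⁻¹ F.* (f ▹ _)
          ≈⟨ ▹-scale f z⁻¹ _ ⟨
        f ▹ _
          ≈⟨ ▹-cong f (λ u → F.trans (F.*-congˡ (F.*-identityˡ _)) (F.sym (F.*-assoc _ _ _))) ⟩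
        f ▹ (λ u → Normal-f.χ u F.* φ (zipWith ℤ._+_ -a (Vec.map pos (Normal-f.ht u ∷ shear (Normal-f.ht u) u)))) ∎
        where
        E : Poly (suc n)
        E = eval ((y * α) Vector.∷ x) F♯

      H-natural : ∀ u → u ∈supp f →
        zipWith ℤ._+_ -a (Vec.map pos (Normal-f.ht u ∷ shear (Normal-f.ht u) u)) ≡ Vec.map pos (Normal-f.θ u)
      H-natural u s = cong (pos (Normal-f.ht u) ∷_) (neg-⊕-pos (proj₂ (low-f u s)))

      module H-Descent = Descent {X = ℕ^ n} {f = f} {L = H-laurent} {χ = Normal-f.χ} Normal-f.θ H-laurent-transform H-natural

      module WithRoot (g : Poly n) (f≈gᵉ : f ≈ₚ g ^ e) where
        open PowerRoot {f = f} {g = g} e f≈gᵉ k a a∈supp a-minimal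

        private
          γ γ⁻¹ : Carrier
          γ = coeff g b
          γ⁻¹ = inverse b∈g

        b≤a : b ≤ᵥ a
        b≤a = subst (b ≤ᵥ_) eb≡a (≤ᵥ-⊗ e b)

        -- Works as for f: one copy of `a` added by the shear also covers `b`, because a = e b.
        low-g : ∀ u → u ∈supp g → w b ≤ w u × b ≤ᵥ shear (w u ℕ.∸ w b) u
        low-g u s with Exponents._≟_ (ℕ^ n) u b
        ... | yes refl = ℕ.≤-refl , ≤ᵥ-⊕ u _
        ... | no u≢b   = ℕ.<⇒≤ (b-minimal u s u≢b) , ≤ᵥ-shear u b≤a (ℕ.m<n⇒0<n∸m (b-minimal u s u≢b))

        module Normal-g = Normalized g b γ γ⁻¹ (F.inverseˡ b∈g) low-g

        -- The root is normalised by its own lightest term but sheared by that of f, the same shear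
        -- that produces H; otherwise its e-th power could not be compared with H.
        G : Poly (suc n)
        G = transform Normal-g.χ Normal-g.θ g

        G-transform : IsTransform Normal-g.χ Normal-g.θ g G
        G-transform = ▹-transform Normal-g.χ Normal-g.θ g

        wa≡ewb : w a ≡ e ℕ.* w b
        wa≡ewb = trans (cong w (sym eb≡a)) (⟨⟩-⊗ e b k)

        unit-termᵉ : Normal-g.unit-term ^ e ≈ₚ Normal-f.unit-term
        unit-termᵉ = ▹⇒≈ₚ {p = Normal-g.unit-term ^ e} {q = Normal-f.unit-term} λ φ → begin
          (Normal-g.unit-term ^ e) ▹ φ
            ≈⟨ IsMonomial-^ {p = Normal-g.unit-term} (monomial-isMonomial {ℕ^ (suc n)} _ _) e φ ⟩
          (γ F.* z F.^ w b) F.^ e F.* φ (e ⊗ (w b ∷ shear (w b) b))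
            ≈⟨ F.*-cong coefficient (F.reflexive (cong φ (cong₂ _∷_ (sym wa≡ewb) exponent))) ⟩
          (z F.* z F.^ w a) F.* φ (w a ∷ shear (w a) a) ≈⟨ ▹-monomial {ℕ^ (suc n)} _ _ φ ⟨
          Normal-f.unit-term ▹ φ                        ∎
          where
          coefficient : (γ F.* z F.^ w b) F.^ e ≈ z F.* z F.^ w a
          coefficient = F.trans (F.^-distrib-* γ (z F.^ w b) e) (F.*-cong coeff-bᵉ
            (F.trans (F.^-assocʳ z (w b) e) (F.^-congʳ z (trans (ℕ.*-comm (w b) e) (sym wa≡ewb)))))
          scale-shear : ∀ {n} e j (b a : Vec ℕ n) → e ⊗ (b ⊕ j ⊗ a) ≡ e ⊗ b ⊕ (e ℕ.* j) ⊗ a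
          scale-shear e j []      []      = refl
          scale-shear e j (x ∷ b) (s ∷ a) = cong₂ _∷_
            (trans (ℕ.*-distribˡ-+ e x (j ℕ.* s)) (cong (e ℕ.* x ℕ.+_) (sym (ℕ.*-assoc e j s)))) (scale-shear e j b a)
          exponent : e ⊗ shear (w b) b ≡ shear (w a) a
          exponent = trans (scale-shear e (w b) b a) (cong₂ (λ v j → v ⊕ j ⊗ a) eb≡a (sym wa≡ewb))

        -- Multiplied by the homogenised lightest term of f, both sides become the homogenisation of
        -- f = g^e; that term is the e-th power of the one for g, and it can be cancelled.
        Gᵉ≈H : ∀ H → IsTransform Normal-f.χ Normal-f.θ f H → G ^ e ≈ₚ H
        Gᵉ≈H H H-transform = monomial-cancel {z = z F.* z F.^ w a} {w a ∷ shear (w a) a} (G ^ e) H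
          (F.x#0y#0→xy#0 a∈supp (F.^-# (w a) a∈supp)) λ u → begin
            coeff (G ^ e * Normal-f.unit-term) u
              ≈⟨ P.*-congˡ {G ^ e} {Normal-g.unit-term ^ e} {Normal-f.unit-term} unit-termᵉ u ⟨
            coeff (G ^ e * Normal-g.unit-term ^ e) u ≈⟨ Exp.^-distrib-* G Normal-g.unit-term e u ⟨
            coeff ((G * Normal-g.unit-term) ^ e) u
              ≈⟨ Exp.^-congˡ e {G * Normal-g.unit-term} {T g} (Normal-g.homogenization {G} G-transform) u ⟩
            coeff (T g ^ e) u                        ≈⟨ transform-^ homogenize g e u ⟨
            coeff (T (g ^ e)) u
              ≈⟨ transform-cong {Y = ℕ^ (suc n)} {χ = MonomialMap.χ homogenize} {MonomialMap.Θ homogenize}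
                   {f} {g ^ e} f≈gᵉ u ⟨
            coeff (T f) u                            ≈⟨ Normal-f.homogenization {H} H-transform u ⟨
            coeff (H * Normal-f.unit-term) u         ∎
          where
          module P = CommutativeRing (Ring.polynomialRing (ℕ^-laws (suc n)))
          module Exp = ExpProperties P.commutativeSemiring
          T : Poly n → Poly (suc n)
          T = transform (MonomialMap.χ homogenize) (MonomialMap.Θ homogenize)

        -- Only `b` has height zero, and there the coefficient γ of g meets the normalising factor
        -- γ⁻¹.
        G-constant-term : ∀ v → coeff G (0 ∷ v) ≈ coeff (const {ℕ^ (suc n)} 1#) (0 ∷ v)
        G-constant-term v = begin
          coeff G (0 ∷ v)                                   ≈⟨ coeff≈▹ G (0 ∷ v) ⟩
          G ▹ δ (0 ∷ v)                                     ≈⟨ G-transform (δ (0 ∷ v)) ⟩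
          g ▹ (λ u → Normal-g.χ u F.* δ (0 ∷ v) (Normal-g.θ u))
            ≈⟨ ▹-single g b (λ u s u≢b → F.trans (F.*-congˡ (δ-≢ {ℕ^ (suc n)} (positive u s u≢b))) (F.zeroʳ _)) ⟩
          γ F.* (Normal-g.χ b F.* δ (0 ∷ v) (Normal-g.θ b)) ≈⟨ F.*-assoc _ _ _ ⟨
          (γ F.* Normal-g.χ b) F.* δ (0 ∷ v) (Normal-g.θ b) ≈⟨ F.*-cong one (F.reflexive (cong (δ (0 ∷ v)) at-b)) ⟩
          1# F.* δ (0 ∷ v) 0s                               ≈⟨ ▹-monomial {ℕ^ (suc n)} 1# 0s (δ (0 ∷ v)) ⟨
          const 1# ▹ δ (0 ∷ v)                              ≈⟨ coeff≈▹ (const {ℕ^ (suc n)} 1#) (0 ∷ v) ⟨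
          coeff (const {ℕ^ (suc n)} 1#) (0 ∷ v)             ∎
          where
          positive : ∀ u → u ∈supp g → u ≢ b → Normal-g.θ u ≢ 0 ∷ v
          positive u s u≢b eq = ℕ.<-irrefl (sym (Vec.∷-injectiveˡ eq)) (ℕ.m<n⇒0<n∸m (b-minimal u s u≢b))
          ht-b : Normal-g.ht b ≡ 0
          ht-b = ℕ.n∸n≡0 (w b)
          one : γ F.* Normal-g.χ b ≈ 1#
          one = F.trans (F.sym (F.*-assoc _ _ _))
            (F.trans (F.*-cong (F.trans (F.*-comm _ _) (F.inverseˡ b∈g)) (F.^-congʳ z ht-b)) (F.*-identityˡ _))
          at-b : Normal-g.θ b ≡ 0s
          at-b = cong₂ _∷_ ht-b (trans (cong (λ j → shear j b ∸ᵥ b) ht-b) (⊕-0⊗-∸ᵥ b a))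

        -- For the heaviest exponent t of g, the exponent e t occurs in f and has height e (⟨t, k⟩ -
        -- ⟨b, k⟩), which is therefore at most D. Replacing e by the smaller q only weakens this.
        G-degree : ∀ {D} q .{{_ : NonZero q}} → q ≤ e → IsYDegree F♯ D → ∀ u → u ∈supp G → Vec.head u ≤ D ℕ./ q
        G-degree {D} q q≤e (_ , max) u s = transform-supp {p = g} {q = G} G-transform (λ v → Vec.head v ≤ D ℕ./ q)
          bound s (Vec.head u ℕ.≤? D ℕ./ q)
          where
          t : Vec ℕ n
          t = proj₁ heaviest
          scaled : q ℕ.* (w t ℕ.∸ w b) ≤ D
          scaled = ℕ.≤-trans (ℕ.*-monoˡ-≤ (w t ℕ.∸ w b) q≤e) (ℕ.≤-trans
            (ℕ.≤-reflexive (trans (ℕ.*-distribˡ-∸ e (w t) (w b)) (cong₂ ℕ._∸_ (sym (⟨⟩-⊗ e t k)) (sym wa≡ewb))))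
            (max _ (e ⊗ t , ∈f⇒∈F♯ (proj₂ (proj₂ heaviest)))))
          bound : ∀ u → u ∈supp g → Normal-g.ht u ≤ D ℕ./ q
          bound u s = ℕ.≤-trans (ℕ.∸-monoˡ-≤ (w b) (proj₁ (proj₂ heaviest) u s))
            (ℕ.≤-trans
              (ℕ.≤-reflexive (sym (trans (cong (ℕ._/ q) (ℕ.*-comm q _)) (ℕ.m*n/n≡m (w t ℕ.∸ w b) q)))) (ℕ./-monoˡ-≤ q scaled))

        module _ (ρ : TermRoot e z a) (R₀ : Poly (suc n)) (R₀≈G : R₀ ≈ₚ G) where
          open TermRoot ρ using (β; β^e) renaming (b to b′; eb≡a to eb′≡a)

          candidate : Laurent (suc n)
          candidate = embed (monomial β (0 ∷ b′)) * eval ((embed y * α⁻¹) Vector.∷ (embed ∘ x)) R₀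

          χ′ : Vec ℕ n → Carrier
          χ′ u = β F.* (Normal-g.χ u F.* z⁻¹ F.^ Normal-g.ht u)

          Θ′ : Vec ℕ n → Vec ℤ (suc n)
          Θ′ u = zipWith ℤ._+_ (Vec.map pos (0 ∷ b′))
            (pos (Normal-g.ht u) ∷ unshear (Normal-g.ht u) (shear (Normal-g.ht u) u ∸ᵥ b) a)

          candidate-transform : IsTransform χ′ Θ′ g candidate
          candidate-transform φ = begin
            candidate ▹ φ                 ≈⟨ ▹-monomial-* β B E φ ⟩
            β F.* (E ▹ ψ)                 ≈⟨ F.*-congˡ (evalUnshear z⁻¹ R₀ ψ) ⟩
            β F.* (R₀ ▹ _)                ≈⟨ F.*-congˡ (≈ₚ⇒▹ {p = R₀} {q = G} R₀≈G _) ⟩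
            β F.* (G ▹ _)                 ≈⟨ F.*-congˡ (G-transform _) ⟩
            β F.* (g ▹ _)                 ≈⟨ ▹-scale g β _ ⟨
            g ▹ _
              ≈⟨ ▹-cong g (λ u → F.trans (F.*-congˡ (F.sym (F.*-assoc _ _ _))) (F.sym (F.*-assoc _ _ _))) ⟩
            g ▹ (λ u → χ′ u F.* φ (Θ′ u)) ∎
            where
            B : Vec ℤ (suc n)
            B = Vec.map pos (0 ∷ b′)
            E : Laurent (suc n)
            E = eval ((embed y * α⁻¹) Vector.∷ (embed ∘ x)) R₀
            ψ : Vec ℤ (suc n) → Carrier
            ψ v = φ (zipWith ℤ._+_ B v)

          -- Both are a/e, so the term root chosen in step 4 can differ from the lightest term of g
          -- only in its coefficient.
          b′≡b : b′ ≡ b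
          b′≡b = ⊗-injective e (trans eb′≡a (sym eb≡a))

          -- Unshearing removes the copies of `a` added to g, and the factor x^b of B undoes the
          -- division by x^b. What is left is x^u times y to the height of u, so step 8 ends in a
          -- polynomial.
          candidate-natural : ∀ u → u ∈supp g → Θ′ u ≡ Vec.map pos (Normal-g.ht u ∷ u)
          candidate-natural u s = cong (pos (Normal-g.ht u) ∷_)
            (trans (cong (λ v → zipWith ℤ._+_ (Vec.map pos v)
                            (unshear (Normal-g.ht u) (shear (Normal-g.ht u) u ∸ᵥ b) a)) b′≡b)
              (unshear-shear (Normal-g.ht u) b u a (proj₂ (low-g u s))))

          module Candidate = Descent {X = ℕ^ n} {f = g} {L = candidate} {χ = χ′} (λ u → Normal-g.ht u ∷ u)
            candidate-transform candidate-natural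

          dehomogenize : MonomialMap (suc n) (ℕ^ n)
          dehomogenize = record
            { χ = λ _ → 1# ; Θ = Vec.tail ; χ-0 = F.refl ; χ-+ = λ _ _ → F.sym (F.*-identityˡ 1#)
            ; Θ-0 = refl ; Θ-+ = λ { (_ ∷ _) (_ ∷ _) → refl } }

          private
            ζ : Carrier
            ζ = β F.* γ⁻¹

          -- The powers of z brought in by the shear cancel against those of z⁻¹, so every term of g
          -- is scaled by the same factor β γ⁻¹, and setting y = 1 forgets the heights.
          candidate-value : ∀ Q → embed Q ≈ₚ candidate → eval (const 1# Vector.∷ var) Q ≈ₚ const ζ * g
          candidate-value Q eq = ▹⇒≈ₚ {p = eval (const 1# Vector.∷ var) Q} {q = const ζ * g} λ φ → begin
            eval (const 1# Vector.∷ var) Q ▹ φ ≈⟨ evalOne φ ⟩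
            Q ▹ (λ v → 1# F.* φ (Vec.tail v))  ≈⟨ Candidate.descent-transform Q eq _ ⟩
            g ▹ (λ u → χ′ u F.* (1# F.* φ u))  ≈⟨ ▹-cong g (λ u → F.*-cong (χ′≈ζ u) (F.*-identityˡ (φ u))) ⟩
            g ▹ (λ u → ζ F.* φ u)              ≈⟨ ▹-scale g ζ φ ⟩
            ζ F.* (g ▹ φ)                      ≈⟨ Ring.▹-const (ℕ^-laws n) ζ g φ ⟨
            (const ζ * g) ▹ φ                  ∎
            where
            evalOne : IsTransform (λ _ → 1#) Vec.tail Q (eval (const 1# Vector.∷ var) Q)
            evalOne = eval-isTransform (ℕ^-laws n) (const 1# Vector.∷ var) dehomogenize
              (λ { zero → monomial-isMonomial {ℕ^ n} 1# 0s ; (suc i) → monomial-isMonomial {ℕ^ n} 1# (unit i) }) Q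
            χ′≈ζ : ∀ u → χ′ u ≈ ζ
            χ′≈ζ u = begin
              β F.* ((γ⁻¹ F.* z F.^ j) F.* z⁻¹ F.^ j) ≈⟨ F.*-congˡ (F.*-assoc _ _ _) ⟩
              β F.* (γ⁻¹ F.* (z F.^ j F.* z⁻¹ F.^ j))
                ≈⟨ F.*-congˡ (F.*-congˡ (F.trans (F.sym (F.^-distrib-* z z⁻¹ j))
                     (F.trans (F.^-congˡ j (F.trans (F.*-comm z z⁻¹) (F.inverseˡ a∈supp))) (F.1^ j)))) ⟩
              β F.* (γ⁻¹ F.* 1#)                      ≈⟨ F.*-congˡ (F.*-identityʳ γ⁻¹) ⟩
              ζ                                       ∎
              where
              j : ℕ
              j = Normal-g.ht u

          candidate-correct : ∀ Q → embed Q ≈ₚ candidate → eval (const 1# Vector.∷ var) Q ^ e ≈ₚ f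
          candidate-correct Q eq = ▹⇒≈ₚ {p = eval (const 1# Vector.∷ var) Q ^ e} {q = f} λ φ → begin
            (eval (const 1# Vector.∷ var) Q ^ e) ▹ φ
              ≈⟨ ≈ₚ⇒▹ {p = eval (const 1# Vector.∷ var) Q ^ e} {q = (const ζ * g) ^ e}
                   (Exp.^-congˡ e {eval (const 1# Vector.∷ var) Q} {const ζ * g} (candidate-value Q eq)) φ ⟩
            ((const ζ * g) ^ e) ▹ φ
              ≈⟨ ≈ₚ⇒▹ {p = (const ζ * g) ^ e} {q = const ζ ^ e * g ^ e} (Exp.^-distrib-* (const ζ) g e) φ ⟩
            (const ζ ^ e * g ^ e) ▹ φ ≈⟨ ▹-* (const ζ ^ e) (g ^ e) φ ⟩
            (const ζ ^ e) ▹ _         ≈⟨ IsMonomial-^ {p = const ζ} (monomial-isMonomial {ℕ^ n} ζ 0s) e _ ⟩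
            ζ F.^ e F.* ((g ^ e) ▹ (λ v → φ (e ⊗ 0s ⊕ v)))
              ≈⟨ F.*-cong ζᵉ≈1 (▹-cong (g ^ e) (λ v → F.reflexive (cong φ (trans (cong (_⊕ v) (⊗-0s e)) (⊕-identityˡ v))))) ⟩
            1# F.* ((g ^ e) ▹ φ)      ≈⟨ F.*-identityˡ _ ⟩
            (g ^ e) ▹ φ               ≈⟨ ≈ₚ⇒▹ {p = f} {q = g ^ e} f≈gᵉ φ ⟨
            f ▹ φ                     ∎
            where
            module P = CommutativeRing (Ring.polynomialRing (ℕ^-laws n))
            module Exp = ExpProperties P.commutativeSemiring
            ζᵉ≈1 : ζ F.^ e ≈ 1#
            ζᵉ≈1 = begin
              (β F.* γ⁻¹) F.^ e     ≈⟨ F.^-distrib-* β γ⁻¹ e ⟩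
              β F.^ e F.* γ⁻¹ F.^ e ≈⟨ F.*-congʳ (F.trans β^e (F.sym coeff-bᵉ)) ⟩
              γ F.^ e F.* γ⁻¹ F.^ e ≈⟨ F.^-distrib-* γ γ⁻¹ e ⟨
              (γ F.* γ⁻¹) F.^ e     ≈⟨ F.^-congˡ e (F.trans (F.*-comm γ γ⁻¹) (F.inverseˡ b∈g)) ⟩
              1# F.^ e              ≈⟨ F.1^ e ⟩
              1#                    ∎

        e∣a : ∀ i → e ∣ lookup a i
        e∣a i = subst (λ v → e ∣ lookup v i) eb≡a (subst (e ∣_) (sym (Vec.lookup-map i (e ℕ.*_) b)) (∣.m∣m*n (lookup b i)))

        hasRoot : HasRoot e z
        hasRoot = γ , coeff-bᵉ

-- The traversal of the procedure

module Run {c ℓ₁ ℓ₂} (em : ExcludedMiddle (c ⊔ ℓ₁ ⊔ ℓ₂)) (F : HeytingField c ℓ₁ ℓ₂) where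
  open Sums em F using (module F; ℕ^-laws; module Ring)
  open Existence em F
  open Correctness em F
  open F using (_≈_; _#_; 0#; 1#; _·_)
  open Reconstruction F

  -- `Post` is left abstract: `ret` is called only after the final test, `fail` only with a proof
  -- that f has no root. The two halves of the theorem instantiate it, the first making `fail`
  -- vacuous and the second `ret`.
  module _ {n s} (f : Poly n) (e : ℕ) (2≤e : 2 ≤ e) (Post : Output n → Set s)
    (ret : ∀ g̃ → g̃ ^ e ≈ₚ f → Post (returns g̃))
    (fail : ¬ (∃[ g ] f ≈ₚ g ^ e) → Post notAnEthPower) where

    private
      instance
        e≢0 : NonZero e
        e≢0 = ℕ.>-nonZero (ℕ.<-trans ℕ.z<s 2≤e)

    module _ {d} (W : Weights f d)
      (F♯ : Poly (suc n)) (F♯≈ : embed F♯ ≈ₚ F♯-laurent f e W)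
      (ρ : TermRoot e (coeff f (Weights.a W)) (Weights.a W))
      (H : Poly (suc n)) (H≈ : embed H ≈ₚ H-laurent f e W F♯ F♯≈) where

      open Weights W
      private
        module OfRoot g f≈gᵉ = WithRoot f e W F♯ F♯≈ g f≈gᵉ

      Gᵉ≈H : ∀ g f≈gᵉ → OfRoot.G g f≈gᵉ ^ e ≈ₚ H
      Gᵉ≈H g f≈gᵉ = OfRoot.Gᵉ≈H g f≈gᵉ H (H-Descent.descent-transform f e W F♯ F♯≈ H H≈)

      -- The common end of both branches of step 6: q is the part of e prime to p, or e itself. The
      -- hypothesis `H′≈Gᑫ` takes the root as an argument because the run must also be described
      -- when there is none.
      module _ (q : ℕ) .{{_ : NonZero q}} (q#0 : q · 1# # 0#) (q≤e : q ≤ e)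
        (H′ : Poly (suc n)) (H′≈Gᑫ : ∀ g f≈gᵉ → H′ ≈ₚ OfRoot.G g f≈gᵉ ^ q) where

        candidate : ∀ {D} → BinomialImages q → Laurent (suc n)
        candidate {D} γ = embed (monomial (TermRoot.β ρ) (0 Vec.∷ TermRoot.b ρ)) *
          eval ((embed y * monomial (inverse a∈supp) (Vec.map (λ j → ℤ.- pos j) (0 Vec.∷ a))) Vector.∷ (embed ∘ x))
            (truncatedRoot q γ (D ℕ./ q) H′)

        finish :
          choose (∃ (IsYDegree F♯)) λ (D , _) →
          choose (BinomialImages q) λ γ →
          let IsPoly = ∃[ G ] embed G ≈ₚ candidate {D} γ in
          when IsPoly
            do′ (choose IsPoly λ (G , _) →
                 let g-cand = eval (const 1# Vector.∷ var) G in
                 when (g-cand ^ e ≈ₚ f)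
                   do′ Post (returns g-cand)
                   otherwise Post notAnEthPower)
            otherwise Post notAnEthPower
        finish = yDegree F♯ (∈f⇒∈F♯ f e W F♯ F♯≈ a∈supp) , λ (D , isD) →
          BinomialImage.binomialImages em F q q#0 , λ γ →
          let R₀≈G = λ g f≈gᵉ → TruncatedRoot.truncatedRoot-correct em F n q q#0 γ (D ℕ./ q) H′
                (OfRoot.G g f≈gᵉ) (H′≈Gᑫ g f≈gᵉ)
                (TruncatedRoot.≡1-mod-y em F n (OfRoot.G g f≈gᵉ) (OfRoot.G-constant-term g f≈gᵉ))
                (OfRoot.G-degree g f≈gᵉ q q≤e isD)
          in
            (λ isPoly → isPoly , λ (Q , Q≈) →
                ret (eval (const 1# Vector.∷ var) Q)
              , λ wrong → fail λ (g , f≈gᵉ) →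
                  wrong (OfRoot.candidate-correct g f≈gᵉ ρ (truncatedRoot q γ (D ℕ./ q) H′) (R₀≈G g f≈gᵉ) Q Q≈))
          , λ notPoly → fail λ (g , f≈gᵉ) →
              notPoly (OfRoot.Candidate.descend g f≈gᵉ ρ (truncatedRoot q γ (D ℕ./ q) H′) (R₀≈G g f≈gᵉ))

      module _ {p : ℕ} (char : Characteristic p) where

        ∤⇒# : ∀ {q} → ¬ p ∣ q → q · 1# # 0#
        ∤⇒# {q} p∤q = F.≉⇒# (p∤q ∘ Equivalence.to (char q))

        -- Characteristic zero falls under the same criterion, since 0 divides only 0 while e is at
        -- least 2.
        e#0 : ¬ ((0 < p) × (p ∣ e)) → e · 1# # 0#
        e#0 h = ∤⇒# λ p∣e → h (ℕ.n≢0⇒n>0 (λ { ≡.refl → ℕ.<⇒≢ (ℕ.<-trans ℕ.z<s 2≤e) (≡.sym (∣.0∣⇒≡0 p∣e)) }) , p∣e)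

        module _ (0<p : 0 < p) (S : Split p e) where
          open Split S
          private
            instance
              p≢0 : NonZero p
              p≢0 = ℕ.>-nonZero 0<p
            m : ℕ
            m = p ℕ.^ r
            module P = CommutativeRing (Ring.polynomialRing (ℕ^-laws (suc n)))
            module Exp = ExpProperties P.commutativeSemiring

          q≤e : q ≤ e
          q≤e = ℕ.≤-trans (ℕ.m≤n*m q m {{ℕ.m^n≢0 p r}}) (ℕ.≤-reflexive (≡.sym e≡pʳq))

          Gᑫᵐ≈H : ∀ g f≈gᵉ → (OfRoot.G g f≈gᵉ ^ q) ^ m ≈ₚ H
          Gᑫᵐ≈H g f≈gᵉ u = F.trans (Exp.^-assocʳ (OfRoot.G g f≈gᵉ) q m u)
            (F.trans (Exp.^-congʳ (OfRoot.G g f≈gᵉ) (≡.trans (ℕ.*-comm q m) (≡.sym e≡pʳq)) u) (Gᵉ≈H g f≈gᵉ u))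

          termsArePowers : ∀ g → f ≈ₚ g ^ e → TermsArePowers m H
          termsArePowers g f≈gᵉ = Frobenius.^pʳ-termsArePowers em F p char r (OfRoot.G g f≈gᵉ ^ q) H (Gᑫᵐ≈H g f≈gᵉ)

          termwiseRoot≈Gᑫ : (H′ : TermwiseRoot m H) → ∀ g f≈gᵉ → proj₁ H′ ≈ₚ OfRoot.G g f≈gᵉ ^ q
          termwiseRoot≈Gᑫ H′ g f≈gᵉ = Frobenius.termwiseRoot-unique em F p char r (OfRoot.G g f≈gᵉ ^ q) H (Gᑫᵐ≈H g f≈gᵉ) H′

    run : ¬ IsConstant f → reconstruct f e 2≤e Post
    run ¬const =
      indeg f ¬const , λ (d , isIndeg) →
      weights f ¬const isIndeg , λ W → let open Weights W in
      F♯-Descent.descend f e W , λ (F♯ , F♯≈) →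
        (λ bad → fail λ (g , f≈gᵉ) → let open WithRoot f e W F♯ F♯≈ g f≈gᵉ in
           noRoot {a = a} bad hasRoot e∣a)
      , λ good → termRoot e a∈supp good , λ ρ →
      H-Descent.descend f e W F♯ F♯≈ , λ (H , H≈) →
      characteristic , λ (p , char) →
        (λ (0<p , p∣e) → split char 0<p e (ℕ.<-trans ℕ.z<s 2≤e) , λ S → let open Split S in
            (λ powers → termwiseRoot (p ℕ.^ r) {{ℕ.m^n≢0 p r {{ℕ.>-nonZero 0<p}}}} H powers , λ (H′ , root) →
               finish W F♯ F♯≈ ρ H H≈ q {{q≢0}} (∤⇒# W F♯ F♯≈ ρ H H≈ char p∤q) (q≤e W F♯ F♯≈ ρ H H≈ char 0<p S)
                 H′ (termwiseRoot≈Gᑫ W F♯ F♯≈ ρ H H≈ char 0<p S (H′ , root)))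
          , λ notPowers → fail λ (g , f≈gᵉ) → notPowers (termsArePowers W F♯ F♯≈ ρ H H≈ char 0<p S g f≈gᵉ))
      , λ h → finish W F♯ F♯≈ ρ H H≈ e (e#0 W F♯ F♯≈ ρ H H≈ char h) ℕ.≤-refl H
          (λ g f≈gᵉ u → F.sym (Gᵉ≈H W F♯ F♯≈ ρ H H≈ g f≈gᵉ u))
      where
      noRoot : ∀ {z} {a : Vec ℕ n} → ¬ HasRoot e z ⊎ (∃[ i ] e ∤ lookup a i) → HasRoot e z → ¬ (∀ i → e ∣ lookup a i)
      noRoot (inj₁ ¬root)     root _   = ¬root root
      noRoot (inj₂ (i , e∤a)) _    e∣a = e∤a (e∣a i)

proposition5p1 : ∀ {c ℓ₁ ℓ₂} → ExcludedMiddle (c ⊔ ℓ₁ ⊔ ℓ₂) →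
    (F : HeytingField c ℓ₁ ℓ₂) → let open Reconstruction F in
    ∀ {n} (f : Poly n) → ¬ IsConstant f → (e : ℕ) (2≤e : 2 ≤ e) →
    ((∃[ g ] f ≈ₚ g ^ e) →
    reconstruct f e 2≤e (λ o → ∃[ g̃ ] (o ≡ returns g̃) × (g̃ ^ e ≈ₚ f)))
    ×
    (¬ (∃[ g ] f ≈ₚ g ^ e) →
    reconstruct f e 2≤e (λ o → o ≡ notAnEthPower))
proposition5p1 em F f ¬const e 2≤e =
    (λ power → Run.run em F f e 2≤e (λ o → ∃[ g̃ ] (o ≡ returns g̃) × (g̃ ^ e ≈ₚ f))
      (λ g̃ eq → g̃ , ≡.refl , eq) (contradiction power) ¬const)
  , (λ ¬power → Run.run em F f e 2≤e (_≡ notAnEthPower)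
      (λ g̃ eq → contradiction (g̃ , λ u → HeytingField.sym F (eq u)) ¬power) (λ _ → ≡.refl) ¬const)
  where open Reconstruction F
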